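{- For every odd positive integer $k$ and every $x\in[0,1]$, $$\left[x(1-x)\right]^{\frac{k}{2}} = \frac{\pi\,(k!!)^2}{4^{k+1}}\sum_{n\geq 0}\frac{(4n+1)\left[\frac{1}{4^n}\binom{2n}{n}\right]^2}{(n+1)_{\frac{k+1}{2}}\cdot \left(\frac{1}{2}-n\right)_{\frac{k+1}{2}}}\,P_{2n}(2x-1),$$ where the series converges pointwise on $[0,1]$.
   Context: $P_m$ denotes the $m$-th Legendre polynomial on $[-1,1]$, normalized by $P_m(1)=1$. $(a)_j=a(a+1)\cdots(a+j-1)$ denotes the rising Pochhammer symbol. $k!!=k(k-2)\cdots 3\cdot 1$ is the double factorial of the odd integer $k$. -}

module Defs where

open import Data.Bool.Base using (if_then_else_)
open import Data.Empty using (⊥)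
open import Data.Integer.Base as ℤ using (+_; +[1+_]; -[1+_])
import Data.Integer.Properties as ℤP
open import Data.Nat.Base as ℕ using (ℕ; zero; suc)
open import Data.Nat.Combinatorics using (_C_)
open import Data.Nat.DivMod using () renaming (_/_ to _div_)
import Data.Nat.Properties as ℕP
import Data.Integer.Solver
open import Data.Product using (∃; _×_; _,_; proj₁; proj₂)
open import Data.Rational.Base as ℚ using (ℚ; 0ℚ; 1ℚ; ½; mkℚ; NonZero)
import Data.Rational.Properties as ℚP
import Data.Rational.Solver
open import Data.Rational.Unnormalised.Base as ℚᵘ using (mkℚᵘ; *≡*)
import Data.Rational.Unnormalised.Properties as ℚᵘP
open import Data.Sum.Base using (inj₁; inj₂)
open import Relation.Binary.PropositionalEquality
open import Relation.Nullary using (¬_; Dec; yes; no; contradiction; does)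

module RationalLemmas where

  open import Data.Rational.Base using (_+_; _-_; -_; _*_; _/_; _≤_; _<_; ∣_∣; _⊔_; 1/_; *≤*; *<*)
  open Data.Rational.Solver.+-*-Solver

  0<1 : 0ℚ < 1ℚ
  0<1 = *<* (ℤ.+<+ (ℕ.s≤s ℕ.z≤n))

  pos* : ∀ {p q} → 0ℚ < p → 0ℚ < q → 0ℚ < p * q
  pos* {p} {q} 0<p 0<q =
    ℚP.positive⁻¹ (p * q) {{ℚP.pos*pos⇒pos p {{ℚ.positive 0<p}} q {{ℚ.positive 0<q}}}}

  nonNeg* : ∀ {p q} → 0ℚ ≤ p → 0ℚ ≤ q → 0ℚ ≤ p * q
  nonNeg* {p} {q} 0≤p 0≤q =
    ℚP.nonNegative⁻¹ (p * q)
      {{ℚP.nonNeg*nonNeg⇒nonNeg p {{ℚ.nonNegative 0≤p}} q {{ℚ.nonNegative 0≤q}}}}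

  pos+nonNeg : ∀ {p q} → 0ℚ < p → 0ℚ ≤ q → 0ℚ < p + q
  pos+nonNeg 0<p 0≤q = ℚP.+-mono-<-≤ 0<p 0≤q

  nonNeg+pos : ∀ {p q} → 0ℚ ≤ p → 0ℚ < q → 0ℚ < p + q
  nonNeg+pos 0≤p 0<q = ℚP.+-mono-≤-< 0≤p 0<q

  half>0 : ∀ {ε} → 0ℚ < ε → 0ℚ < ε * ½
  half>0 0<ε = pos* 0<ε (ℚP.positive⁻¹ ½)

  half+half : ∀ ε → ε * ½ + ε * ½ ≡ ε
  half+half ε = trans (sym (ℚP.*-distribˡ-+ ε ½ ½)) (ℚP.*-identityʳ ε)

  p≤∣p∣ : ∀ p → p ≤ ∣ p ∣
  p≤∣p∣ p with ℚP.≤-total 0ℚ p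
  ... | inj₁ 0≤p = ℚP.≤-reflexive (sym (ℚP.0≤p⇒∣p∣≡p 0≤p))
  ... | inj₂ p≤0 = ℚP.≤-trans p≤0 (ℚP.0≤∣p∣ p)

  ∣∣-sym : ∀ p q → ∣ p - q ∣ ≡ ∣ q - p ∣
  ∣∣-sym p q = trans (sym (ℚP.∣-p∣≡∣p∣ (p - q)))
    (cong ∣_∣ (solve 2 (λ a b → :- (a :+ :- b) := b :+ :- a) refl p q))

  ∣∣-bound : ∀ {p ε} → p < ε → - p < ε → ∣ p ∣ < ε
  ∣∣-bound {p} {ε} p<ε -p<ε with ℚP.∣p∣≡p∨∣p∣≡-p p
  ... | inj₁ eq = subst (_< ε) (sym eq) p<ε
  ... | inj₂ eq = subst (_< ε) (sym eq) -p<ε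

  <+⇒-< : ∀ {p q ε} → p < q + ε → p - q < ε
  <+⇒-< {p} {q} {ε} p<q+ε =
    subst (p - q <_) (solve 2 (λ a b → a :+ b :+ :- a := b) refl q ε)
      (ℚP.+-monoˡ-< (- q) p<q+ε)

  -<⇒<+ : ∀ {p q ε} → p - q < ε → p < q + ε
  -<⇒<+ {p} {q} {ε} p-q<ε =
    subst₂ _<_ (solve 2 (λ a b → a :+ :- b :+ b := a) refl p q) (ℚP.+-comm ε q)
      (ℚP.+-monoˡ-< q p-q<ε)

  ∣-∣<-intro : ∀ {p q ε} → p < q + ε → q < p + ε → ∣ p - q ∣ < ε
  ∣-∣<-intro {p} {q} {ε} h₁ h₂ = ∣∣-bound (<+⇒-< {p} {q} h₁)
    (subst (_< ε) (solve 2 (λ a b → b :+ :- a := :- (a :+ :- b)) refl p q) (<+⇒-< {q} {p} h₂))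

  ∣-∣<-elim : ∀ {p q ε} → ∣ p - q ∣ < ε → p < q + ε
  ∣-∣<-elim {p} {q} h = -<⇒<+ (ℚP.≤-<-trans (p≤∣p∣ (p - q)) h)

  ∣p∣<∣q∣+ : ∀ {p q ε} → ∣ p - q ∣ < ε → ∣ p ∣ < ∣ q ∣ + ε
  ∣p∣<∣q∣+ {p} {q} {ε} h = ℚP.≤-<-trans
    (subst (λ z → ∣ z ∣ ≤ ∣ q ∣ + ∣ p - q ∣)
      (solve 2 (λ a b → b :+ (a :+ :- b) := a) refl p q) (ℚP.∣p+q∣≤∣p∣+∣q∣ q (p - q)))
    (ℚP.+-monoʳ-< ∣ q ∣ h)

  *-mono-nonNeg : ∀ {a b c d} → 0ℚ ≤ a → 0ℚ ≤ d → a ≤ b → c ≤ d → a * c ≤ b * d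
  *-mono-nonNeg {a} {b} {c} {d} 0≤a 0≤d a≤b c≤d = ℚP.≤-trans
    (ℚP.*-monoˡ-≤-nonNeg a {{ℚ.nonNegative 0≤a}} c≤d)
    (ℚP.*-monoʳ-≤-nonNeg d {{ℚ.nonNegative 0≤d}} a≤b)

  sq-mono : ∀ {a b} → 0ℚ ≤ a → a ≤ b → a * a ≤ b * b
  sq-mono 0≤a a≤b = *-mono-nonNeg 0≤a (ℚP.≤-trans 0≤a a≤b) a≤b a≤b

  ⊔0-mono-< : ∀ {p q δ} → 0ℚ < δ → p < q + δ → p ⊔ 0ℚ < (q ⊔ 0ℚ) + δ
  ⊔0-mono-< {p} {q} {δ} 0<δ h with ℚP.≤-total p 0ℚ
  ... | inj₁ p≤0 = subst (_< (q ⊔ 0ℚ) + δ) (sym (ℚP.p≤q⇒p⊔q≡q p≤0))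
                     (nonNeg+pos (ℚP.p≤q⊔p q 0ℚ) 0<δ)
  ... | inj₂ 0≤p = subst (_< (q ⊔ 0ℚ) + δ) (sym (ℚP.p≥q⇒p⊔q≡p 0≤p))
                     (ℚP.<-≤-trans h (ℚP.+-monoˡ-≤ δ (ℚP.p≤p⊔q q 0ℚ)))

  /-mono-≤ : ∀ a b m n → a ℕ.* suc n ℕ.≤ b ℕ.* suc m → + a / suc m ≤ + b / suc n
  /-mono-≤ a b m n h = ℚP.toℚᵘ-cancel-≤
    (ℚᵘP.≤-respˡ-≃ (ℚᵘP.≃-sym (ℚP.toℚᵘ-fromℚᵘ (mkℚᵘ (+ a) m)))
      (ℚᵘP.≤-respʳ-≃ (ℚᵘP.≃-sym (ℚP.toℚᵘ-fromℚᵘ (mkℚᵘ (+ b) n)))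
        (ℚᵘ.*≤* (subst₂ ℤ._≤_ (ℤP.pos-* a (suc n)) (ℤP.pos-* b (suc m)) (ℤ.+≤+ h)))))

  0≤/ : ∀ a m → 0ℚ ≤ + a / suc m
  0≤/ a m = /-mono-≤ 0 a 0 m ℕ.z≤n

  archimedean : ∀ c ε → 0ℚ < ε → ∃ λ N → ∀ n → N ℕ.≤ n → + c / suc n < ε
  archimedean c (mkℚ (+ 0) d _) (*<* (ℤ.+<+ ()))
  archimedean c (mkℚ -[1+ p ] d _) (*<* ())
  archimedean c ε@(mkℚ +[1+ p ] d _) _ = c ℕ.* suc d , λ n N≤n → ℚP.toℚᵘ-cancel-<
    (ℚᵘP.<-respˡ-≃ (ℚᵘP.≃-sym (ℚP.toℚᵘ-fromℚᵘ (mkℚᵘ (+ c) n)))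
      (ℚᵘ.*<* (subst₂ ℤ._<_ (ℤP.pos-* c (suc d)) (ℤP.pos-* (suc p) (suc n))
        (ℤ.+<+ (ℕP.≤-trans (ℕ.s≤s N≤n) (ℕP.m≤m+n (suc n) (p ℕ.* suc n)))))))

  natural-bound : ∀ q → ∃ λ B → q ≤ + B / 1
  natural-bound q@(mkℚ (+ p) d c) = p , subst (_≤ + p / 1) (ℚP.fromℚᵘ-toℚᵘ q)
    (/-mono-≤ p p d 0 (ℕP.*-monoʳ-≤ p (ℕ.s≤s ℕ.z≤n)))
  natural-bound (mkℚ -[1+ p ] d c) = 0 , *≤* ℤ.-≤+

  ½*/ : ∀ B n → ½ * (+ B / suc n) ≤ + B / suc (suc n)
  ½*/ B n = ℚP.toℚᵘ-cancel-≤
    (ℚᵘP.≤-respˡ-≃ (ℚᵘP.≃-sym (ℚᵘP.≃-trans (ℚP.toℚᵘ-homo-* ½ (+ B / suc n))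
        (ℚᵘP.*-congˡ {mkℚᵘ (+ 1) 1} (ℚP.toℚᵘ-fromℚᵘ (mkℚᵘ (+ B) n)))))
      (ℚᵘP.≤-respʳ-≃ (ℚᵘP.≃-sym (ℚP.toℚᵘ-fromℚᵘ (mkℚᵘ (+ B) (suc n))))
        (ℚᵘ.*≤* (subst₂ ℤ._≤_
          (trans (ℤP.pos-* B (suc (suc n))) (cong (ℤ._* + suc (suc n)) (sym (ℤP.*-identityˡ (+ B)))))
          (ℤP.pos-* B (2 ℕ.* suc n))
          (ℤ.+≤+ (ℕP.*-monoʳ-≤ B (ℕ.s≤s (subst (suc n ℕ.≤_) (sym (ℕP.+-suc n (n ℕ.+ 0)))
            (ℕ.s≤s (ℕP.m≤m+n n (n ℕ.+ 0)))))))))))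

  *-difference : ∀ a b c d → a * c - b * d ≡ a * (c - d) + (a - b) * d
  *-difference = solve 4 (λ a b c d →
    a :* c :+ :- (b :* d) := a :* (c :+ :- d) :+ (a :+ :- b) :* d) refl

  *-close : ∀ {a b c d A B δ} → 0ℚ < A → 0ℚ < B → ∣ a ∣ ≤ A → ∣ d ∣ ≤ B →
            ∣ a - b ∣ < δ → ∣ c - d ∣ < δ → ∣ a * c - b * d ∣ < (A + B) * δ
  *-close {a} {b} {c} {d} {A} {B} {δ} 0<A 0<B a≤A d≤B ab cd = begin-strict
      ∣ a * c - b * d ∣                    ≡⟨ cong ∣_∣ (*-difference a b c d) ⟩
      ∣ a * (c - d) + (a - b) * d ∣        ≤⟨ ℚP.∣p+q∣≤∣p∣+∣q∣ (a * (c - d)) ((a - b) * d) ⟩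
      ∣ a * (c - d) ∣ + ∣ (a - b) * d ∣    ≡⟨ cong₂ _+_ (ℚP.∣p*q∣≡∣p∣*∣q∣ a (c - d)) (ℚP.∣p*q∣≡∣p∣*∣q∣ (a - b) d) ⟩
      ∣ a ∣ * ∣ c - d ∣ + ∣ a - b ∣ * ∣ d ∣
        ≤⟨ ℚP.+-mono-≤
             (ℚP.*-monoʳ-≤-nonNeg ∣ c - d ∣ {{ℚP.∣-∣-nonNeg (c - d)}} a≤A)
             (ℚP.*-monoˡ-≤-nonNeg ∣ a - b ∣ {{ℚP.∣-∣-nonNeg (a - b)}} d≤B) ⟩
      A * ∣ c - d ∣ + ∣ a - b ∣ * B
        <⟨ ℚP.+-mono-< (ℚP.*-monoʳ-<-pos A {{ℚ.positive 0<A}} cd) (ℚP.*-monoˡ-<-pos B {{ℚ.positive 0<B}} ab) ⟩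
      A * δ + δ * B                        ≡⟨ cong (λ z → A * δ + z) (ℚP.*-comm δ B) ⟩
      A * δ + B * δ                        ≡⟨ sym (ℚP.*-distribʳ-+ δ A B) ⟩
      (A + B) * δ                          ∎
    where open ℚP.≤-Reasoning

  scale : ∀ {p ε} → 0ℚ < p → 0ℚ < ε → ∃ λ δ → 0ℚ < δ × p * δ ≡ ε
  scale {p} {ε} 0<p 0<ε = r * ε , pos* 0<r 0<ε ,
    trans (sym (ℚP.*-assoc p r ε))
      (trans (cong (_* ε) (ℚP.*-inverseʳ p {{ℚ.>-nonZero 0<p}})) (ℚP.*-identityˡ ε))
    where
    r : ℚ
    r = (1/ p) {{ℚ.>-nonZero 0<p}}
    0<r : 0ℚ < r
    0<r = ℚP.positive⁻¹ r {{ℚP.1/pos⇒pos p {{ℚ.positive 0<p}}}}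

  nonZero* : ∀ {p q} → NonZero p → NonZero q → NonZero (p * q)
  nonZero* {p} {q} p≢0 q≢0 = ℚ.≢-nonZero λ pq≡0 → contra q q≢0 (begin
      q                  ≡⟨ sym (ℚP.*-identityˡ q) ⟩
      1ℚ * q             ≡⟨ cong (_* q) (sym (ℚP.*-inverseˡ p {{p≢0}})) ⟩
      r * p * q          ≡⟨ ℚP.*-assoc r p q ⟩
      r * (p * q)        ≡⟨ cong (r *_) pq≡0 ⟩
      r * 0ℚ             ≡⟨ ℚP.*-zeroʳ r ⟩
      0ℚ                 ∎)
    where
    open ≡-Reasoning
    r : ℚ
    r = (1/ p) {{p≢0}}
    contra : ∀ q → NonZero q → q ≡ 0ℚ → ⊥
    contra .0ℚ (record { nonZero = () }) refl

open RationalLemmas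

IsCauchy : (ℕ → ℚ) → Set
IsCauchy s = ∀ ε → 0ℚ ℚ.< ε → ∃ λ N → ∀ m n → N ℕ.≤ m → N ℕ.≤ n → ℚ.∣ s m ℚ.- s n ∣ ℚ.< ε

-- Cauchy reals; the modulus of convergence is part of the data.
record ℝ : Set where
  constructor mkℝ
  field
    seq    : ℕ → ℚ
    cauchy : IsCauchy seq

open ℝ public

infix 4 _≃_ _≤_

_≃_ : ℝ → ℝ → Set
x ≃ y = ∀ ε → 0ℚ ℚ.< ε → ∃ λ N → ∀ n → N ℕ.≤ n → ℚ.∣ seq x n ℚ.- seq y n ∣ ℚ.< ε

_≤_ : ℝ → ℝ → Set
x ≤ y = ∀ ε → 0ℚ ℚ.< ε → ∃ λ N → ∀ n → N ℕ.≤ n → seq x n ℚ.≤ seq y n ℚ.+ ε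

-- It suffices to bound the differences s m - s n from one side, since m and n
-- can be swapped.
cauchy-intro : ∀ s → (∀ ε → 0ℚ ℚ.< ε → ∃ λ N → ∀ m n → N ℕ.≤ m → N ℕ.≤ n → s m ℚ.< s n ℚ.+ ε) →
               IsCauchy s
cauchy-intro s h ε 0<ε with h ε 0<ε
... | N , f = N , λ m n N≤m N≤n → ∣-∣<-intro {s m} {s n} (f m n N≤m N≤n) (f n m N≤n N≤m)

infix  9 -_
infixl 7 _*_
infixl 6 _+_ _-_
infixr 8 _^_

fromℚ : ℚ → ℝ
fromℚ q = mkℝ (λ _ → q)
  (cauchy-intro (λ _ → q) λ ε 0<ε → 0 , λ _ _ _ _ →
    subst (ℚ._< q ℚ.+ ε) (ℚP.+-identityʳ q) (ℚP.+-monoʳ-< q 0<ε))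

fromℕ : ℕ → ℝ
fromℕ n = fromℚ (+ n ℚ./ 1)

_+_ : ℝ → ℝ → ℝ
x + y = mkℝ s (cauchy-intro s proof)
  where
  open Data.Rational.Solver.+-*-Solver
  s : ℕ → ℚ
  s n = seq x n ℚ.+ seq y n
  proof : ∀ ε → 0ℚ ℚ.< ε → ∃ λ N → ∀ m n → N ℕ.≤ m → N ℕ.≤ n → s m ℚ.< s n ℚ.+ ε
  proof ε 0<ε with cauchy x (ε ℚ.* ½) (half>0 0<ε) | cauchy y (ε ℚ.* ½) (half>0 0<ε)
  ... | M , f | K , g = M ℕ.⊔ K , λ m n N≤m N≤n →
    subst (s m ℚ.<_)
      (trans (solve 3 (λ a b e → (a :+ e) :+ (b :+ e) := (a :+ b) :+ (e :+ e)) refl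
                (seq x n) (seq y n) (ε ℚ.* ½))
             (cong (s n ℚ.+_) (half+half ε)))
      (ℚP.+-mono-< (∣-∣<-elim {seq x m} {seq x n} (f m n (ℕP.m⊔n≤o⇒m≤o M K N≤m) (ℕP.m⊔n≤o⇒m≤o M K N≤n)))
                   (∣-∣<-elim {seq y m} {seq y n} (g m n (ℕP.m⊔n≤o⇒n≤o M K N≤m) (ℕP.m⊔n≤o⇒n≤o M K N≤n))))

-_ : ℝ → ℝ
- x = mkℝ (λ n → ℚ.- seq x n) λ ε 0<ε → proj₁ (cauchy x ε 0<ε) , λ m n N≤m N≤n →
  subst (ℚ._< ε)
    (trans (∣∣-sym (seq x m) (seq x n))
      (cong ℚ.∣_∣ (solve 2 (λ a b → b :+ :- a := :- a :+ :- (:- b)) refl (seq x m) (seq x n))))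
    (proj₂ (cauchy x ε 0<ε) m n N≤m N≤n)
  where open Data.Rational.Solver.+-*-Solver

_-_ : ℝ → ℝ → ℝ
x - y = x + (- y)

eventual-bound : ∀ x → ∃ λ B → 0ℚ ℚ.< B × ∃ λ N → ∀ n → N ℕ.≤ n → ℚ.∣ seq x n ∣ ℚ.≤ B
eventual-bound x with cauchy x 1ℚ 0<1
... | N , f = ℚ.∣ seq x N ∣ ℚ.+ 1ℚ , nonNeg+pos (ℚP.0≤∣p∣ (seq x N)) 0<1 , N , λ n N≤n →
  ℚP.<⇒≤ (∣p∣<∣q∣+ {seq x n} {seq x N} (f n N N≤n ℕP.≤-refl))

_*_ : ℝ → ℝ → ℝ
x * y = mkℝ s λ ε 0<ε → proof ε 0<ε (eventual-bound x) (eventual-bound y)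
  where
  s : ℕ → ℚ
  s n = seq x n ℚ.* seq y n
  combine : ∀ A B δ ε → 0ℚ ℚ.< A → 0ℚ ℚ.< B → (A ℚ.+ B) ℚ.* δ ≡ ε → ∀ N₁ N₂ →
    (∀ n → N₁ ℕ.≤ n → ℚ.∣ seq x n ∣ ℚ.≤ A) → (∀ n → N₂ ℕ.≤ n → ℚ.∣ seq y n ∣ ℚ.≤ B) →
    (∃ λ N → ∀ m n → N ℕ.≤ m → N ℕ.≤ n → ℚ.∣ seq x m ℚ.- seq x n ∣ ℚ.< δ) →
    (∃ λ N → ∀ m n → N ℕ.≤ m → N ℕ.≤ n → ℚ.∣ seq y m ℚ.- seq y n ∣ ℚ.< δ) →
    ∃ λ N → ∀ m n → N ℕ.≤ m → N ℕ.≤ n → ℚ.∣ s m ℚ.- s n ∣ ℚ.< ε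
  combine A B δ ε 0<A 0<B eq N₁ N₂ f g (N₃ , f′) (N₄ , g′) =
    N , λ m n N≤m N≤n →
      subst (ℚ.∣ s m ℚ.- s n ∣ ℚ.<_) eq
        (*-close {seq x m} {seq x n} {seq y m} {seq y n} 0<A 0<B (f m (to₁ N≤m)) (g n (to₂ N≤n))
          (f′ m n (to₃ N≤m) (to₃ N≤n)) (g′ m n (to₄ N≤m) (to₄ N≤n)))
    where
    N : ℕ
    N = (N₁ ℕ.⊔ N₂) ℕ.⊔ (N₃ ℕ.⊔ N₄)
    to₁ : ∀ {n} → N ℕ.≤ n → N₁ ℕ.≤ n
    to₁ h = ℕP.m⊔n≤o⇒m≤o N₁ N₂ (ℕP.m⊔n≤o⇒m≤o (N₁ ℕ.⊔ N₂) (N₃ ℕ.⊔ N₄) h)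
    to₂ : ∀ {n} → N ℕ.≤ n → N₂ ℕ.≤ n
    to₂ h = ℕP.m⊔n≤o⇒n≤o N₁ N₂ (ℕP.m⊔n≤o⇒m≤o (N₁ ℕ.⊔ N₂) (N₃ ℕ.⊔ N₄) h)
    to₃ : ∀ {n} → N ℕ.≤ n → N₃ ℕ.≤ n
    to₃ h = ℕP.m⊔n≤o⇒m≤o N₃ N₄ (ℕP.m⊔n≤o⇒n≤o (N₁ ℕ.⊔ N₂) (N₃ ℕ.⊔ N₄) h)
    to₄ : ∀ {n} → N ℕ.≤ n → N₄ ℕ.≤ n
    to₄ h = ℕP.m⊔n≤o⇒n≤o N₃ N₄ (ℕP.m⊔n≤o⇒n≤o (N₁ ℕ.⊔ N₂) (N₃ ℕ.⊔ N₄) h)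
  proof : ∀ ε → 0ℚ ℚ.< ε →
    (∃ λ B → 0ℚ ℚ.< B × ∃ λ N → ∀ n → N ℕ.≤ n → ℚ.∣ seq x n ∣ ℚ.≤ B) →
    (∃ λ B → 0ℚ ℚ.< B × ∃ λ N → ∀ n → N ℕ.≤ n → ℚ.∣ seq y n ∣ ℚ.≤ B) →
    ∃ λ N → ∀ m n → N ℕ.≤ m → N ℕ.≤ n → ℚ.∣ s m ℚ.- s n ∣ ℚ.< ε
  proof ε 0<ε (A , 0<A , N₁ , f) (B , 0<B , N₂ , g) with scale {A ℚ.+ B} (pos+nonNeg 0<A (ℚP.<⇒≤ 0<B)) 0<ε
  ... | δ , 0<δ , eq = combine A B δ ε 0<A 0<B eq N₁ N₂ f g (cauchy x δ 0<δ) (cauchy y δ 0<δ)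

_^_ : ℝ → ℕ → ℝ
x ^ zero  = fromℚ 1ℚ
x ^ suc n = x * x ^ n

∣_∣ : ℝ → ℝ
∣ x ∣ = mkℝ (λ n → ℚ.∣ seq x n ∣) (cauchy-intro (λ n → ℚ.∣ seq x n ∣) λ ε 0<ε →
  proj₁ (cauchy x ε 0<ε) , λ m n N≤m N≤n →
    ∣p∣<∣q∣+ {seq x m} {seq x n} (proj₂ (cauchy x ε 0<ε) m n N≤m N≤n))

-- Bisection for the square root of a nonnegative rational q: after n halvings
-- the root lies in [ lower q n , lower q n + width q n ).
width : ℚ → ℕ → ℚ
width q zero    = q ℚ.+ 1ℚ
width q (suc n) = ½ ℚ.* width q n

lower : ℚ → ℕ → ℚ
lower q zero    = 0ℚ
lower q (suc n) =
  let mid = lower q n ℚ.+ width q (suc n)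
  in if does (mid ℚ.* mid ℚP.≤? q) then mid else lower q n

width>0 : ∀ q n → 0ℚ ℚ.≤ q → 0ℚ ℚ.< width q n
width>0 q zero    0≤q = nonNeg+pos 0≤q 0<1
width>0 q (suc n) 0≤q = pos* (ℚP.positive⁻¹ ½) (width>0 q n 0≤q)

width-bound : ∀ q B n → q ℚ.+ 1ℚ ℚ.≤ + B ℚ./ 1 → width q n ℚ.≤ + B ℚ./ suc n
width-bound q B zero    h = h
width-bound q B (suc n) h =
  ℚP.≤-trans (ℚP.*-monoˡ-≤-nonNeg ½ (width-bound q B n h)) (½*/ B n)

if-does : {P : Set} (P? : Dec P) (Q : ℚ → Set) {p q : ℚ} →
          (P → Q p) → (¬ P → Q q) → Q (if does P? then p else q)
if-does (yes p) Q f g = f p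
if-does (no ¬p) Q f g = g ¬p

lower-spec : ∀ q n → 0ℚ ℚ.≤ q →
  0ℚ ℚ.≤ lower q n × lower q n ℚ.* lower q n ℚ.≤ q ×
  q ℚ.< (lower q n ℚ.+ width q n) ℚ.* (lower q n ℚ.+ width q n)
lower-spec q zero 0≤q = ℚP.≤-refl , 0≤q , (begin-strict
    q                                         ≡⟨ sym (ℚP.+-identityˡ q) ⟩
    0ℚ ℚ.+ q                                  <⟨ ℚP.+-mono-<-≤ 0<1 q≤ ⟩
    1ℚ ℚ.+ (q ℚ.+ q ℚ.+ q ℚ.* q)              ≡⟨ solve 1 (λ a → con 1ℚ :+ (a :+ a :+ a :* a)
                                                   := (con 0ℚ :+ (a :+ con 1ℚ)) :* (con 0ℚ :+ (a :+ con 1ℚ))) refl q ⟩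
    (0ℚ ℚ.+ (q ℚ.+ 1ℚ)) ℚ.* (0ℚ ℚ.+ (q ℚ.+ 1ℚ)) ∎)
  where
  open Data.Rational.Solver.+-*-Solver
  open ℚP.≤-Reasoning
  q≤ : q ℚ.≤ q ℚ.+ q ℚ.+ q ℚ.* q
  q≤ = subst (ℚ._≤ q ℚ.+ q ℚ.+ q ℚ.* q) (trans (ℚP.+-identityʳ (q ℚ.+ 0ℚ)) (ℚP.+-identityʳ q))
         (ℚP.+-mono-≤ (ℚP.+-monoʳ-≤ q 0≤q) (nonNeg* 0≤q 0≤q))
lower-spec q (suc n) 0≤q =
  if-does (mid ℚ.* mid ℚP.≤? q) (λ z → 0ℚ ℚ.≤ z × z ℚ.* z ℚ.≤ q × q ℚ.< (z ℚ.+ w) ℚ.* (z ℚ.+ w))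
    (λ mid²≤q → ℚP.+-mono-≤ 0≤l (ℚP.<⇒≤ (width>0 q (suc n) 0≤q)) , mid²≤q ,
                subst (λ u → q ℚ.< u ℚ.* u) (sym mid+w) q<u²)
    (λ mid²≰q → 0≤l , l²≤q , ℚP.≰⇒> mid²≰q)
  where
  l w mid : ℚ
  l   = lower q n
  w   = width q (suc n)
  mid = l ℚ.+ w
  0≤l : 0ℚ ℚ.≤ l
  0≤l = proj₁ (lower-spec q n 0≤q)
  l²≤q : l ℚ.* l ℚ.≤ q
  l²≤q = proj₁ (proj₂ (lower-spec q n 0≤q))
  q<u² : q ℚ.< (l ℚ.+ width q n) ℚ.* (l ℚ.+ width q n)
  q<u² = proj₂ (proj₂ (lower-spec q n 0≤q))
  mid+w : mid ℚ.+ w ≡ l ℚ.+ width q n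
  mid+w = trans (ℚP.+-assoc l w w) (cong (l ℚ.+_)
    (trans (sym (ℚP.*-distribʳ-+ (width q n) ½ ½)) (ℚP.*-identityˡ (width q n))))

-- If l is a lower approximation of √p, and l′ one of √q with error at most
-- ε/2, then l < l′ + ε as soon as p < q + ε²/4.
lower-close : ∀ {p q l l′ w ε} → 0ℚ ℚ.< ε → 0ℚ ℚ.≤ l′ → 0ℚ ℚ.≤ w → w ℚ.≤ ε ℚ.* ½ →
  l ℚ.* l ℚ.≤ p → q ℚ.< (l′ ℚ.+ w) ℚ.* (l′ ℚ.+ w) →
  p ℚ.< q ℚ.+ (ε ℚ.* ½) ℚ.* (ε ℚ.* ½) → l ℚ.< l′ ℚ.+ ε
lower-close {p} {q} {l} {l′} {w} {ε} 0<ε 0≤l′ 0≤w w≤ l²≤p q< p< with l ℚP.<? l′ ℚ.+ ε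
... | yes h = h
... | no  h = contradiction p<p (ℚP.<-irrefl refl)
  where
  open Data.Rational.Solver.+-*-Solver
  open ℚP.≤-Reasoning
  e : ℚ
  e = ε ℚ.* ½
  0≤e : 0ℚ ℚ.≤ e
  0≤e = ℚP.<⇒≤ (half>0 0<ε)
  0≤2l′e : 0ℚ ℚ.≤ l′ ℚ.* e ℚ.+ l′ ℚ.* e ℚ.+ (e ℚ.* e ℚ.+ e ℚ.* e)
  0≤2l′e = ℚP.+-mono-≤ (ℚP.+-mono-≤ (nonNeg* 0≤l′ 0≤e) (nonNeg* 0≤l′ 0≤e))
                       (ℚP.+-mono-≤ (nonNeg* 0≤e 0≤e) (nonNeg* 0≤e 0≤e))
  p<p : p ℚ.< p
  p<p = begin-strict
    p                                          <⟨ p< ⟩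
    q ℚ.+ e ℚ.* e                              <⟨ ℚP.+-monoˡ-< (e ℚ.* e) q< ⟩
    (l′ ℚ.+ w) ℚ.* (l′ ℚ.+ w) ℚ.+ e ℚ.* e      ≤⟨ ℚP.+-monoˡ-≤ (e ℚ.* e)
                                                    (sq-mono (ℚP.+-mono-≤ 0≤l′ 0≤w) (ℚP.+-monoʳ-≤ l′ w≤)) ⟩
    (l′ ℚ.+ e) ℚ.* (l′ ℚ.+ e) ℚ.+ e ℚ.* e      ≡⟨ sym (ℚP.+-identityʳ ((l′ ℚ.+ e) ℚ.* (l′ ℚ.+ e) ℚ.+ e ℚ.* e)) ⟩
    (l′ ℚ.+ e) ℚ.* (l′ ℚ.+ e) ℚ.+ e ℚ.* e ℚ.+ 0ℚ
      ≤⟨ ℚP.+-monoʳ-≤ ((l′ ℚ.+ e) ℚ.* (l′ ℚ.+ e) ℚ.+ e ℚ.* e) 0≤2l′e ⟩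
    (l′ ℚ.+ e) ℚ.* (l′ ℚ.+ e) ℚ.+ e ℚ.* e ℚ.+ (l′ ℚ.* e ℚ.+ l′ ℚ.* e ℚ.+ (e ℚ.* e ℚ.+ e ℚ.* e))
      ≡⟨ solve 2 (λ a b → (a :+ b) :* (a :+ b) :+ b :* b :+ (a :* b :+ a :* b :+ (b :* b :+ b :* b))
                   := (a :+ (b :+ b)) :* (a :+ (b :+ b))) refl l′ e ⟩
    (l′ ℚ.+ (e ℚ.+ e)) ℚ.* (l′ ℚ.+ (e ℚ.+ e))  ≡⟨ cong (λ z → (l′ ℚ.+ z) ℚ.* (l′ ℚ.+ z)) (half+half ε) ⟩
    (l′ ℚ.+ ε) ℚ.* (l′ ℚ.+ ε)                  ≤⟨ sq-mono (ℚP.+-mono-≤ 0≤l′ (ℚP.<⇒≤ 0<ε)) (ℚP.≮⇒≥ h) ⟩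
    l ℚ.* l                                    ≤⟨ l²≤p ⟩
    p                                          ∎

-- Negative arguments are clamped to 0, so that √ is total.
√_ : ℝ → ℝ
√ x = mkℝ s (cauchy-intro s λ ε 0<ε → proof ε 0<ε (eventual-bound x))
  where
  q : ℕ → ℚ
  q n = seq x n ℚ.⊔ 0ℚ
  0≤q : ∀ n → 0ℚ ℚ.≤ q n
  0≤q n = ℚP.p≤q⊔p (seq x n) 0ℚ
  s : ℕ → ℚ
  s n = lower (q n) n
  combine : ∀ ε → 0ℚ ℚ.< ε → ∀ A → 0ℚ ℚ.< A → ∀ N₁ → (∀ n → N₁ ℕ.≤ n → ℚ.∣ seq x n ∣ ℚ.≤ A) →
    (∃ λ B → A ℚ.+ 1ℚ ℚ.≤ + B ℚ./ 1 × ∃ λ N → ∀ n → N ℕ.≤ n → + B ℚ./ suc n ℚ.< ε ℚ.* ½) →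
    (∃ λ N → ∀ m n → N ℕ.≤ m → N ℕ.≤ n → ℚ.∣ seq x m ℚ.- seq x n ∣ ℚ.< (ε ℚ.* ½) ℚ.* (ε ℚ.* ½)) →
    ∃ λ N → ∀ m n → N ℕ.≤ m → N ℕ.≤ n → s m ℚ.< s n ℚ.+ ε
  combine ε 0<ε A 0<A N₁ f (B , A+1≤B , N₂ , g) (N₃ , h) =
    N , λ m n N≤m N≤n →
      lower-close {q m} {q n} {s m} {s n} {width (q n) n} 0<ε
        (proj₁ (lower-spec (q n) n (0≤q n)))
        (ℚP.<⇒≤ (width>0 (q n) n (0≤q n)))
        (ℚP.≤-trans
          (width-bound (q n) B n (ℚP.≤-trans (ℚP.+-monoˡ-≤ 1ℚ (q≤A n (to₁ N≤n))) A+1≤B))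
          (ℚP.<⇒≤ (g n (to₂ N≤n))))
        (proj₁ (proj₂ (lower-spec (q m) m (0≤q m))))
        (proj₂ (proj₂ (lower-spec (q n) n (0≤q n))))
        (⊔0-mono-< {seq x m} {seq x n} (pos* (half>0 0<ε) (half>0 0<ε))
          (∣-∣<-elim {seq x m} {seq x n} (h m n (to₃ N≤m) (to₃ N≤n))))
    where
    N : ℕ
    N = (N₁ ℕ.⊔ N₂) ℕ.⊔ N₃
    to₁ : ∀ {n} → N ℕ.≤ n → N₁ ℕ.≤ n
    to₁ h = ℕP.m⊔n≤o⇒m≤o N₁ N₂ (ℕP.m⊔n≤o⇒m≤o (N₁ ℕ.⊔ N₂) N₃ h)
    to₂ : ∀ {n} → N ℕ.≤ n → N₂ ℕ.≤ n
    to₂ h = ℕP.m⊔n≤o⇒n≤o N₁ N₂ (ℕP.m⊔n≤o⇒m≤o (N₁ ℕ.⊔ N₂) N₃ h)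
    to₃ : ∀ {n} → N ℕ.≤ n → N₃ ℕ.≤ n
    to₃ h = ℕP.m⊔n≤o⇒n≤o (N₁ ℕ.⊔ N₂) N₃ h
    q≤A : ∀ n → N₁ ℕ.≤ n → q n ℚ.≤ A
    q≤A n N₁≤n = ℚP.⊔-lub (ℚP.≤-trans (p≤∣p∣ (seq x n)) (f n N₁≤n)) (ℚP.<⇒≤ 0<A)
  proof : ∀ ε → 0ℚ ℚ.< ε →
    (∃ λ A → 0ℚ ℚ.< A × ∃ λ N → ∀ n → N ℕ.≤ n → ℚ.∣ seq x n ∣ ℚ.≤ A) →
    ∃ λ N → ∀ m n → N ℕ.≤ m → N ℕ.≤ n → s m ℚ.< s n ℚ.+ ε
  proof ε 0<ε (A , 0<A , N₁ , f) =
    combine ε 0<ε A 0<A N₁ f (bound (natural-bound (A ℚ.+ 1ℚ)))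
      (cauchy x ((ε ℚ.* ½) ℚ.* (ε ℚ.* ½)) (pos* (half>0 0<ε) (half>0 0<ε)))
    where
    bound : (∃ λ B → A ℚ.+ 1ℚ ℚ.≤ + B ℚ./ 1) →
      ∃ λ B → A ℚ.+ 1ℚ ℚ.≤ + B ℚ./ 1 × ∃ λ N → ∀ n → N ℕ.≤ n → + B ℚ./ suc n ℚ.< ε ℚ.* ½
    bound (B , A+1≤B) = B , A+1≤B , archimedean B (ε ℚ.* ½) (half>0 0<ε)

infix 8 _^[_/2]

_^[_/2] : ℝ → ℕ → ℝ
x ^[ k /2] = (√ x) ^ k

partialSum : (ℕ → ℝ) → ℕ → ℝ
partialSum a zero    = fromℚ 0ℚ
partialSum a (suc N) = partialSum a N + a N

infix 4 _ConvergesTo_ _SumsTo_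

_ConvergesTo_ : (ℕ → ℝ) → ℝ → Set
a ConvergesTo ℓ = ∀ ε → 0ℚ ℚ.< ε → ∃ λ N → ∀ n → N ℕ.≤ n → ∣ a n - ℓ ∣ ≤ fromℚ ε

_SumsTo_ : (ℕ → ℝ) → ℝ → Set
a SumsTo ℓ = partialSum a ConvergesTo ℓ

sign : ℕ → ℚ
sign zero    = 1ℚ
sign (suc n) = ℚ.- sign n

leibnizTerm : ℕ → ℚ
leibnizTerm n = + 4 ℚ./ suc (2 ℕ.* n)

leibnizSum : ℕ → ℚ
leibnizSum zero    = 0ℚ
leibnizSum (suc n) = leibnizSum n ℚ.+ sign n ℚ.* leibnizTerm n

leibnizTerm-antitone : ∀ n → leibnizTerm (suc n) ℚ.≤ leibnizTerm n
leibnizTerm-antitone n = /-mono-≤ 4 4 (2 ℕ.* suc n) (2 ℕ.* n)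
  (ℕP.*-monoʳ-≤ 4 (ℕ.s≤s (ℕP.*-monoʳ-≤ 2 (ℕP.n≤1+n n))))

leibnizTail : ℕ → ℕ → ℚ
leibnizTail n zero    = 0ℚ
leibnizTail n (suc d) = leibnizTerm n ℚ.- leibnizTail (suc n) d

leibnizTail-bounds : ∀ n d → 0ℚ ℚ.≤ leibnizTail n d × leibnizTail n d ℚ.≤ leibnizTerm n
leibnizTail-bounds n zero = ℚP.≤-refl , 0≤/ 4 (2 ℕ.* n)
leibnizTail-bounds n (suc d) with leibnizTail-bounds (suc n) d
... | 0≤t , t≤a =
  subst (ℚ._≤ leibnizTerm n ℚ.- leibnizTail (suc n) d) (ℚP.+-inverseʳ (leibnizTail (suc n) d))
    (ℚP.+-monoˡ-≤ (ℚ.- leibnizTail (suc n) d) (ℚP.≤-trans t≤a (leibnizTerm-antitone n))) ,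
  subst (leibnizTerm n ℚ.- leibnizTail (suc n) d ℚ.≤_) (ℚP.+-identityʳ (leibnizTerm n))
    (ℚP.+-monoʳ-≤ (leibnizTerm n) (ℚP.neg-antimono-≤ 0≤t))

leibnizSum-tail : ∀ n d → leibnizSum (d ℕ.+ n) ≡ leibnizSum n ℚ.+ sign n ℚ.* leibnizTail n d
leibnizSum-tail n zero = solve 2 (λ a b → a := a :+ b :* con 0ℚ) refl (leibnizSum n) (sign n)
  where open Data.Rational.Solver.+-*-Solver
leibnizSum-tail n (suc d) = trans (cong leibnizSum (sym (ℕP.+-suc d n)))
  (trans (leibnizSum-tail (suc n) d)
    (solve 4 (λ S σ a t → (S :+ σ :* a) :+ (:- σ) :* t := S :+ σ :* (a :+ :- t)) refl
      (leibnizSum n) (sign n) (leibnizTerm n) (leibnizTail (suc n) d)))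
  where open Data.Rational.Solver.+-*-Solver

∣sign∣ : ∀ n → ℚ.∣ sign n ∣ ≡ 1ℚ
∣sign∣ zero    = refl
∣sign∣ (suc n) = trans (ℚP.∣-p∣≡∣p∣ (sign n)) (∣sign∣ n)

leibnizSum-close : ∀ {m n} → n ℕ.≤ m → ℚ.∣ leibnizSum m ℚ.- leibnizSum n ∣ ℚ.≤ + 4 ℚ./ suc n
leibnizSum-close {m} {n} n≤m = begin
    ℚ.∣ leibnizSum m ℚ.- leibnizSum n ∣
      ≡⟨ cong (λ z → ℚ.∣ leibnizSum z ℚ.- leibnizSum n ∣) (sym (ℕP.m∸n+n≡m n≤m)) ⟩
    ℚ.∣ leibnizSum (d ℕ.+ n) ℚ.- leibnizSum n ∣
      ≡⟨ cong (λ z → ℚ.∣ z ℚ.- leibnizSum n ∣) (leibnizSum-tail n d) ⟩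
    ℚ.∣ leibnizSum n ℚ.+ sign n ℚ.* t ℚ.- leibnizSum n ∣
      ≡⟨ cong ℚ.∣_∣ (solve 2 (λ a b → a :+ b :+ :- a := b) refl (leibnizSum n) (sign n ℚ.* t)) ⟩
    ℚ.∣ sign n ℚ.* t ∣
      ≡⟨ ℚP.∣p*q∣≡∣p∣*∣q∣ (sign n) t ⟩
    ℚ.∣ sign n ∣ ℚ.* ℚ.∣ t ∣
      ≡⟨ cong₂ ℚ._*_ (∣sign∣ n) (ℚP.0≤p⇒∣p∣≡p (proj₁ (leibnizTail-bounds n d))) ⟩
    1ℚ ℚ.* t
      ≡⟨ ℚP.*-identityˡ t ⟩
    t
      ≤⟨ proj₂ (leibnizTail-bounds n d) ⟩
    leibnizTerm n
      ≤⟨ /-mono-≤ 4 4 (2 ℕ.* n) n (ℕP.*-monoʳ-≤ 4 (ℕ.s≤s (ℕP.m≤m+n n (n ℕ.+ 0)))) ⟩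
    + 4 ℚ./ suc n ∎
  where
  open Data.Rational.Solver.+-*-Solver
  open ℚP.≤-Reasoning
  d : ℕ
  d = m ℕ.∸ n
  t : ℚ
  t = leibnizTail n d

-- π = 4 Σ (-1)ⁿ / (2n + 1).
π : ℝ
π = mkℝ leibnizSum proof
  where
  proof : IsCauchy leibnizSum
  proof ε 0<ε with archimedean 4 ε 0<ε
  ... | N , f = N , bound
    where
    bound : ∀ m n → N ℕ.≤ m → N ℕ.≤ n → ℚ.∣ leibnizSum m ℚ.- leibnizSum n ∣ ℚ.< ε
    bound m n N≤m N≤n with ℕP.≤-total n m
    ... | inj₁ n≤m = ℚP.≤-<-trans (leibnizSum-close n≤m) (f n N≤n)
    ... | inj₂ m≤n = subst (ℚ._< ε) (∣∣-sym (leibnizSum n) (leibnizSum m))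
                       (ℚP.≤-<-trans (leibnizSum-close m≤n) (f m N≤m))

-- Bonnet's recurrence (n + 2) Pₙ₊₂ = (2n + 3) x Pₙ₊₁ - (n + 1) Pₙ; with P₀ = 1
-- and P₁ = x it gives the normalisation Pₘ(1) = 1.
legendre : ℕ → ℝ → ℝ
legendre zero          x = fromℚ 1ℚ
legendre (suc zero)    x = x
legendre (suc (suc n)) x =
  fromℚ (+ 1 ℚ./ (2 ℕ.+ n)) *
    (fromℕ (2 ℕ.* n ℕ.+ 3) * x * legendre (suc n) x - fromℕ (n ℕ.+ 1) * legendre n x)

rising : ℚ → ℕ → ℚ
rising a zero    = 1ℚ
rising a (suc j) = rising a j ℚ.* (a ℚ.+ + j ℚ./ 1)

infix 9 _!!

_!! : ℕ → ℕ
zero !!          = 1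
suc zero !!      = 1
suc (suc n) !!   = suc (suc n) ℕ.* n !!

rising-nonZero : ∀ a j → (∀ i → NonZero (a ℚ.+ + i ℚ./ 1)) → NonZero (rising a j)
rising-nonZero a zero    h = _
rising-nonZero a (suc j) h = nonZero* {rising a j} (rising-nonZero a j h) (h j)

suc+-nonZero : ∀ n i → NonZero (+ suc n ℚ./ 1 ℚ.+ + i ℚ./ 1)
suc+-nonZero n i = ℚ.>-nonZero
  (pos+nonNeg (ℚP.<-≤-trans 0<1 (/-mono-≤ 1 (suc n) 0 0 (ℕ.s≤s ℕ.z≤n))) (0≤/ i 0))

½-n+i≢0 : ∀ n i → (½ ℚ.- + n ℚ./ 1) ℚ.+ + i ℚ./ 1 ≢ 0ℚ
½-n+i≢0 n i eq = ℕP.even≢odd n i (ℤP.+-injective (begin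
    + (2 ℕ.* n)                                     ≡⟨ ℤP.pos-* 2 n ⟩
    + 2 ℤ.* + n                                     ≡⟨ sym (ℤP.+-identityˡ (+ 2 ℤ.* + n)) ⟩
    + 0 ℤ.+ + 2 ℤ.* + n                             ≡⟨ cong (ℤ._+ + 2 ℤ.* + n) (sym numerator≡0) ⟩
    ((+ 1 ℤ.* + 1 ℤ.+ ℤ.- (+ n) ℤ.* + 2) ℤ.* + 1 ℤ.+ + i ℤ.* + 2) ℤ.* + 1 ℤ.+ + 2 ℤ.* + n
      ≡⟨ solve 2 (λ a b → ((con (+ 1) :* con (+ 1) :+ :- a :* con (+ 2)) :* con (+ 1) :+ b :* con (+ 2)) :* con (+ 1)
                            :+ con (+ 2) :* a := con (+ 1) :+ con (+ 2) :* b) refl (+ n) (+ i) ⟩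
    + 1 ℤ.+ + 2 ℤ.* + i                             ≡⟨ cong (λ z → + 1 ℤ.+ z) (sym (ℤP.pos-* 2 i)) ⟩
    + suc (2 ℕ.* i)                                 ∎))
  where
  open Data.Integer.Solver.+-*-Solver
  open ≡-Reasoning
  unnormalised : ℚᵘ.ℚᵘ
  unnormalised = mkℚᵘ (+ 1) 1 ℚᵘ.- mkℚᵘ (+ n) 0 ℚᵘ.+ mkℚᵘ (+ i) 0
  unnormalised≃0 : unnormalised ℚᵘ.≃ mkℚᵘ (+ 0) 0
  unnormalised≃0 = ℚᵘP.≃-trans (ℚᵘP.≃-sym
    (ℚᵘP.≃-trans (ℚP.toℚᵘ-homo-+ (½ ℚ.- + n ℚ./ 1) (+ i ℚ./ 1))
      (ℚᵘP.+-cong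
        (ℚᵘP.≃-trans (ℚP.toℚᵘ-homo-+ ½ (ℚ.- (+ n ℚ./ 1)))
          (ℚᵘP.+-congʳ (mkℚᵘ (+ 1) 1)
            (ℚᵘP.≃-trans (ℚP.toℚᵘ-homo‿- (+ n ℚ./ 1)) (ℚᵘP.-‿cong (ℚP.toℚᵘ-fromℚᵘ (mkℚᵘ (+ n) 0))))))
        (ℚP.toℚᵘ-fromℚᵘ (mkℚᵘ (+ i) 0)))))
    (ℚᵘP.≃-reflexive (cong ℚ.toℚᵘ eq))
  numerator≡0 : ((+ 1 ℤ.* + 1 ℤ.+ ℤ.- (+ n) ℤ.* + 2) ℤ.* + 1 ℤ.+ + i ℤ.* + 2) ℤ.* + 1 ≡ + 0
  numerator≡0 = ℚᵘP.drop-*≡* unnormalised≃0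

½-+-nonZero : ∀ n i → NonZero ((½ ℚ.- + n ℚ./ 1) ℚ.+ + i ℚ./ 1)
½-+-nonZero n i = ℚ.≢-nonZero (½-n+i≢0 n i)

-- (n + 1)ⱼ (1/2 - n)ⱼ with j = (k + 1)/2, an exact division for odd k.
denominator : ℕ → ℕ → ℚ
denominator k n = rising (+ (n ℕ.+ 1) ℚ./ 1) j ℚ.* rising (½ ℚ.- + n ℚ./ 1) j
  where
  j : ℕ
  j = (k ℕ.+ 1) div 2

denominator-nonZero : ∀ k n → NonZero (denominator k n)
denominator-nonZero k n =
  nonZero* {rising (+ (n ℕ.+ 1) ℚ./ 1) ((k ℕ.+ 1) div 2)}
    (rising-nonZero (+ (n ℕ.+ 1) ℚ./ 1) ((k ℕ.+ 1) div 2)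
      (subst (λ m → ∀ i → NonZero (+ m ℚ./ 1 ℚ.+ + i ℚ./ 1)) (ℕP.+-comm 1 n) (suc+-nonZero n)))
    (rising-nonZero (½ ℚ.- + n ℚ./ 1) ((k ℕ.+ 1) div 2) (½-+-nonZero n))

centralRatio : ℕ → ℚ
centralRatio n = (+ ((2 ℕ.* n) C n) ℚ./ 4 ℕ.^ n) {{ℕP.m^n≢0 4 n}}

coefficient : ℕ → ℕ → ℚ
coefficient k n =
  ((+ (4 ℕ.* n ℕ.+ 1) ℚ./ 1 ℚ.* (centralRatio n ℚ.* centralRatio n)) ℚ.÷ denominator k n)
    {{denominator-nonZero k n}}

prefactor : ℕ → ℝ
prefactor k = π * fromℚ ((+ (k !! ℕ.* k !!) ℚ./ 4 ℕ.^ (k ℕ.+ 1)) {{ℕP.m^n≢0 4 (k ℕ.+ 1)}})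

{-# OPTIONS --safe #-}

-- Put y = 2x - 1, so that 4x(1 - x) = 1 - y².  On rational y everything is a
-- finite identity with an explicit error.
--
-- k = 1.  Let a m be the Taylor coefficients of √(1 - z).  Expanding each y²ᵐ in
-- even Legendre polynomials, the coefficients of Σ_{m≤N} a m y²ᵐ satisfy a
-- first-order recurrence in the Legendre index (Zeilberger) with an error term
-- of constant sign, so from the second on they lie above their limits.  Hence
-- the sum of the absolute errors is, up to sign, the error at y = 1, and tends
-- to 0.  The limit at the index 0 is Gauss's value of ₂F₁(-1/2, 1/2; 3/2; 1), a
-- Wallis product.  It equals the sum of Leibniz's series for π/4, because
-- Euler's transformation of that series is the case n = 0 of a family A n that
-- decreases in n and obeys the Wallis recurrence (n + 2) A (n + 2) = (n + 1) A n.
--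
-- k → k + 2.  Multiplying by 1 - y² acts on Legendre coefficients through
-- Bonnet's recurrence, and takes the series for k to a multiple of the series
-- for k + 2.
module Submission where

open import Data.Integer.Base as ℤ using (+_)
import Data.Integer.Tactic.RingSolver as ℤR
open import Data.Nat.Base as ℕ using (ℕ; zero; suc)
open import Data.Nat.Divisibility using (_∣_)
import Data.Nat.Properties as ℕP
open import Data.Product using (∃; _×_; _,_; proj₁; proj₂)
open import Data.Rational.Base as ℚ using (ℚ; 0ℚ; 1ℚ; ½; NonZero)
import Data.Rational.Properties as ℚP
import Data.Rational.Unnormalised.Base as ℚᵘ
import Data.Rational.Unnormalised.Properties as ℚᵘP
open import Data.Sum.Base using (inj₁; inj₂)
open import Level using (0ℓ)
open import Relation.Binary.PropositionalEquality
open import Relation.Nullary using (¬_; yes; no; contradiction)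
open import Relation.Nullary.Decidable.Core using (dec⇒maybe)
open import Tactic.RingSolver using (solve-∀)
open import Tactic.RingSolver.Core.AlmostCommutativeRing using (AlmostCommutativeRing; fromCommutativeRing)
open import Defs using (module RationalLemmas)
open RationalLemmas

-- A real is a Cauchy sequence of rationals and its operations act entrywise, so entry i of a
-- partial sum is a rational polynomial at entry i of x. But 1 - y² need not have a rational root,
-- 4/π is not rational, and entries of x may lie outside [0, 1]. This dictates the form of the
-- central estimate `Approximates`: it is uniform in rational y with y² ≤ 1, it admits any rational
-- r in [0, 1] with r² near 1 - y², and it replaces 4/π by the rational Wallis product `V n`.
--
-- The sum S is built from the real `Vᵣ` with entries `V n`, so π is never inverted. Leibniz's π
-- meets `V` in the single fact `quarter*V`; the detour through Euler's transformation is there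
-- because π is given as a series while the coefficients lead to a product.
--
-- Integrals and orthogonality are only the origin of formulas. Hypergeometric sums are cut off and
-- treated through recurrences with cleared denominators, which the ring solver checks; what needs
-- estimating is the last term that each cut leaves.

module Arithmetic where

  open import Data.Rational.Base using (_+_; _-_; -_; _*_; _/_; _≤_; _<_; ∣_∣; 1/_)

  -- Ordered-field arithmetic of the rationals.

  ℚ-ring : AlmostCommutativeRing 0ℓ 0ℓ
  ℚ-ring = fromCommutativeRing ℚP.+-*-commutativeRing (λ x → dec⇒maybe (0ℚ ℚP.≟ x))

  2ℚ 3ℚ 4ℚ 5ℚ 6ℚ 8ℚ : ℚ
  2ℚ = + 2 / 1
  3ℚ = + 3 / 1
  4ℚ = + 4 / 1
  5ℚ = + 5 / 1
  6ℚ = + 6 / 1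
  8ℚ = + 8 / 1

  -- Equalities are proved by linear combinations: the ring solver supplies
  -- A = B + c (l - r), and the hypothesis l = r removes the last summand.

  by₁ : ∀ {A B l r} c → l ≡ r → A ≡ B + c * (l - r) → A ≡ B
  by₁ {A} {B} {l} c refl eq = trans eq (lemma B c l)
    where
    lemma : ∀ B c l → B + c * (l - l) ≡ B
    lemma = solve-∀ ℚ-ring

  by₂ : ∀ {A B l r l′ r′} c c′ → l ≡ r → l′ ≡ r′ → A ≡ B + c * (l - r) + c′ * (l′ - r′) → A ≡ B
  by₂ c c′ h h′ eq = by₁ c h (by₁ c′ h′ eq)

  by₃ : ∀ {A B l r l′ r′ l″ r″} c c′ c″ → l ≡ r → l′ ≡ r′ → l″ ≡ r″ →
        A ≡ B + c * (l - r) + c′ * (l′ - r′) + c″ * (l″ - r″) → A ≡ B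
  by₃ c c′ c″ h h′ h″ eq = by₂ c c′ h h′ (by₁ c″ h″ eq)

  0≤1 : 0ℚ ≤ 1ℚ
  0≤1 = ℚP.<⇒≤ 0<1

  0≤2* : ∀ {p} → 0ℚ ≤ p → 0ℚ ≤ 2ℚ * p
  0≤2* = nonNeg* {2ℚ} (0≤/ 2 0)

  0<2* : ∀ {p} → 0ℚ < p → 0ℚ < 2ℚ * p
  0<2* = pos* {2ℚ} (ℚP.positive⁻¹ 2ℚ)

  ≤-by : ∀ {a b} e → 0ℚ ≤ e → b ≡ a + e → a ≤ b
  ≤-by {a} e 0≤e eq = subst₂ _≤_ (ℚP.+-identityʳ a) (sym eq) (ℚP.+-monoʳ-≤ a 0≤e)

  ≤⇒0≤- : ∀ {a b} → a ≤ b → 0ℚ ≤ b - a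
  ≤⇒0≤- {a} {b} a≤b = subst (_≤ b - a) (ℚP.+-inverseʳ a) (ℚP.+-monoˡ-≤ (- a) a≤b)

  0<⇒≢ : ∀ {p} → 0ℚ < p → p ≢ 0ℚ
  0<⇒≢ 0<p refl = ℚP.<-irrefl refl 0<p

  cancelˡ : ∀ {a b} d → d ≢ 0ℚ → d * a ≡ d * b → a ≡ b
  cancelˡ {a} {b} d d≢0 eq = begin
      a                  ≡⟨ undo a ⟨
      r * (d * a)        ≡⟨ cong (r *_) eq ⟩
      r * (d * b)        ≡⟨ undo b ⟩
      b                  ∎
    where
    open ≡-Reasoning
    r : ℚ
    r = (1/ d) {{ℚ.≢-nonZero d≢0}}
    undo : ∀ x → r * (d * x) ≡ x
    undo x = trans (sym (ℚP.*-assoc r d x))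
      (trans (cong (_* x) (ℚP.*-inverseˡ d {{ℚ.≢-nonZero d≢0}})) (ℚP.*-identityˡ x))

  cancel-≤ : ∀ {a b} d → 0ℚ < d → d * a ≤ d * b → a ≤ b
  cancel-≤ d 0<d = ℚP.*-cancelˡ-≤-pos d {{ℚ.positive 0<d}}

  cancel-< : ∀ {a b} d → 0ℚ < d → d * a < d * b → a < b
  cancel-< d 0<d = ℚP.*-cancelˡ-<-nonNeg d {{ℚ.nonNegative (ℚP.<⇒≤ 0<d)}}

  0≤+ : ∀ {p q} → 0ℚ ≤ p → 0ℚ ≤ q → 0ℚ ≤ p + q
  0≤+ 0≤p 0≤q = ℚP.+-mono-≤ 0≤p 0≤q

  0≤sq : ∀ p → 0ℚ ≤ p * p
  0≤sq p with ℚP.≤-total 0ℚ p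
  ... | inj₁ 0≤p = nonNeg* 0≤p 0≤p
  ... | inj₂ p≤0 = subst (0ℚ ≤_) (eq p) (nonNeg* (ℚP.neg-antimono-≤ p≤0) (ℚP.neg-antimono-≤ p≤0))
    where
    eq : ∀ p → - p * - p ≡ p * p
    eq = solve-∀ ℚ-ring

  *-monoˡ : ∀ {a b} c → 0ℚ ≤ c → a ≤ b → c * a ≤ c * b
  *-monoˡ c 0≤c = ℚP.*-monoˡ-≤-nonNeg c {{ℚ.nonNegative 0≤c}}

  *-monoʳ : ∀ {a b} c → 0ℚ ≤ c → a ≤ b → a * c ≤ b * c
  *-monoʳ c 0≤c = ℚP.*-monoʳ-≤-nonNeg c {{ℚ.nonNegative 0≤c}}

  neg* : ∀ {a b} → 0ℚ ≤ a → b ≤ 0ℚ → a * b ≤ 0ℚ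
  neg* {a} {b} 0≤a b≤0 = subst (a * b ≤_) (ℚP.*-zeroʳ a) (*-monoˡ a 0≤a b≤0)

  ∣∣≤-intro : ∀ {p e} → p ≤ e → - p ≤ e → ∣ p ∣ ≤ e
  ∣∣≤-intro {p} {e} h h′ with ℚP.∣p∣≡p∨∣p∣≡-p p
  ... | inj₁ eq = subst (_≤ e) (sym eq) h
  ... | inj₂ eq = subst (_≤ e) (sym eq) h′

  -p≤∣p∣ : ∀ p → - p ≤ ∣ p ∣
  -p≤∣p∣ p = subst (- p ≤_) (ℚP.∣-p∣≡∣p∣ p) (p≤∣p∣ (- p))

  ∣*∣≤ : ∀ {p q a b} → ∣ p ∣ ≤ a → ∣ q ∣ ≤ b → ∣ p * q ∣ ≤ a * b
  ∣*∣≤ {p} {q} {a} {b} p≤ q≤ = subst (_≤ a * b) (sym (ℚP.∣p*q∣≡∣p∣*∣q∣ p q))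
    (*-mono-nonNeg (ℚP.0≤∣p∣ p) (ℚP.≤-trans (ℚP.0≤∣p∣ q) q≤) p≤ q≤)

  ∣+∣≤ : ∀ {p q a b} → ∣ p ∣ ≤ a → ∣ q ∣ ≤ b → ∣ p + q ∣ ≤ a + b
  ∣+∣≤ {p} {q} p≤ q≤ = ℚP.≤-trans (ℚP.∣p+q∣≤∣p∣+∣q∣ p q) (ℚP.+-mono-≤ p≤ q≤)

  ∣-∣≤-trans : ∀ {p q r a b} → ∣ p - q ∣ ≤ a → ∣ q - r ∣ ≤ b → ∣ p - r ∣ ≤ a + b
  ∣-∣≤-trans {p} {q} {r} {a} {b} h h′ = subst (λ z → ∣ z ∣ ≤ a + b) (eq p q r) (∣+∣≤ h h′)
    where
    eq : ∀ p q r → p - q + (q - r) ≡ p - r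
    eq = solve-∀ ℚ-ring

  ∣nonNeg∣≤ : ∀ {p e} → 0ℚ ≤ p → p ≤ e → ∣ p ∣ ≤ e
  ∣nonNeg∣≤ {p} {e} 0≤p p≤e = subst (_≤ e) (sym (ℚP.0≤p⇒∣p∣≡p 0≤p)) p≤e

  sq-cancel-≤ : ∀ {a b} → 0ℚ ≤ b → a * a ≤ b * b → a ≤ b
  sq-cancel-≤ {a} {b} 0≤b h with a ℚP.≤? b
  ... | yes a≤b = a≤b
  ... | no a≰b = contradiction h (λ aa≤bb → ℚP.<-irrefl refl (ℚP.<-≤-trans (ℚP.≤-<-trans
          (*-monoˡ b 0≤b (ℚP.<⇒≤ b<a))
          (ℚP.*-monoˡ-<-pos a {{ℚ.positive (ℚP.≤-<-trans 0≤b b<a)}} b<a)) aa≤bb))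
    where
    b<a : b < a
    b<a = ℚP.≰⇒> a≰b

  sq≤⇒∣∣≤ : ∀ {p b} → 0ℚ ≤ b → p * p ≤ b * b → ∣ p ∣ ≤ b
  sq≤⇒∣∣≤ {p} {b} 0≤b h = ∣∣≤-intro (sq-cancel-≤ 0≤b h)
    (sq-cancel-≤ 0≤b (subst (_≤ b * b) (eq p) h))
    where
    eq : ∀ p → p * p ≡ - p * - p
    eq = solve-∀ ℚ-ring

  -- 0 for a zero divisor.
  infixl 7 _÷_
  _÷_ : ℚ → ℚ → ℚ
  p ÷ q with q ℚP.≟ 0ℚ
  ... | yes _  = 0ℚ
  ... | no q≢0 = p * (1/ q) {{ℚ.≢-nonZero q≢0}}

  ÷-* : ∀ p {q} → q ≢ 0ℚ → (p ÷ q) * q ≡ p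
  ÷-* p {q} q≢0 with q ℚP.≟ 0ℚ
  ... | yes q≡0 = contradiction q≡0 q≢0
  ... | no q≢0′ = trans (ℚP.*-assoc p _ q)
    (trans (cong (p *_) (ℚP.*-inverseˡ q {{ℚ.≢-nonZero q≢0′}})) (ℚP.*-identityʳ p))

  ÷-*⁺ : ∀ p {q} → 0ℚ < q → (p ÷ q) * q ≡ p
  ÷-*⁺ p 0<q = ÷-* p (0<⇒≢ 0<q)

  0≤÷ : ∀ {p q} → 0ℚ ≤ p → 0ℚ < q → 0ℚ ≤ p ÷ q
  0≤÷ {p} {q} 0≤p 0<q = cancel-≤ q 0<q (subst₂ _≤_ (sym (ℚP.*-zeroʳ q))
    (trans (sym (÷-*⁺ p 0<q)) (ℚP.*-comm (p ÷ q) q)) 0≤p)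

  ÷≤ : ∀ {p q r} → 0ℚ < q → p ≤ r * q → p ÷ q ≤ r
  ÷≤ {p} {q} {r} 0<q h = cancel-≤ q 0<q (subst₂ _≤_
    (trans (sym (÷-*⁺ p 0<q)) (ℚP.*-comm (p ÷ q) q)) (ℚP.*-comm r q) h)

  -- Used in place of `+ n / 1` because `ι (suc n)` unfolds to `1ℚ + ι n`: the ring solver can treat
  -- `ι n` as a variable, and successor cases match its equations by computation.
  ι : ℕ → ℚ
  ι zero    = 0ℚ
  ι (suc n) = 1ℚ + ι n

  0≤ι : ∀ n → 0ℚ ≤ ι n
  0≤ι zero    = ℚP.≤-refl
  0≤ι (suc n) = 0≤+ 0≤1 (0≤ι n)

  0<ι : ∀ n → 0ℚ < ι (suc n)
  0<ι n = pos+nonNeg 0<1 (0≤ι n)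

  ι-+ : ∀ m n → ι (m ℕ.+ n) ≡ ι m + ι n
  ι-+ zero    n = sym (ℚP.+-identityˡ (ι n))
  ι-+ (suc m) n = trans (cong (λ z → 1ℚ + z) (ι-+ m n)) (sym (ℚP.+-assoc 1ℚ (ι m) (ι n)))

  ι-* : ∀ m n → ι (m ℕ.* n) ≡ ι m * ι n
  ι-* zero    n = sym (ℚP.*-zeroˡ (ι n))
  ι-* (suc m) n = trans (ι-+ n (m ℕ.* n)) (trans (cong (λ z → ι n + z) (ι-* m n)) (eq (ι m) (ι n)))
    where
    eq : ∀ a b → b + a * b ≡ (1ℚ + a) * b
    eq = solve-∀ ℚ-ring

  ι-mono : ∀ {m n} → m ℕ.≤ n → ι m ≤ ι n
  ι-mono {n = n} ℕ.z≤n = 0≤ι n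
  ι-mono (ℕ.s≤s h)     = ℚP.+-monoʳ-≤ 1ℚ (ι-mono h)

  /1≡ι : ∀ n → + n / 1 ≡ ι n
  /1≡ι zero    = refl
  /1≡ι (suc n) = trans (ℚP.toℚᵘ-injective (ℚᵘP.≃-trans (ℚP.toℚᵘ-fromℚᵘ (ℚᵘ.mkℚᵘ (+ suc n) 0))
      (ℚᵘP.≃-trans (ℚᵘ.*≡* (eq (+ n)))
        (ℚᵘP.≃-sym (ℚᵘP.≃-trans (ℚP.toℚᵘ-homo-+ 1ℚ (+ n / 1))
          (ℚᵘP.+-congʳ (ℚᵘ.mkℚᵘ (+ 1) 0) (ℚP.toℚᵘ-fromℚᵘ (ℚᵘ.mkℚᵘ (+ n) 0))))))))
    (cong (λ z → 1ℚ + z) (/1≡ι n))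
    where
    eq : ∀ z → (+ 1 ℤ.+ z) ℤ.* + 1 ≡ (+ 1 ℤ.* + 1 ℤ.+ z ℤ.* + 1) ℤ.* + 1
    eq = ℤR.solve-∀

  /-*ι : ∀ a d → + a / suc d * ι (suc d) ≡ ι a
  /-*ι a d = trans (cong (λ z → + a / suc d * z) (sym (/1≡ι (suc d))))
    (trans (ℚP.toℚᵘ-injective (ℚᵘP.≃-trans (ℚP.toℚᵘ-homo-* (+ a / suc d) (+ suc d / 1))
        (ℚᵘP.≃-trans
          (ℚᵘP.*-cong (ℚP.toℚᵘ-fromℚᵘ (ℚᵘ.mkℚᵘ (+ a) d)) (ℚP.toℚᵘ-fromℚᵘ (ℚᵘ.mkℚᵘ (+ suc d) 0)))
          (ℚᵘP.≃-trans (ℚᵘ.*≡* (eq (+ a) (+ suc d)))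
            (ℚᵘP.≃-sym (ℚP.toℚᵘ-fromℚᵘ (ℚᵘ.mkℚᵘ (+ a) 0)))))))
      (/1≡ι a))
    where
    eq : ∀ x y → x ℤ.* y ℤ.* + 1 ≡ x ℤ.* (y ℤ.* + 1)
    eq = ℤR.solve-∀

  sum : (ℕ → ℚ) → ℕ → ℚ
  sum f zero    = 0ℚ
  sum f (suc n) = sum f n + f n

  sum-cong : ∀ {f g} n → (∀ i → f i ≡ g i) → sum f n ≡ sum g n
  sum-cong zero    h = refl
  sum-cong (suc n) h = cong₂ _+_ (sum-cong n h) (h n)

  sum-* : ∀ c f n → sum (λ i → c * f i) n ≡ c * sum f n
  sum-* c f zero    = sym (ℚP.*-zeroʳ c)
  sum-* c f (suc n) = trans (cong (_+ c * f n) (sum-* c f n)) (sym (ℚP.*-distribˡ-+ c (sum f n) (f n)))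

  sum-≥0 : ∀ {f} n → (∀ i → 0ℚ ≤ f i) → 0ℚ ≤ sum f n
  sum-≥0 zero    h = ℚP.≤-refl
  sum-≥0 (suc n) h = 0≤+ (sum-≥0 n h) (h n)

  infixr 8 _^_
  _^_ : ℚ → ℕ → ℚ
  p ^ zero  = 1ℚ
  p ^ suc n = p * p ^ n

  0≤^ : ∀ {p} n → 0ℚ ≤ p → 0ℚ ≤ p ^ n
  0≤^ zero    0≤p = 0≤1
  0≤^ (suc n) 0≤p = nonNeg* 0≤p (0≤^ n 0≤p)

  ^≤1 : ∀ {p} n → 0ℚ ≤ p → p ≤ 1ℚ → p ^ n ≤ 1ℚ
  ^≤1 zero    0≤p p≤1 = ℚP.≤-refl
  ^≤1 (suc n) 0≤p p≤1 = *-mono-nonNeg 0≤p 0≤1 p≤1 (^≤1 n 0≤p p≤1)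

  1^ : ∀ n → 1ℚ ^ n ≡ 1ℚ
  1^ zero    = refl
  1^ (suc n) = trans (ℚP.*-identityˡ (1ℚ ^ n)) (1^ n)

-- Legendre polynomials at rational points.

module LegendrePolynomials where

  open import Data.Rational.Base using (_+_; _-_; -_; _*_; _/_; _≤_; _<_; ∣_∣; 1/_)
  open Arithmetic

  -- Keeps the exact shape of `legendre`, literals included, so that each entry of the real
  -- polynomial agrees with it by congruence alone (`seq-legendre`).
  P : ℕ → ℚ → ℚ
  P zero          y = 1ℚ
  P (suc zero)    y = y
  P (suc (suc n)) y = + 1 / (2 ℕ.+ n) *
    (+ (2 ℕ.* n ℕ.+ 3) / 1 * y * P (suc n) y - + (n ℕ.+ 1) / 1 * P n y)

  bonnet : ∀ n y → (2ℚ + ι n) * P (suc (suc n)) y ≡ (2ℚ * ι n + 3ℚ) * y * P (suc n) y - (ι n + 1ℚ) * P n y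
  bonnet n y = by₃ ((2ℚ * ν + 3ℚ) * y * p₁ - (ν + 1ℚ) * p₀)
      ((2ℚ + ν) * r * y * p₁) (- ((2ℚ + ν) * r * p₀)) (/-*ι 1 (suc n)) A≡ B≡
      (eq ν r (+ (2 ℕ.* n ℕ.+ 3) / 1) (+ (n ℕ.+ 1) / 1) y p₀ p₁)
    where
    ν r p₀ p₁ : ℚ
    ν = ι n
    r = + 1 / (2 ℕ.+ n)
    p₀ = P n y
    p₁ = P (suc n) y
    A≡ : + (2 ℕ.* n ℕ.+ 3) / 1 ≡ 2ℚ * ν + 3ℚ
    A≡ = trans (/1≡ι (2 ℕ.* n ℕ.+ 3)) (trans (ι-+ (2 ℕ.* n) 3) (cong (_+ 3ℚ) (ι-* 2 n)))
    B≡ : + (n ℕ.+ 1) / 1 ≡ ν + 1ℚ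
    B≡ = trans (/1≡ι (n ℕ.+ 1)) (ι-+ n 1)
    eq : ∀ ν r A B y p₀ p₁ → (2ℚ + ν) * (r * (A * y * p₁ - B * p₀)) ≡
      (2ℚ * ν + 3ℚ) * y * p₁ - (ν + 1ℚ) * p₀
      + ((2ℚ * ν + 3ℚ) * y * p₁ - (ν + 1ℚ) * p₀) * (r * (1ℚ + (1ℚ + ν)) - (1ℚ + 0ℚ))
      + (2ℚ + ν) * r * y * p₁ * (A - (2ℚ * ν + 3ℚ))
      + - ((2ℚ + ν) * r * p₀) * (B - (ν + 1ℚ))
    eq = solve-∀ ℚ-ring

  -- (1 - y²) Pₙ² + (Pₙ₊₁ - y Pₙ)², a discrete energy that Bonnet's recurrence
  -- does not increase.
  energy : ℕ → ℚ → ℚ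
  energy n y = P n y * P n y + P (suc n) y * P (suc n) y - 2ℚ * y * P n y * P (suc n) y

  -- By Bonnet's recurrence, (n + 2)² times the loss of energy is (2n + 3) (y Pₙ₊₁ - Pₙ)².
  energy-decreasing : ∀ n y → energy (suc n) y ≤ energy n y
  energy-decreasing n y = cancel-≤ ((2ℚ + ν) * (2ℚ + ν)) (pos* 0<2+ν 0<2+ν)
      (≤-by ((2ℚ * ν + 3ℚ) * ((y * p₁ - p₀) * (y * p₁ - p₀)))
        (nonNeg* (0≤+ (0≤2* (0≤ι n)) (0≤/ 3 0)) (0≤sq (y * p₁ - p₀)))
        (by₁ (2ℚ * (2ℚ + ν) * y * p₁ - ((2ℚ + ν) * p₂ + ((2ℚ * ν + 3ℚ) * y * p₁ - (ν + 1ℚ) * p₀)))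
          (bonnet n y) (eq ν y p₀ p₁ p₂)))
    where
    ν p₀ p₁ p₂ : ℚ
    ν = ι n
    p₀ = P n y
    p₁ = P (suc n) y
    p₂ = P (suc (suc n)) y
    0<2+ν : 0ℚ < 2ℚ + ν
    0<2+ν = pos+nonNeg {2ℚ} (ℚP.positive⁻¹ 2ℚ) (0≤ι n)
    eq : ∀ ν y p₀ p₁ p₂ →
      (2ℚ + ν) * (2ℚ + ν) * (p₀ * p₀ + p₁ * p₁ - 2ℚ * y * p₀ * p₁) ≡
      (2ℚ + ν) * (2ℚ + ν) * (p₁ * p₁ + p₂ * p₂ - 2ℚ * y * p₁ * p₂)
      + (2ℚ * ν + 3ℚ) * ((y * p₁ - p₀) * (y * p₁ - p₀))
      + (2ℚ * (2ℚ + ν) * y * p₁ - ((2ℚ + ν) * p₂ + ((2ℚ * ν + 3ℚ) * y * p₁ - (ν + 1ℚ) * p₀)))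
        * ((2ℚ + ν) * p₂ - ((2ℚ * ν + 3ℚ) * y * p₁ - (ν + 1ℚ) * p₀))
    eq = solve-∀ ℚ-ring

  energy≤ : ∀ n y → energy n y ≤ 1ℚ - y * y
  energy≤ zero y = ℚP.≤-reflexive (eq y)
    where
    eq : ∀ y → 1ℚ * 1ℚ + y * y - 2ℚ * y * 1ℚ * y ≡ 1ℚ - y * y
    eq = solve-∀ ℚ-ring
  energy≤ (suc n) y = ℚP.≤-trans (energy-decreasing n y) (energy≤ n y)

  energy-split : ∀ n y → energy n y ≡
    (1ℚ - y * y) * (P n y * P n y) + (P (suc n) y - y * P n y) * (P (suc n) y - y * P n y)
  energy-split n y = eq y (P n y) (P (suc n) y)
    where
    eq : ∀ y p q → p * p + q * q - 2ℚ * y * p * q ≡ (1ℚ - y * y) * (p * p) + (q - y * p) * (q - y * p)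
    eq = solve-∀ ℚ-ring

  -- At y² = 1 the first square in `energy-split` has weight 0 and the bound 1 - y² on the energy is
  -- 0, so the second square vanishes.
  P-endpoint : ∀ n y → y * y ≡ 1ℚ → P (suc n) y ≡ y * P n y
  P-endpoint n y yy≡1 = diff≡0 (sq≤0 (subst₂ _≤_ (trans (energy-split n y) drop) (ends y yy≡1) (energy≤ n y)))
    where
    d : ℚ
    d = P (suc n) y - y * P n y
    drop : (1ℚ - y * y) * (P n y * P n y) + d * d ≡ d * d
    drop = by₁ (- (P n y * P n y)) yy≡1 (eq y (P n y) d)
      where
      eq : ∀ y p d → (1ℚ - y * y) * (p * p) + d * d ≡ d * d + - (p * p) * (y * y - 1ℚ)
      eq = solve-∀ ℚ-ring
    ends : ∀ y → y * y ≡ 1ℚ → 1ℚ - y * y ≡ 0ℚ * 0ℚ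
    ends y h = cong (λ z → 1ℚ - z) h
    sq≤0 : d * d ≤ 0ℚ * 0ℚ → d ≡ 0ℚ
    sq≤0 h = ℚP.∣p∣≡0⇒p≡0 d (ℚP.≤-antisym (sq≤⇒∣∣≤ ℚP.≤-refl h) (ℚP.0≤∣p∣ d))
    diff≡0 : d ≡ 0ℚ → P (suc n) y ≡ y * P n y
    diff≡0 h = by₁ 1ℚ h (eq (P (suc n) y) (y * P n y))
      where
      eq : ∀ p q → p ≡ q + 1ℚ * (p - q - 0ℚ)
      eq = solve-∀ ℚ-ring

  P-one : ∀ n → P n 1ℚ ≡ 1ℚ
  P-one zero    = refl
  P-one (suc n) = trans (P-endpoint n 1ℚ refl) (trans (ℚP.*-identityˡ (P n 1ℚ)) (P-one n))

  P-endpoint-sq : ∀ n y → y * y ≡ 1ℚ → P n y * P n y ≡ 1ℚ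
  P-endpoint-sq zero    y h = refl
  P-endpoint-sq (suc n) y h = trans (cong (λ z → z * z) (P-endpoint n y h))
    (by₂ (P n y * P n y) 1ℚ h (P-endpoint-sq n y h) (eq y (P n y)))
    where
    eq : ∀ y p → y * p * (y * p) ≡ 1ℚ + p * p * (y * y - 1ℚ) + 1ℚ * (p * p - 1ℚ)
    eq = solve-∀ ℚ-ring

  -- `energy-split` gives (1 - y²) Pₙ² ≤ 1 - y². The factor cancels except at the endpoints, where
  -- Pₙ² is computed separately.
  ∣P∣≤1 : ∀ n y → y * y ≤ 1ℚ → ∣ P n y ∣ ≤ 1ℚ
  ∣P∣≤1 n y yy≤1 = sq≤⇒∣∣≤ 0≤1 sq≤1
    where
    p : ℚ
    p = P n y
    sq≤1 : p * p ≤ 1ℚ * 1ℚ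
    sq≤1 with y * y ℚP.≟ 1ℚ
    ... | yes yy≡1 = ℚP.≤-reflexive (P-endpoint-sq n y yy≡1)
    ... | no  yy≢1 = cancel-≤ (1ℚ - y * y) 0<1-yy (ℚP.≤-trans (≤-by (d * d) (0≤sq d) (energy-split n y))
        (subst (energy n y ≤_) (sym (ℚP.*-identityʳ (1ℚ - y * y))) (energy≤ n y)))
      where
      d : ℚ
      d = P (suc n) y - y * p
      0<1-yy : 0ℚ < 1ℚ - y * y
      0<1-yy with y * y ℚP.<? 1ℚ
      ... | yes yy<1 = subst (_< 1ℚ - y * y) (ℚP.+-inverseʳ (y * y)) (ℚP.+-monoˡ-< (- (y * y)) yy<1)
      ... | no  yy≮1 = contradiction (ℚP.≤-antisym yy≤1 (ℚP.≮⇒≥ yy≮1)) yy≢1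

  -- Unlike `2 ℕ.* n`, this exposes two successors at `suc n`, so that `P (double (suc n))` unfolds.
  double : ℕ → ℕ
  double zero    = zero
  double (suc n) = suc (suc (double n))

  2*≡double : ∀ n → 2 ℕ.* n ≡ double n
  2*≡double zero    = refl
  2*≡double (suc n) = cong suc (trans (ℕP.+-suc n (n ℕ.+ 0)) (cong suc (2*≡double n)))

  ι-double : ∀ n → ι (double n) ≡ 2ℚ * ι n
  ι-double n = trans (cong ι (sym (2*≡double n))) (ι-* 2 n)

  Pe Po : ℕ → ℚ → ℚ
  Pe n = P (double n)
  Po n = P (suc (double n))

  bonnet-even : ∀ n y → (2ℚ * ι n + 2ℚ) * Pe (suc n) y ≡ (4ℚ * ι n + 3ℚ) * y * Po n y - (2ℚ * ι n + 1ℚ) * Pe n y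
  bonnet-even n y = by₂ (2ℚ * y * Po n y - Pe n y - Pe (suc n) y) 1ℚ (ι-double n) (bonnet (double n) y)
      (eq (ι n) (ι (double n)) y (Pe n y) (Po n y) (Pe (suc n) y))
    where
    eq : ∀ ν δ y p q r → (2ℚ * ν + 2ℚ) * r ≡ (4ℚ * ν + 3ℚ) * y * q - (2ℚ * ν + 1ℚ) * p
      + (2ℚ * y * q - p - r) * (δ - 2ℚ * ν)
      + 1ℚ * ((2ℚ + δ) * r - ((2ℚ * δ + 3ℚ) * y * q - (δ + 1ℚ) * p))
    eq = solve-∀ ℚ-ring

  bonnet-odd : ∀ n y → (2ℚ * ι n + 3ℚ) * Po (suc n) y ≡ (4ℚ * ι n + 5ℚ) * y * Pe (suc n) y - (2ℚ * ι n + 2ℚ) * Po n y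
  bonnet-odd n y = by₂ (2ℚ * y * Pe (suc n) y - Po n y - Po (suc n) y) 1ℚ (ι-double n) (bonnet (suc (double n)) y)
      (eq (ι n) (ι (double n)) y (Po n y) (Pe (suc n) y) (Po (suc n) y))
    where
    eq : ∀ ν δ y p q r → (2ℚ * ν + 3ℚ) * r ≡ (4ℚ * ν + 5ℚ) * y * q - (2ℚ * ν + 2ℚ) * p
      + (2ℚ * y * q - p - r) * (δ - 2ℚ * ν)
      + 1ℚ * ((2ℚ + (1ℚ + δ)) * r - ((2ℚ * (1ℚ + δ) + 3ℚ) * y * q - ((1ℚ + δ) + 1ℚ) * p))
    eq = solve-∀ ℚ-ring

  -- The mean square of P₂ₙ on [-1, 1] is 1/(4n + 1). With that weight split off, `b n` stands for
  -- the mean of f P₂ₙ, and multiplication by y becomes a two-term rule with the coefficients of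
  -- Bonnet's recurrence.
  evenSum : (ℕ → ℚ) → ℕ → ℚ → ℚ
  evenSum b N y = sum (λ n → (4ℚ * ι n + 1ℚ) * b n * Pe n y) N

  -- Multiplication by y takes the coefficients (4n + 1) bₙ of the even Legendre
  -- polynomials to (4n + 3) oₙ of the odd ones, and those to (4n + 1) b′ₙ.
  multiply-y² : (b o b′ : ℕ → ℚ) →
    (∀ n → (4ℚ * ι n + 3ℚ) * o n ≡ (2ℚ * ι n + 1ℚ) * b n + (2ℚ * ι n + 2ℚ) * b (suc n)) →
    b′ 0 ≡ o 0 →
    (∀ n → (4ℚ * ι n + 5ℚ) * b′ (suc n) ≡ (2ℚ * ι n + 3ℚ) * o (suc n) + (2ℚ * ι n + 2ℚ) * o n) →
    ∀ N y → y * y * evenSum b (suc N) y ≡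
      evenSum b′ (suc N) y + (2ℚ * ι N + 2ℚ) * (o N * Pe (suc N) y - y * (b (suc N) * Po N y))
  multiply-y² b o b′ h h₀ h′ zero y =
    by₃ (- (y * y)) (- 1ℚ) (- o 0) (h 0) h₀ (bonnet-even 0 y) (eq y (b 0) (b 1) (o 0) (b′ 0) (Pe 1 y))
    where
    eq : ∀ y b₀ b₁ o₀ b₀′ p → y * y * (0ℚ + (4ℚ * 0ℚ + 1ℚ) * b₀ * 1ℚ) ≡
      0ℚ + (4ℚ * 0ℚ + 1ℚ) * b₀′ * 1ℚ + (2ℚ * 0ℚ + 2ℚ) * (o₀ * p - y * (b₁ * y))
      + - (y * y) * ((4ℚ * 0ℚ + 3ℚ) * o₀ - ((2ℚ * 0ℚ + 1ℚ) * b₀ + (2ℚ * 0ℚ + 2ℚ) * b₁))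
      + - 1ℚ * (b₀′ - o₀)
      + - o₀ * ((2ℚ * 0ℚ + 2ℚ) * p - ((4ℚ * 0ℚ + 3ℚ) * y * y - (2ℚ * 0ℚ + 1ℚ) * 1ℚ))
    eq = solve-∀ ℚ-ring
  multiply-y² b o b′ h h₀ h′ (suc N) y =
    by₁ 1ℚ (multiply-y² b o b′ h h₀ h′ N y)
      (by₂ (- p₁) (- o₁) (h′ N) (bonnet-even (suc N) y)
        (by₂ (- (y * p₂)) (- (y * b₁)) (h (suc N)) (bonnet-odd N y)
          (eq (ι N) y S S′ (o N) o₁ b₁ (b (suc (suc N))) (b′ (suc N)) (Po N y) p₁ p₂ (Pe (suc (suc N)) y))))
    where
    S S′ o₁ b₁ p₁ p₂ : ℚ
    S  = evenSum b (suc N) y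
    S′ = evenSum b′ (suc N) y
    o₁ = o (suc N)
    b₁ = b (suc N)
    p₁ = Pe (suc N) y
    p₂ = Po (suc N) y
    eq : ∀ ν y S S′ o₀ o₁ b₁ b₂ b₁′ p₀ p₁ p₂ p₃ →
      y * y * (S + (4ℚ * (1ℚ + ν) + 1ℚ) * b₁ * p₁) ≡
      S′ + (4ℚ * (1ℚ + ν) + 1ℚ) * b₁′ * p₁ + (2ℚ * (1ℚ + ν) + 2ℚ) * (o₁ * p₃ - y * (b₂ * p₂))
      + 1ℚ * (y * y * S - (S′ + (2ℚ * ν + 2ℚ) * (o₀ * p₁ - y * (b₁ * p₀))))
      + - p₁ * ((4ℚ * ν + 5ℚ) * b₁′ - ((2ℚ * ν + 3ℚ) * o₁ + (2ℚ * ν + 2ℚ) * o₀))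
      + - o₁ * ((2ℚ * (1ℚ + ν) + 2ℚ) * p₃ - ((4ℚ * (1ℚ + ν) + 3ℚ) * y * p₂ - (2ℚ * (1ℚ + ν) + 1ℚ) * p₁))
      + - (y * p₂) * ((4ℚ * (1ℚ + ν) + 3ℚ) * o₁ - ((2ℚ * (1ℚ + ν) + 1ℚ) * b₁ + (2ℚ * (1ℚ + ν) + 2ℚ) * b₂))
      + - (y * b₁) * ((2ℚ * ν + 3ℚ) * p₂ - ((4ℚ * ν + 5ℚ) * y * p₁ - (2ℚ * ν + 2ℚ) * p₀))
    eq = solve-∀ ℚ-ring

-- The Taylor polynomials of √(1 - z) in Legendre form.

module TaylorSeries where

  open import Data.Rational.Base using (_+_; _-_; -_; _*_; _/_; _≤_; _<_; ∣_∣; 1/_)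
  open Arithmetic
  open LegendrePolynomials

  0<+ : ∀ {p q} → 0ℚ ≤ p → 0ℚ < q → 0ℚ < p + q
  0<+ = nonNeg+pos

  0<1ℚ+ι : ∀ n → 0ℚ < ι n + 1ℚ
  0<1ℚ+ι n = 0<+ (0≤ι n) 0<1

  0≤2ι : ∀ n → 0ℚ ≤ 2ℚ * ι n
  0≤2ι n = nonNeg* (0≤/ 2 0) (0≤ι n)

  0<2ι+1 : ∀ n → 0ℚ < 2ℚ * ι n + 1ℚ
  0<2ι+1 n = 0<+ (0≤2ι n) 0<1

  0<2ι+2 : ∀ n → 0ℚ < 2ℚ * ι n + 2ℚ
  0<2ι+2 n = 0<+ (0≤2ι n) (ℚP.positive⁻¹ 2ℚ)

  0<2ι+3 : ∀ n → 0ℚ < 2ℚ * ι n + 3ℚ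
  0<2ι+3 n = 0<+ (0≤2ι n) (ℚP.positive⁻¹ 3ℚ)

  -- The number C(2n, n) / 4ⁿ; `centralRatio≡w` makes the identification.
  w : ℕ → ℚ
  w zero    = 1ℚ
  w (suc n) = (2ℚ * ι n + 1ℚ) * w n ÷ (2ℚ * ι n + 2ℚ)

  w-suc : ∀ n → w (suc n) * (2ℚ * ι n + 2ℚ) ≡ (2ℚ * ι n + 1ℚ) * w n
  w-suc n = ÷-*⁺ _ (0<2ι+2 n)

  0≤w : ∀ n → 0ℚ ≤ w n
  0≤w zero    = 0≤1
  0≤w (suc n) = 0≤÷ (nonNeg* (ℚP.<⇒≤ (0<2ι+1 n)) (0≤w n)) (0<2ι+2 n)

  -- The left side decreases with n, by the ratio (2n + 1)(2n + 3) / (2n + 2)². This rate gives both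
  -- `w-null` and the quadratic decay in `γ-bound`.
  w²≤ : ∀ n → (2ℚ * ι n + 1ℚ) * (w n * w n) ≤ 1ℚ
  w²≤ zero    = ℚP.≤-refl
  w²≤ (suc n) = ℚP.≤-trans (cancel-≤ (d * d) (pos* (0<2ι+2 n) (0<2ι+2 n))
      (≤-by ((2ℚ * ν + 1ℚ) * (u * u)) (nonNeg* (ℚP.<⇒≤ (0<2ι+1 n)) (0≤sq u))
        (by₁ (- ((2ℚ * (1ℚ + ν) + 1ℚ) * (v * d + (2ℚ * ν + 1ℚ) * u))) (w-suc n) (eq ν u v))))
      (w²≤ n)
    where
    ν u v d : ℚ
    ν = ι n
    u = w n
    v = w (suc n)
    d = 2ℚ * ν + 2ℚ
    eq : ∀ ν u v → (2ℚ * ν + 2ℚ) * (2ℚ * ν + 2ℚ) * ((2ℚ * ν + 1ℚ) * (u * u)) ≡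
      (2ℚ * ν + 2ℚ) * (2ℚ * ν + 2ℚ) * ((2ℚ * (1ℚ + ν) + 1ℚ) * (v * v)) + (2ℚ * ν + 1ℚ) * (u * u)
      + - ((2ℚ * (1ℚ + ν) + 1ℚ) * (v * (2ℚ * ν + 2ℚ) + (2ℚ * ν + 1ℚ) * u))
        * (v * (2ℚ * ν + 2ℚ) - (2ℚ * ν + 1ℚ) * u)
    eq = solve-∀ ℚ-ring

  -- The Taylor coefficients of √(1 - z).
  a : ℕ → ℚ
  a zero    = 1ℚ
  a (suc m) = - (w m ÷ (2ℚ * ι m + 2ℚ))

  a-suc-w : ∀ m → a (suc m) * (2ℚ * ι m + 2ℚ) ≡ - w m
  a-suc-w m = trans (eq (w m ÷ (2ℚ * ι m + 2ℚ)) (2ℚ * ι m + 2ℚ)) (cong -_ (÷-*⁺ (w m) (0<2ι+2 m)))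
    where
    eq : ∀ p q → - p * q ≡ - (p * q)
    eq = solve-∀ ℚ-ring

  a-suc≤0 : ∀ m → a (suc m) ≤ 0ℚ
  a-suc≤0 m = ℚP.neg-antimono-≤ (0≤÷ (0≤w m) (0<2ι+2 m))

  a-suc : ∀ m → (2ℚ * ι m + 2ℚ) * a (suc m) ≡ (2ℚ * ι m - 1ℚ) * a m
  a-suc zero    = refl
  a-suc (suc m) = cancelˡ (2ℚ * ι m + 2ℚ) (0<⇒≢ (0<2ι+2 m))
    (by₃ (2ℚ * ι m + 2ℚ) (- 1ℚ) (- (2ℚ * (1ℚ + ι m) - 1ℚ)) (a-suc-w (suc m)) (w-suc m) (a-suc-w m)
      (eq (ι m) (w m) (w (suc m)) (a (suc m)) (a (suc (suc m)))))
    where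
    eq : ∀ ν u v x y → (2ℚ * ν + 2ℚ) * ((2ℚ * (1ℚ + ν) + 2ℚ) * y) ≡ (2ℚ * ν + 2ℚ) * ((2ℚ * (1ℚ + ν) - 1ℚ) * x)
      + (2ℚ * ν + 2ℚ) * (y * (2ℚ * (1ℚ + ν) + 2ℚ) - - v)
      + - 1ℚ * (v * (2ℚ * ν + 2ℚ) - (2ℚ * ν + 1ℚ) * u)
      + - (2ℚ * (1ℚ + ν) - 1ℚ) * (x * (2ℚ * ν + 2ℚ) - - u)
    eq = solve-∀ ℚ-ring

  -- At z = 1 the root √(1 - z) is 0, so `w m` is exactly the truncation error there.
  sum-a : ∀ m → sum a (suc m) ≡ w m
  sum-a zero    = refl
  sum-a (suc m) = cancelˡ (2ℚ * ι m + 2ℚ) (0<⇒≢ (0<2ι+2 m))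
    (by₃ (2ℚ * ι m + 2ℚ) 1ℚ (- 1ℚ) (sum-a m) (a-suc-w m) (w-suc m)
      (eq (ι m) (sum a (suc m)) (a (suc m)) (w m) (w (suc m))))
    where
    eq : ∀ ν s x u v → (2ℚ * ν + 2ℚ) * (s + x) ≡ (2ℚ * ν + 2ℚ) * v
      + (2ℚ * ν + 2ℚ) * (s - u) + 1ℚ * (x * (2ℚ * ν + 2ℚ) - - u) + - 1ℚ * (v * (2ℚ * ν + 2ℚ) - (2ℚ * ν + 1ℚ) * u)
    eq = solve-∀ ℚ-ring

  -- y²ᵐ = Σ (4n + 1) β m n P₂ₙ(y).
  β : ℕ → ℕ → ℚ
  β m zero    = 1ℚ ÷ (2ℚ * ι m + 1ℚ)
  β m (suc n) = 2ℚ * (ι m - ι n) * β m n ÷ (2ℚ * ι m + (2ℚ * ι n + 3ℚ))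

  0<den : ∀ m n → 0ℚ < 2ℚ * ι m + (2ℚ * ι n + 3ℚ)
  0<den m n = 0<+ (0≤2ι m) (0<2ι+3 n)

  β-zero : ∀ m → β m 0 * (2ℚ * ι m + 1ℚ) ≡ 1ℚ
  β-zero m = ÷-*⁺ 1ℚ (0<2ι+1 m)

  β-sucʳ : ∀ m n → β m (suc n) * (2ℚ * ι m + (2ℚ * ι n + 3ℚ)) ≡ 2ℚ * (ι m - ι n) * β m n
  β-sucʳ m n = ÷-*⁺ _ (0<den m n)

  -- The factor m + 1 - n stays on the left: at n = m + 1 it is 0 and so is `β m n`, whereas the
  -- leading coefficient `β (suc m) n` is not, so no quotient formula covers this case.
  β-sucˡ : ∀ m n → (2ℚ * ι m + (2ℚ * ι n + 3ℚ)) * ((ι m + 1ℚ - ι n) * β (suc m) n) ≡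
                   (ι m + 1ℚ) * (2ℚ * ι m + 1ℚ) * β m n
  β-sucˡ m zero = by₂ (ι m + 1ℚ) (- (ι m + 1ℚ)) (β-zero (suc m)) (β-zero m) (eq (ι m) (β m 0) (β (suc m) 0))
    where
    eq : ∀ μ b b′ → (2ℚ * μ + (2ℚ * 0ℚ + 3ℚ)) * ((μ + 1ℚ - 0ℚ) * b′) ≡ (μ + 1ℚ) * (2ℚ * μ + 1ℚ) * b
      + (μ + 1ℚ) * (b′ * (2ℚ * (1ℚ + μ) + 1ℚ) - 1ℚ) + - (μ + 1ℚ) * (b * (2ℚ * μ + 1ℚ) - 1ℚ)
    eq = solve-∀ ℚ-ring
  β-sucˡ m (suc n) = cancelˡ (2ℚ * ι m + (2ℚ * ι n + 3ℚ)) (0<⇒≢ (0<den m n))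
    (by₃ ((2ℚ * ι m + (2ℚ * ι n + 3ℚ)) * (ι m - ι n)) (2ℚ * (ι m - ι n)) (- ((ι m + 1ℚ) * (2ℚ * ι m + 1ℚ)))
      (β-sucʳ (suc m) n) (β-sucˡ m n) (β-sucʳ m n)
      (eq (ι m) (ι n) (β m n) (β m (suc n)) (β (suc m) n) (β (suc m) (suc n))))
    where
    eq : ∀ μ ν b b₁ b′ b₁′ → (2ℚ * μ + (2ℚ * ν + 3ℚ)) * ((2ℚ * μ + (2ℚ * (1ℚ + ν) + 3ℚ)) * ((μ + 1ℚ - (1ℚ
      + ν)) * b₁′)) ≡
      (2ℚ * μ + (2ℚ * ν + 3ℚ)) * ((μ + 1ℚ) * (2ℚ * μ + 1ℚ) * b₁)
      + (2ℚ * μ + (2ℚ * ν + 3ℚ)) * (μ - ν) * (b₁′ * (2ℚ * (1ℚ + μ) + (2ℚ * ν + 3ℚ)) - 2ℚ * ((1ℚ + μ) - ν) * b′)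
      + 2ℚ * (μ - ν) * ((2ℚ * μ + (2ℚ * ν + 3ℚ)) * ((μ + 1ℚ - ν) * b′) - (μ + 1ℚ) * (2ℚ * μ + 1ℚ) * b)
      + - ((μ + 1ℚ) * (2ℚ * μ + 1ℚ)) * (b₁ * (2ℚ * μ + (2ℚ * ν + 3ℚ)) - 2ℚ * (μ - ν) * b)
    eq = solve-∀ ℚ-ring

  β-vanishes : ∀ m n → m ℕ.< n → β m n ≡ 0ℚ
  β-vanishes m (suc n) (ℕ.s≤s m≤n) = cancelˡ D (0<⇒≢ (0<den m n))
    (trans (ℚP.*-comm D (β m (suc n))) (trans (β-sucʳ m n) (trans factor≡0 (sym (ℚP.*-zeroʳ D)))))
    where
    D : ℚ
    D = 2ℚ * ι m + (2ℚ * ι n + 3ℚ)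
    eq : ∀ μ b → 2ℚ * (μ - μ) * b ≡ 0ℚ
    eq = solve-∀ ℚ-ring
    factor≡0 : 2ℚ * (ι m - ι n) * β m n ≡ 0ℚ
    factor≡0 with ℕP.m≤n⇒m<n∨m≡n m≤n
    ... | inj₁ m<n  = trans (cong (2ℚ * (ι m - ι n) *_) (β-vanishes m n m<n)) (ℚP.*-zeroʳ (2ℚ * (ι m - ι n)))
    ... | inj₂ refl = eq (ι m) (β m m)

  0≤β : ∀ m n → 0ℚ ≤ β m n
  -- For n > m the factor is negative but `β m n` is 0. Together with `a-suc≤0` this fixes the sign
  -- of the error term in `τ-suc`.
  0≤[m-n]β : ∀ m n → 0ℚ ≤ (ι m - ι n) * β m n

  0≤β m zero    = 0≤÷ 0≤1 (0<2ι+1 m)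
  0≤β m (suc n) = 0≤÷ (subst (0ℚ ≤_) (sym (ℚP.*-assoc 2ℚ (ι m - ι n) (β m n)))
    (nonNeg* (0≤/ 2 0) (0≤[m-n]β m n))) (0<den m n)

  0≤[m-n]β m n with n ℕP.≤? m
  ... | yes n≤m = nonNeg* (≤⇒0≤- (ι-mono n≤m)) (0≤β m n)
  ... | no  n≰m = ℚP.≤-reflexive (sym (trans (cong ((ι m - ι n) *_) (β-vanishes m n (ℕP.≰⇒> n≰m)))
                    (ℚP.*-zeroʳ (ι m - ι n))))

  -- y²ᵐ⁺¹ = Σ (4n + 3) βₒ m n P₂ₙ₊₁(y).
  βₒ : ℕ → ℕ → ℚ
  βₒ m n = (2ℚ * ι m + 1ℚ) * β m n ÷ (2ℚ * ι m + (2ℚ * ι n + 3ℚ))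

  βₒ-def : ∀ m n → βₒ m n * (2ℚ * ι m + (2ℚ * ι n + 3ℚ)) ≡ (2ℚ * ι m + 1ℚ) * β m n
  βₒ-def m n = ÷-*⁺ _ (0<den m n)

  βₒ-vanishes : ∀ m n → m ℕ.< n → βₒ m n ≡ 0ℚ
  βₒ-vanishes m n m<n = cancelˡ D (0<⇒≢ (0<den m n))
    (trans (ℚP.*-comm D (βₒ m n)) (trans (βₒ-def m n)
      (trans (cong ((2ℚ * ι m + 1ℚ) *_) (β-vanishes m n m<n))
        (trans (ℚP.*-zeroʳ (2ℚ * ι m + 1ℚ)) (sym (ℚP.*-zeroʳ D))))))
    where
    D : ℚ
    D = 2ℚ * ι m + (2ℚ * ι n + 3ℚ)

  private
    even→odd : ∀ m n → (4ℚ * ι n + 3ℚ) * βₒ m n ≡ (2ℚ * ι n + 1ℚ) * β m n + (2ℚ * ι n + 2ℚ) * β m (suc n)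
    even→odd m n = cancelˡ (2ℚ * ι m + (2ℚ * ι n + 3ℚ)) (0<⇒≢ (0<den m n))
      (by₂ (4ℚ * ι n + 3ℚ) (- (2ℚ * ι n + 2ℚ)) (βₒ-def m n) (β-sucʳ m n)
        (eq (ι m) (ι n) (β m n) (β m (suc n)) (βₒ m n)))
      where
      eq : ∀ μ ν b b₁ o → (2ℚ * μ + (2ℚ * ν + 3ℚ)) * ((4ℚ * ν + 3ℚ) * o) ≡
        (2ℚ * μ + (2ℚ * ν + 3ℚ)) * ((2ℚ * ν + 1ℚ) * b + (2ℚ * ν + 2ℚ) * b₁)
        + (4ℚ * ν + 3ℚ) * (o * (2ℚ * μ + (2ℚ * ν + 3ℚ)) - (2ℚ * μ + 1ℚ) * b)
        + - (2ℚ * ν + 2ℚ) * (b₁ * (2ℚ * μ + (2ℚ * ν + 3ℚ)) - 2ℚ * (μ - ν) * b)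
      eq = solve-∀ ℚ-ring

    odd→even₀ : ∀ m → β (suc m) 0 ≡ βₒ m 0
    odd→even₀ m = cancelˡ (2ℚ * ι m + (2ℚ * ι 0 + 3ℚ)) (0<⇒≢ (0<den m 0))
      (by₃ 1ℚ (- 1ℚ) (- 1ℚ) (β-zero (suc m)) (βₒ-def m 0) (β-zero m) (eq (ι m) (β m 0) (β (suc m) 0) (βₒ m 0)))
      where
      eq : ∀ μ b b′ o → (2ℚ * μ + (2ℚ * 0ℚ + 3ℚ)) * b′ ≡ (2ℚ * μ + (2ℚ * 0ℚ + 3ℚ)) * o
        + 1ℚ * (b′ * (2ℚ * (1ℚ + μ) + 1ℚ) - 1ℚ)
        + - 1ℚ * (o * (2ℚ * μ + (2ℚ * 0ℚ + 3ℚ)) - (2ℚ * μ + 1ℚ) * b)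
        + - 1ℚ * (b * (2ℚ * μ + 1ℚ) - 1ℚ)
      eq = solve-∀ ℚ-ring

    odd→even : ∀ m n → (4ℚ * ι n + 5ℚ) * β (suc m) (suc n) ≡
      (2ℚ * ι n + 3ℚ) * βₒ m (suc n) + (2ℚ * ι n + 2ℚ) * βₒ m n
    odd→even m n = cancelˡ (D * D′) (0<⇒≢ (pos* (0<den m n) (0<den m (suc n))))
      (by₂ ((4ℚ * ν + 5ℚ) * D) (2ℚ * (4ℚ * ν + 5ℚ)) (β-sucʳ (suc m) n) (β-sucˡ m n)
        (by₃ (- ((2ℚ * ν + 3ℚ) * D)) (- ((2ℚ * ν + 3ℚ) * (2ℚ * μ + 1ℚ))) (- ((2ℚ * ν + 2ℚ) * D′))
          (βₒ-def m (suc n)) (β-sucʳ m n) (βₒ-def m n)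
          (eq μ ν (β m n) (β m (suc n)) (β (suc m) n) (β (suc m) (suc n)) (βₒ m n) (βₒ m (suc n)))))
      where
      μ ν D D′ : ℚ
      μ = ι m
      ν = ι n
      D = 2ℚ * μ + (2ℚ * ν + 3ℚ)
      D′ = 2ℚ * μ + (2ℚ * (1ℚ + ν) + 3ℚ)
      eq : ∀ μ ν b b₁ b′ b₁′ o o₁ →
        (2ℚ * μ + (2ℚ * ν + 3ℚ)) * (2ℚ * μ + (2ℚ * (1ℚ + ν) + 3ℚ)) * ((4ℚ * ν + 5ℚ) * b₁′) ≡
        (2ℚ * μ + (2ℚ * ν + 3ℚ)) * (2ℚ * μ + (2ℚ * (1ℚ + ν) + 3ℚ)) * ((2ℚ * ν + 3ℚ) * o₁ + (2ℚ * ν + 2ℚ) * o)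
        + (4ℚ * ν + 5ℚ) * (2ℚ * μ + (2ℚ * ν + 3ℚ)) * (b₁′ * (2ℚ * (1ℚ + μ) + (2ℚ * ν + 3ℚ)) - 2ℚ * (1ℚ + μ - ν) * b′)
        + 2ℚ * (4ℚ * ν + 5ℚ) * ((2ℚ * μ + (2ℚ * ν + 3ℚ)) * ((μ + 1ℚ - ν) * b′) - (μ + 1ℚ) * (2ℚ * μ + 1ℚ) * b)
        + - ((2ℚ * ν + 3ℚ) * (2ℚ * μ + (2ℚ * ν + 3ℚ))) * (o₁ * (2ℚ * μ + (2ℚ * (1ℚ + ν) + 3ℚ)) - (2ℚ * μ + 1ℚ) * b₁)
        + - ((2ℚ * ν + 3ℚ) * (2ℚ * μ + 1ℚ)) * (b₁ * (2ℚ * μ + (2ℚ * ν + 3ℚ)) - 2ℚ * (μ - ν) * b)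
        + - ((2ℚ * ν + 2ℚ) * (2ℚ * μ + (2ℚ * (1ℚ + ν) + 3ℚ))) * (o * (2ℚ * μ + (2ℚ * ν + 3ℚ)) - (2ℚ * μ + 1ℚ) * b)
      eq = solve-∀ ℚ-ring

  -- Each multiplication by y² raises the degree by 2. The last summand of `multiply-y²` involves
  -- only coefficients beyond the degree, which `m ℕ.≤ N` makes zero.
  monomial : ∀ m N y → m ℕ.≤ N → (y * y) ^ m ≡ evenSum (β m) (suc N) y
  monomial zero zero y m≤N = refl
  monomial zero (suc N) y m≤N = trans (monomial zero N y ℕ.z≤n)
    (by₁ (- ((4ℚ * ι (suc N) + 1ℚ) * Pe (suc N) y)) (β-vanishes 0 (suc N) (ℕ.s≤s ℕ.z≤n))
      (eq (evenSum (β 0) (suc N) y) (4ℚ * ι (suc N) + 1ℚ) (β 0 (suc N)) (Pe (suc N) y)))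
    where
    eq : ∀ s c b p → s ≡ s + c * b * p + - (c * p) * (b - 0ℚ)
    eq = solve-∀ ℚ-ring
  monomial (suc m) N y m<N = trans (cong (y * y *_) (monomial m N y (ℕP.<⇒≤ m<N)))
    (by₃ 1ℚ (c * Pe (suc N) y) (- (c * (y * Po N y)))
      (multiply-y² (β m) (βₒ m) (β (suc m)) (even→odd m) (odd→even₀ m) (odd→even m) N y)
      (βₒ-vanishes m N m<N) (β-vanishes m (suc N) (ℕP.<-trans m<N (ℕP.n<1+n N)))
      (eq (y * y * evenSum (β m) (suc N) y) (evenSum (β (suc m)) (suc N) y) c (βₒ m N) (Pe (suc N) y) y (β m (suc N))
        (Po N y)))
    where
    c : ℚ
    c = 2ℚ * ι N + 2ℚ
    eq : ∀ L s c o p y b q → L ≡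
      s + 1ℚ * (L - (s + c * (o * p - y * (b * q)))) + c * p * (o - 0ℚ) + - (c * (y * q)) * (b - 0ℚ)
    eq = solve-∀ ℚ-ring

  G : ℕ → ℚ → ℚ
  G N z = sum (λ m → a m * z ^ m) N

  -- By `G-expansion`, the Legendre coefficients of the Taylor polynomial `G N (y * y)`.
  τ : ℕ → ℕ → ℚ
  τ N n = sum (λ m → a m * β m n) N

  evenSum-linear : ∀ f c g N y → evenSum (λ n → f n + c * g n) N y ≡ evenSum f N y + c * evenSum g N y
  evenSum-linear f c g zero    y = eq c
    where
    eq : ∀ c → 0ℚ ≡ 0ℚ + c * 0ℚ
    eq = solve-∀ ℚ-ring
  evenSum-linear f c g (suc N) y = by₁ 1ℚ (evenSum-linear f c g N y)
      (eq (evenSum (λ n → f n + c * g n) N y) (evenSum f N y) c (evenSum g N y) (4ℚ * ι N + 1ℚ) (f N) (g N) (Pe N y))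
    where
    eq : ∀ s s₁ c s₂ k f g p → s + k * (f + c * g) * p ≡
      s₁ + k * f * p + c * (s₂ + k * g * p) + 1ℚ * (s - (s₁ + c * s₂))
    eq = solve-∀ ℚ-ring

  evenSum-zero : ∀ N y → evenSum (λ _ → 0ℚ) N y ≡ 0ℚ
  evenSum-zero zero    y = refl
  evenSum-zero (suc N) y = trans (cong (_+ (4ℚ * ι N + 1ℚ) * 0ℚ * Pe N y) (evenSum-zero N y))
    (eq (4ℚ * ι N + 1ℚ) (Pe N y))
    where
    eq : ∀ k p → 0ℚ + k * 0ℚ * p ≡ 0ℚ
    eq = solve-∀ ℚ-ring

  G-expansion : ∀ N K y → K ℕ.≤ suc N → G K (y * y) ≡ evenSum (τ K) (suc N) y
  G-expansion N zero    y K≤N = sym (evenSum-zero (suc N) y)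
  G-expansion N (suc K) y (ℕ.s≤s K≤N) = trans
    (cong₂ (λ s t → s + a K * t) (G-expansion N K y (ℕP.m≤n⇒m≤1+n K≤N)) (monomial K N y K≤N))
    (sym (evenSum-linear (τ K) (a K) (β K) (suc N) y))

  G-one : ∀ N → G N 1ℚ ≡ sum a N
  G-one N = sum-cong N (λ m → trans (cong (a m *_) (1^ m)) (ℚP.*-identityʳ (a m)))

  -- The certificate of Zeilberger's algorithm for τ, summed over m.
  τ-suc : ∀ N n → 4ℚ * (ι n + 1ℚ) * (ι n + 2ℚ) * τ N (suc n) ≡
    (4ℚ * ι n * ι n - 1ℚ) * τ N n - (8ℚ * ι n + 6ℚ) * (a N * ((ι N - ι n) * β N n))
  τ-suc zero    n = trans (ℚP.*-zeroʳ (4ℚ * (ι n + 1ℚ) * (ι n + 2ℚ)))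
    (by₁ (8ℚ * ι n + 6ℚ) (nβ₀≡0 n) (eq (ι n) (β 0 n)))
    where
    nβ₀≡0 : ∀ n → (ι 0 - ι n) * β 0 n ≡ 0ℚ
    nβ₀≡0 zero    = refl
    nβ₀≡0 (suc n) = trans (cong ((ι 0 - ι (suc n)) *_) (β-vanishes 0 (suc n) (ℕ.s≤s ℕ.z≤n))) (ℚP.*-zeroʳ (ι 0 - ι
      (suc n)))
    eq : ∀ ν b → 0ℚ ≡ (4ℚ * ν * ν - 1ℚ) * 0ℚ - (8ℚ * ν + 6ℚ) * (1ℚ * ((0ℚ - ν) * b)) + (8ℚ * ν
      + 6ℚ) * ((0ℚ - ν) * b - 0ℚ)
    eq = solve-∀ ℚ-ring
  τ-suc (suc N) n = cancelˡ (2ℚ * D) (0<⇒≢ (0<2* (0<den N n)))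
    (by₁ (2ℚ * D) (τ-suc N n)
      (by₃ (8ℚ * (ν + 1ℚ) * (ν + 2ℚ) * a N) (2ℚ * (8ℚ * ν + 6ℚ) * a (suc N)) ((8ℚ * ν + 6ℚ) * (2ℚ * μ + 1ℚ) * β N n)
        (β-sucʳ N n) (β-sucˡ N n) (a-suc N)
        (eq μ ν (τ N n) (τ N (suc n)) (a N) (a (suc N)) (β N n) (β N (suc n)) (β (suc N) n))))
    where
    μ ν D : ℚ
    μ = ι N
    ν = ι n
    D = 2ℚ * μ + (2ℚ * ν + 3ℚ)
    eq : ∀ μ ν t t₁ x x′ b b₁ b′ →
      2ℚ * (2ℚ * μ + (2ℚ * ν + 3ℚ)) * (4ℚ * (ν + 1ℚ) * (ν + 2ℚ) * (t₁ + x * b₁)) ≡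
      2ℚ * (2ℚ * μ + (2ℚ * ν + 3ℚ)) * ((4ℚ * ν * ν - 1ℚ) * (t + x * b) - (8ℚ * ν + 6ℚ) * (x′ * ((1ℚ + μ - ν) * b′)))
      + 2ℚ * (2ℚ * μ + (2ℚ * ν + 3ℚ)) * (4ℚ * (ν + 1ℚ) * (ν + 2ℚ) * t₁ -
          ((4ℚ * ν * ν - 1ℚ) * t - (8ℚ * ν + 6ℚ) * (x * ((μ - ν) * b))))
      + 8ℚ * (ν + 1ℚ) * (ν + 2ℚ) * x * (b₁ * (2ℚ * μ + (2ℚ * ν + 3ℚ)) - 2ℚ * (μ - ν) * b)
      + 2ℚ * (8ℚ * ν + 6ℚ) * x′ * ((2ℚ * μ + (2ℚ * ν + 3ℚ)) * ((μ + 1ℚ - ν) * b′) - (μ + 1ℚ) * (2ℚ * μ + 1ℚ) * b)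
      + (8ℚ * ν + 6ℚ) * (2ℚ * μ + 1ℚ) * b * ((2ℚ * μ + 2ℚ) * x′ - (2ℚ * μ - 1ℚ) * x)
    eq = solve-∀ ℚ-ring

-- Legendre coefficients of the Taylor polynomials and their limits.

module LegendreCoefficients where

  open import Data.Rational.Base using (_+_; _-_; -_; _*_; _/_; _≤_; _<_; ∣_∣; 1/_)
  open Arithmetic
  open LegendrePolynomials
  open TaylorSeries

  -- W p decreases to π/4, and V p is its inverse.
  W V : ℕ → ℚ
  W zero    = 1ℚ
  W (suc p) = (2ℚ * ι p + 2ℚ) * (2ℚ * ι p + 4ℚ) * W p ÷ ((2ℚ * ι p + 3ℚ) * (2ℚ * ι p + 3ℚ))
  V zero    = 1ℚ
  V (suc p) = (2ℚ * ι p + 3ℚ) * (2ℚ * ι p + 3ℚ) * V p ÷ ((2ℚ * ι p + 2ℚ) * (2ℚ * ι p + 4ℚ))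

  0<2ι+4 : ∀ n → 0ℚ < 2ℚ * ι n + 4ℚ
  0<2ι+4 n = 0<+ (0≤2ι n) (ℚP.positive⁻¹ 4ℚ)

  private
    0<W-num : ∀ p → 0ℚ < (2ℚ * ι p + 2ℚ) * (2ℚ * ι p + 4ℚ)
    0<W-num p = pos* (0<2ι+2 p) (0<2ι+4 p)

    0<W-den : ∀ p → 0ℚ < (2ℚ * ι p + 3ℚ) * (2ℚ * ι p + 3ℚ)
    0<W-den p = pos* (0<2ι+3 p) (0<2ι+3 p)

  W-suc : ∀ p → W (suc p) * ((2ℚ * ι p + 3ℚ) * (2ℚ * ι p + 3ℚ)) ≡ (2ℚ * ι p + 2ℚ) * (2ℚ * ι p + 4ℚ) * W p
  W-suc p = ÷-*⁺ _ (0<W-den p)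

  V-suc : ∀ p → V (suc p) * ((2ℚ * ι p + 2ℚ) * (2ℚ * ι p + 4ℚ)) ≡ (2ℚ * ι p + 3ℚ) * (2ℚ * ι p + 3ℚ) * V p
  V-suc p = ÷-*⁺ _ (0<W-num p)

  W*V : ∀ p → W p * V p ≡ 1ℚ
  W*V zero    = refl
  W*V (suc p) = cancelˡ (d * n) (0<⇒≢ (pos* (0<W-den p) (0<W-num p)))
    (by₃ (V (suc p) * n) (n * W p) (d * n) (W-suc p) (V-suc p) (W*V p)
      (eq (W p) (W (suc p)) (V p) (V (suc p)) n d))
    where
    n d : ℚ
    n = (2ℚ * ι p + 2ℚ) * (2ℚ * ι p + 4ℚ)
    d = (2ℚ * ι p + 3ℚ) * (2ℚ * ι p + 3ℚ)
    eq : ∀ u u′ v v′ n d → d * n * (u′ * v′) ≡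
      d * n * 1ℚ + v′ * n * (u′ * d - n * u) + n * u * (v′ * n - d * v) + d * n * (u * v - 1ℚ)
    eq = solve-∀ ℚ-ring

  0≤W : ∀ p → 0ℚ ≤ W p
  0≤W zero    = 0≤1
  0≤W (suc p) = 0≤÷ (nonNeg* (ℚP.<⇒≤ (0<W-num p)) (0≤W p)) (0<W-den p)

  0≤V : ∀ p → 0ℚ ≤ V p
  0≤V zero    = 0≤1
  0≤V (suc p) = 0≤÷ (nonNeg* (ℚP.<⇒≤ (0<W-den p)) (0≤V p)) (0<W-num p)

  W≤1 : ∀ p → W p ≤ 1ℚ
  W≤1 zero    = ℚP.≤-refl
  W≤1 (suc p) = ÷≤ (0<W-den p) (ℚP.≤-trans
      (*-monoˡ n (ℚP.<⇒≤ (0<W-num p)) (W≤1 p))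
      (≤-by 1ℚ 0≤1 (eq (ι p))))
    where
    n : ℚ
    n = (2ℚ * ι p + 2ℚ) * (2ℚ * ι p + 4ℚ)
    eq : ∀ π → 1ℚ * ((2ℚ * π + 3ℚ) * (2ℚ * π + 3ℚ)) ≡ (2ℚ * π + 2ℚ) * (2ℚ * π + 4ℚ) * 1ℚ + 1ℚ
    eq = solve-∀ ℚ-ring

  -- ρ p m = (1/2)ₘ / (p + 3/2)ₘ.
  ρ : ℕ → ℕ → ℚ
  ρ zero    m = 1ℚ ÷ (2ℚ * ι m + 1ℚ)
  ρ (suc p) m = (2ℚ * ι p + 3ℚ) * ρ p m ÷ (2ℚ * ι m + (2ℚ * ι p + 3ℚ))

  ρ-sucˡ : ∀ p m → ρ (suc p) m * (2ℚ * ι m + (2ℚ * ι p + 3ℚ)) ≡ (2ℚ * ι p + 3ℚ) * ρ p m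
  ρ-sucˡ p m = ÷-*⁺ _ (0<den m p)

  ρ-sucʳ : ∀ p m → (2ℚ * ι m + (2ℚ * ι p + 3ℚ)) * ρ p (suc m) ≡ (2ℚ * ι m + 1ℚ) * ρ p m
  ρ-sucʳ zero m = by₂ 1ℚ (- 1ℚ) (β-zero (suc m)) (β-zero m) (eq (ι m) (ρ 0 m) (ρ 0 (suc m)))
    where
    eq : ∀ μ r r′ → (2ℚ * μ + (2ℚ * 0ℚ + 3ℚ)) * r′ ≡ (2ℚ * μ + 1ℚ) * r
      + 1ℚ * (r′ * (2ℚ * (1ℚ + μ) + 1ℚ) - 1ℚ) + - 1ℚ * (r * (2ℚ * μ + 1ℚ) - 1ℚ)
    eq = solve-∀ ℚ-ring
  ρ-sucʳ (suc p) m = cancelˡ (2ℚ * ι m + (2ℚ * ι p + 3ℚ)) (0<⇒≢ (0<den m p))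
    (by₃ (2ℚ * ι m + (2ℚ * ι p + 3ℚ)) (2ℚ * ι p + 3ℚ) (- (2ℚ * ι m + 1ℚ)) (ρ-sucˡ p (suc m)) (ρ-sucʳ p m) (ρ-sucˡ p m)
      (eq (ι m) (ι p) (ρ p m) (ρ p (suc m)) (ρ (suc p) m) (ρ (suc p) (suc m))))
    where
    eq : ∀ μ π r r₁ r′ r₁′ → (2ℚ * μ + (2ℚ * π + 3ℚ)) * ((2ℚ * μ + (2ℚ * (1ℚ + π) + 3ℚ)) * r₁′) ≡
      (2ℚ * μ + (2ℚ * π + 3ℚ)) * ((2ℚ * μ + 1ℚ) * r′)
      + (2ℚ * μ + (2ℚ * π + 3ℚ)) * (r₁′ * (2ℚ * (1ℚ + μ) + (2ℚ * π + 3ℚ)) - (2ℚ * π + 3ℚ) * r₁)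
      + (2ℚ * π + 3ℚ) * ((2ℚ * μ + (2ℚ * π + 3ℚ)) * r₁ - (2ℚ * μ + 1ℚ) * r)
      + - (2ℚ * μ + 1ℚ) * (r′ * (2ℚ * μ + (2ℚ * π + 3ℚ)) - (2ℚ * π + 3ℚ) * r)
    eq = solve-∀ ℚ-ring

  ρ-zero : ∀ p → ρ p 0 ≡ 1ℚ
  ρ-zero zero    = refl
  ρ-zero (suc p) = cancelˡ (2ℚ * ι 0 + (2ℚ * ι p + 3ℚ)) (0<⇒≢ (0<den 0 p))
    (by₂ 1ℚ (2ℚ * ι p + 3ℚ) (ρ-sucˡ p 0) (ρ-zero p) (eq (ι p) (ρ p 0) (ρ (suc p) 0)))
    where
    eq : ∀ π r r′ → (2ℚ * 0ℚ + (2ℚ * π + 3ℚ)) * r′ ≡ (2ℚ * 0ℚ + (2ℚ * π + 3ℚ)) * 1ℚ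
      + 1ℚ * (r′ * (2ℚ * 0ℚ + (2ℚ * π + 3ℚ)) - (2ℚ * π + 3ℚ) * r) + (2ℚ * π + 3ℚ) * (r - 1ℚ)
    eq = solve-∀ ℚ-ring

  0≤ρ : ∀ p m → 0ℚ ≤ ρ p m
  0≤ρ zero    m = 0≤β m 0
  0≤ρ (suc p) m = 0≤÷ (nonNeg* (ℚP.<⇒≤ (0<2ι+3 p)) (0≤ρ p m)) (0<den m p)

  ρ-antitone : ∀ p m → ρ p (suc m) ≤ ρ p m
  ρ-antitone p m = cancel-≤ D (0<den m p) (≤-by ((2ℚ * ι p + 2ℚ) * ρ p m)
      (nonNeg* (ℚP.<⇒≤ (0<2ι+2 p)) (0≤ρ p m))
      (by₁ (- 1ℚ) (ρ-sucʳ p m) (eq (ι m) (ι p) (ρ p m) (ρ p (suc m)))))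
    where
    D : ℚ
    D = 2ℚ * ι m + (2ℚ * ι p + 3ℚ)
    eq : ∀ μ π r r₁ → (2ℚ * μ + (2ℚ * π + 3ℚ)) * r ≡ (2ℚ * μ + (2ℚ * π + 3ℚ)) * r₁ + (2ℚ * π + 2ℚ) * r
      + - 1ℚ * ((2ℚ * μ + (2ℚ * π + 3ℚ)) * r₁ - (2ℚ * μ + 1ℚ) * r)
    eq = solve-∀ ℚ-ring

  ρ-suc≤ : ∀ p m → (2ℚ * ι p + 3ℚ) * ρ p (suc m) ≤ 1ℚ
  ρ-suc≤ p zero    = ℚP.≤-reflexive (by₂ 1ℚ 1ℚ (ρ-sucʳ p 0) (ρ-zero p) (eq (ι p) (ρ p 0) (ρ p 1)))
    where
    eq : ∀ π r r₁ → (2ℚ * π + 3ℚ) * r₁ ≡ 1ℚ + 1ℚ * ((2ℚ * 0ℚ + (2ℚ * π + 3ℚ)) * r₁ - (2ℚ * 0ℚ + 1ℚ) * r) + 1ℚ * (r - 1ℚ)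
    eq = solve-∀ ℚ-ring
  ρ-suc≤ p (suc m) = ℚP.≤-trans (*-monoˡ (2ℚ * ι p + 3ℚ) (ℚP.<⇒≤ (0<2ι+3 p)) (ρ-antitone p (suc m))) (ρ-suc≤ p m)

  -- The partial sums of ₂F₁(-1/2, 1/2; p + 3/2; 1).
  U : ℕ → ℕ → ℚ
  U p N = sum (λ m → a m * ρ p m) N

  -- Gauss's contiguous relation in the lower parameter; the last summand comes from cutting the
  -- series at N. For the full series it says that W p times its value does not depend on p.
  U-suc : ∀ p N → (2ℚ * ι p + 2ℚ) * (2ℚ * ι p + 4ℚ) * U (suc p) N ≡
    (2ℚ * ι p + 3ℚ) * (2ℚ * ι p + 3ℚ) * U p N + 2ℚ * (2ℚ * ι p + 3ℚ) * (ι N * (a N * ρ p N))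
  U-suc p zero = eq (ι p) (ρ p 0)
    where
    eq : ∀ π r → (2ℚ * π + 2ℚ) * (2ℚ * π + 4ℚ) * 0ℚ ≡
      (2ℚ * π + 3ℚ) * (2ℚ * π + 3ℚ) * 0ℚ + 2ℚ * (2ℚ * π + 3ℚ) * (0ℚ * (1ℚ * r))
    eq = solve-∀ ℚ-ring
  U-suc p (suc N) = cancelˡ (2ℚ * ι N + (2ℚ * ι p + 3ℚ)) (0<⇒≢ (0<den N p))
    (by₁ (2ℚ * ι N + (2ℚ * ι p + 3ℚ)) (U-suc p N)
      (by₃ ((2ℚ * ι p + 2ℚ) * (2ℚ * ι p + 4ℚ) * a N) (- (2ℚ * (2ℚ * ι p + 3ℚ) * (ι N
        + 1ℚ) * a (suc N))) (- ((2ℚ * ι p + 3ℚ) * (2ℚ * ι N + 1ℚ) * ρ p N))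
        (ρ-sucˡ p N) (ρ-sucʳ p N) (a-suc N)
        (eq (ι N) (ι p) (U p N) (U (suc p) N) (a N) (a (suc N)) (ρ p N) (ρ p (suc N)) (ρ (suc p) N))))
    where
    eq : ∀ μ π u u′ x x₁ r r₁ r′ →
      (2ℚ * μ + (2ℚ * π + 3ℚ)) * ((2ℚ * π + 2ℚ) * (2ℚ * π + 4ℚ) * (u′ + x * r′)) ≡
      (2ℚ * μ + (2ℚ * π + 3ℚ)) * ((2ℚ * π + 3ℚ) * (2ℚ * π + 3ℚ) * (u + x * r) + 2ℚ * (2ℚ * π + 3ℚ) * ((1ℚ
        + μ) * (x₁ * r₁)))
      + (2ℚ * μ + (2ℚ * π + 3ℚ)) * ((2ℚ * π + 2ℚ) * (2ℚ * π + 4ℚ) * u′ -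
          ((2ℚ * π + 3ℚ) * (2ℚ * π + 3ℚ) * u + 2ℚ * (2ℚ * π + 3ℚ) * (μ * (x * r))))
      + (2ℚ * π + 2ℚ) * (2ℚ * π + 4ℚ) * x * (r′ * (2ℚ * μ + (2ℚ * π + 3ℚ)) - (2ℚ * π + 3ℚ) * r)
      + - (2ℚ * (2ℚ * π + 3ℚ) * (μ + 1ℚ) * x₁) * ((2ℚ * μ + (2ℚ * π + 3ℚ)) * r₁ - (2ℚ * μ + 1ℚ) * r)
      + - ((2ℚ * π + 3ℚ) * (2ℚ * μ + 1ℚ) * r) * ((2ℚ * μ + 2ℚ) * x₁ - (2ℚ * μ - 1ℚ) * x)
    eq = solve-∀ ℚ-ring

  aρ≤0 : ∀ p m → a (suc m) * ρ p (suc m) ≤ 0ℚ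
  aρ≤0 p m = subst (_≤ 0ℚ) (ℚP.*-comm (ρ p (suc m)) (a (suc m))) (neg* (0≤ρ p (suc m)) (a-suc≤0 m))

  U≤1 : ∀ p N → U p (suc N) ≤ 1ℚ
  U≤1 p zero    = ℚP.≤-reflexive (trans (eq (ρ p 0)) (ρ-zero p))
    where
    eq : ∀ r → 0ℚ + 1ℚ * r ≡ r
    eq = solve-∀ ℚ-ring
  U≤1 p (suc N) = subst (U p (suc (suc N)) ≤_) (ℚP.+-identityʳ 1ℚ) (ℚP.+-mono-≤ (U≤1 p N) (aρ≤0 p N))

  private
    U≥-sum-a : ∀ p N → (2ℚ * ι p + 3ℚ) * (1ℚ - U p (suc N)) ≤ 1ℚ - sum a (suc N)
    U≥-sum-a p zero = ℚP.≤-reflexive (by₁ (- (2ℚ * ι p + 3ℚ)) (ρ-zero p) (eq (ι p) (ρ p 0)))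
      where
      eq : ∀ π r → (2ℚ * π + 3ℚ) * (1ℚ - (0ℚ + 1ℚ * r)) ≡ 1ℚ - (0ℚ + 1ℚ) + - (2ℚ * π + 3ℚ) * (r - 1ℚ)
      eq = solve-∀ ℚ-ring
    U≥-sum-a p (suc N) = ≤-by
      ((1ℚ - sum a (suc N) - c * (1ℚ - U p (suc N))) + (- a (suc N)) * (1ℚ - c * ρ p (suc N)))
      (0≤+ (≤⇒0≤- (U≥-sum-a p N)) (nonNeg* (ℚP.neg-antimono-≤ (a-suc≤0 N)) (≤⇒0≤- (ρ-suc≤ p N))))
      (eq c (sum a (suc N)) (U p (suc N)) (a (suc N)) (ρ p (suc N)))
      where
      c : ℚ
      c = 2ℚ * ι p + 3ℚ
      eq : ∀ c s u x r → 1ℚ - (s + x) ≡ c * (1ℚ - (u + x * r)) + (1ℚ - s - c * (1ℚ - u) + (- x) * (1ℚ - c * r))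
      eq = solve-∀ ℚ-ring

  -- From the second term on, ρ p m ≤ 1/(2p + 3), and there the |a m| add up to at most 1. With
  -- `U≤1`, U p tends to 1 uniformly in N.
  U≥ : ∀ p N → 2ℚ * ι p + 2ℚ ≤ (2ℚ * ι p + 3ℚ) * U p (suc N)
  U≥ p N = ≤-by (1ℚ - sum a (suc N) - (2ℚ * ι p + 3ℚ) * (1ℚ - U p (suc N)) + w N)
    (0≤+ (≤⇒0≤- (U≥-sum-a p N)) (0≤w N))
    (by₁ 1ℚ (sum-a N) (eq (ι p) (sum a (suc N)) (U p (suc N)) (w N)))
    where
    eq : ∀ π s u v → (2ℚ * π + 3ℚ) * u ≡ 2ℚ * π + 2ℚ + (1ℚ - s - (2ℚ * π + 3ℚ) * (1ℚ - u) + v) + 1ℚ * (s - v)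
    eq = solve-∀ ℚ-ring

  -- The last summand of `U-suc` has the sign of `a (suc N)`, hence is at most 0.
  WU-antitone : ∀ p N → W p * U p (suc N) ≤ U 0 (suc N)
  WU-antitone zero    N = ℚP.≤-reflexive (ℚP.*-identityˡ (U 0 (suc N)))
  WU-antitone (suc p) N = ℚP.≤-trans (cancel-≤ (c * c) (0<W-den p)
      (≤-by (W p * (2ℚ * c) * (ι (suc N) * (- v))) (nonNeg* (nonNeg* (0≤W p) (nonNeg* (0≤/ 2 0) (ℚP.<⇒≤ (0<2ι+3 p))))
          (nonNeg* (0≤ι (suc N)) (ℚP.neg-antimono-≤ (aρ≤0 p N))))
        (by₂ (- U (suc p) (suc N)) (- W p) (W-suc p) (U-suc p (suc N))
          (eq (W p) (W (suc p)) (U p (suc N)) (U (suc p) (suc N)) c ((2ℚ * ι p + 2ℚ) * (2ℚ * ι p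
            + 4ℚ)) (ι (suc N)) v))))
      (WU-antitone p N)
    where
    c v : ℚ
    c = 2ℚ * ι p + 3ℚ
    v = a (suc N) * ρ p (suc N)
    eq : ∀ w w′ u u′ c n N v → c * c * (w * u) ≡ c * c * (w′ * u′) + w * (2ℚ * c) * (N * (- v))
      + - u′ * (w′ * (c * c) - n * w) + - w * (n * u′ - (c * c * u + 2ℚ * c * (N * v)))
    eq = solve-∀ ℚ-ring

  -- The added term is negative and outweighs the tail of the series.
  corrected : ℕ → ℕ → ℚ
  corrected p N = U p N + 2ℚ * (ι N * (a N * ρ p N))

  -- The correction reverses the direction of `WU-antitone`. As `corrected` is at most 1, the value
  -- at p = 0 is bounded from above by W p (`corrected≤W`), while `WU-antitone` bounds it from
  -- below.
  W-corrected-monotone : ∀ p N → corrected 0 (suc N) ≤ W p * corrected p (suc N)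
  W-corrected-monotone zero    N = ℚP.≤-reflexive (sym (ℚP.*-identityˡ (corrected 0 (suc N))))
  W-corrected-monotone (suc p) N = ℚP.≤-trans (W-corrected-monotone p N)
    (cancel-≤ (D * (c * c)) (pos* (0<den (suc N) p) (0<W-den p))
      (≤-by (W p * (2ℚ * (ι (suc N) * (- (x * r)))) * (c * (2ℚ * π + 2ℚ) * (2ℚ * ι N + 1ℚ)))
        (nonNeg* (nonNeg* (0≤W p) (0≤2* (nonNeg* (0≤ι (suc N)) (ℚP.neg-antimono-≤ (aρ≤0 p N)))))
          (nonNeg* (nonNeg* (ℚP.<⇒≤ (0<2ι+3 p)) (ℚP.<⇒≤ (0<2ι+2 p))) (ℚP.<⇒≤ (0<2ι+1 N))))
        (by₃ (D * corrected (suc p) (suc N)) (D * W p) (W p * ((2ℚ * π + 2ℚ) * (2ℚ * π + 4ℚ)) * 2ℚ * (ι (suc N) * x))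
          (W-suc p) (U-suc p (suc N)) (ρ-sucˡ p (suc N))
          (eq (W p) (W (suc p)) (U p (suc N)) (U (suc p) (suc N)) π (ι N) x r (ρ (suc p) (suc N))))))
    where
    π c x r D : ℚ
    π = ι p
    c = 2ℚ * π + 3ℚ
    x = a (suc N)
    r = ρ p (suc N)
    D = 2ℚ * ι (suc N) + c
    eq : ∀ w w′ u u′ π n x r r′ →
      (2ℚ * (1ℚ + n) + (2ℚ * π + 3ℚ)) * ((2ℚ * π + 3ℚ) * (2ℚ * π + 3ℚ)) * (w′ * (u′ + 2ℚ * ((1ℚ + n) * (x * r′)))) ≡
      (2ℚ * (1ℚ + n) + (2ℚ * π + 3ℚ)) * ((2ℚ * π + 3ℚ) * (2ℚ * π + 3ℚ)) * (w * (u + 2ℚ * ((1ℚ + n) * (x * r))))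
      + w * (2ℚ * ((1ℚ + n) * (- (x * r)))) * ((2ℚ * π + 3ℚ) * (2ℚ * π + 2ℚ) * (2ℚ * n + 1ℚ))
      + (2ℚ * (1ℚ + n) + (2ℚ * π + 3ℚ)) * (u′ + 2ℚ * ((1ℚ + n) * (x * r′))) * (w′ * ((2ℚ * π + 3ℚ) * (2ℚ * π
        + 3ℚ)) - (2ℚ * π + 2ℚ) * (2ℚ * π + 4ℚ) * w)
      + (2ℚ * (1ℚ + n) + (2ℚ * π + 3ℚ)) * w * ((2ℚ * π + 2ℚ) * (2ℚ * π + 4ℚ) * u′ - ((2ℚ * π + 3ℚ) * (2ℚ * π
        + 3ℚ) * u + 2ℚ * (2ℚ * π + 3ℚ) * ((1ℚ + n) * (x * r))))
      + w * ((2ℚ * π + 2ℚ) * (2ℚ * π + 4ℚ)) * 2ℚ * ((1ℚ + n) * x) * (r′ * (2ℚ * (1ℚ + n) + (2ℚ * π + 3ℚ)) - (2ℚ * π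
        + 3ℚ) * r)
    eq = solve-∀ ℚ-ring

  corrected≤W : ∀ p N → corrected 0 (suc N) ≤ W p
  corrected≤W p N = ℚP.≤-trans (W-corrected-monotone p N)
    (subst (W p * corrected p (suc N) ≤_) (ℚP.*-identityʳ (W p)) (*-monoˡ (W p) (0≤W p)
      (subst (corrected p (suc N) ≤_) (ℚP.+-identityʳ 1ℚ)
        (ℚP.+-mono-≤ (U≤1 p N) (neg* {2ℚ} (0≤/ 2 0) (neg* (0≤ι (suc N)) (aρ≤0 p N)))))))

  -- w n ² / ((n + 1) (1/2 - n)).
  g : ℕ → ℚ
  g zero    = 2ℚ
  g (suc n) = (4ℚ * ι n * ι n - 1ℚ) * g n ÷ (4ℚ * (ι n + 1ℚ) * (ι n + 2ℚ))

  private
    0<g-den : ∀ n → 0ℚ < 4ℚ * (ι n + 1ℚ) * (ι n + 2ℚ)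
    0<g-den n = pos* {4ℚ * (ι n + 1ℚ)} (pos* {4ℚ} (ℚP.positive⁻¹ 4ℚ) (0<1ℚ+ι n)) (0<+ (0≤ι n) (ℚP.positive⁻¹ 2ℚ))

  g-suc : ∀ n → 4ℚ * (ι n + 1ℚ) * (ι n + 2ℚ) * g (suc n) ≡ (4ℚ * ι n * ι n - 1ℚ) * g n
  g-suc n = trans (ℚP.*-comm _ (g (suc n))) (÷-*⁺ _ (0<g-den n))

  -- By the closed form of `g` the right side is (4N + 2) (w N)² / (N + 1), which explains the sign
  -- in `g-sum≥0`.
  g-sum : ∀ N → sum (λ n → (4ℚ * ι n + 1ℚ) * g n) (suc N) ≡ (1ℚ - 4ℚ * ι N * ι N) * g N
  g-sum zero    = refl
  g-sum (suc N) = by₂ 1ℚ 1ℚ (g-sum N) (g-suc N) (eq (ι N) (sum (λ n → (4ℚ * ι n + 1ℚ) * g n) (suc N)) (g N) (g (suc N)))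
    where
    eq : ∀ ν s g g′ → s + (4ℚ * (1ℚ + ν) + 1ℚ) * g′ ≡ (1ℚ - 4ℚ * (1ℚ + ν) * (1ℚ + ν)) * g′
      + 1ℚ * (s - (1ℚ - 4ℚ * ν * ν) * g) + 1ℚ * (4ℚ * (ν + 1ℚ) * (ν + 2ℚ) * g′ - (4ℚ * ν * ν - 1ℚ) * g)
    eq = solve-∀ ℚ-ring

  0≤4ι²-1 : ∀ n → 0ℚ ≤ 4ℚ * ι (suc n) * ι (suc n) - 1ℚ
  0≤4ι²-1 n = subst (0ℚ ≤_) (eq (ι n)) (0≤+ (nonNeg* {4ℚ} (0≤/ 4 0) (0≤+ (nonNeg* (0≤ι n) (0≤ι n)) (0≤2ι n))) (0≤/ 3 0))
    where
    eq : ∀ ν → 4ℚ * (ν * ν + 2ℚ * ν) + 3ℚ ≡ 4ℚ * (1ℚ + ν) * (1ℚ + ν) - 1ℚ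
    eq = solve-∀ ℚ-ring

  g-sum≥0 : ∀ N → 0ℚ ≤ sum (λ n → (4ℚ * ι n + 1ℚ) * g n) (suc N)
  g-sum≥0 N = subst (0ℚ ≤_) (sym (g-sum N)) (nonneg N)
    where
    eq : ∀ x g → x * - g ≡ (- x) * g
    eq = solve-∀ ℚ-ring
    eq′ : ∀ y g → (y - 1ℚ) * - g ≡ (1ℚ - y) * g
    eq′ = solve-∀ ℚ-ring
    nonneg : ∀ N → 0ℚ ≤ (1ℚ - 4ℚ * ι N * ι N) * g N
    nonneg zero    = 0≤/ 2 0
    nonneg (suc N) = subst (0ℚ ≤_) (eq′ (4ℚ * ι (suc N) * ι (suc N)) (g (suc N))) (nonNeg* (0≤4ι²-1 N)
      (cancel-≤ (4ℚ * (ι N + 1ℚ) * (ι N + 2ℚ)) (0<g-den N)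
        (≤-by ((1ℚ - 4ℚ * ι N * ι N) * g N) (nonneg N)
          (by₁ (- 1ℚ) (g-suc N) (eq″ (ι N) (g N) (g (suc N)))))))
      where
      eq″ : ∀ ν g g′ → 4ℚ * (ν + 1ℚ) * (ν + 2ℚ) * - g′ ≡ 4ℚ * (ν + 1ℚ) * (ν + 2ℚ) * 0ℚ + (1ℚ - 4ℚ * ν * ν) * g
        + - 1ℚ * (4ℚ * (ν + 1ℚ) * (ν + 2ℚ) * g′ - (4ℚ * ν * ν - 1ℚ) * g)
      eq″ = solve-∀ ℚ-ring

  -- `τ (suc N) 0` is `U 0 (suc N)` by definition, since `β m 0` and `ρ 0 m` are the same quotient.
  -- At this index the error may be negative, but the shortfall below W p is at most W p / (2p + 3).
  τ-zero≥ : ∀ p N → W p * (2ℚ * ι p + 2ℚ) ≤ (2ℚ * ι p + 3ℚ) * τ (suc N) 0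
  τ-zero≥ p N = ℚP.≤-trans (*-monoˡ (W p) (0≤W p) (U≥ p N))
    (subst (_≤ c * U 0 (suc N)) (eq c (W p) (U p (suc N))) (*-monoˡ c (ℚP.<⇒≤ (0<2ι+3 p)) (WU-antitone p N)))
    where
    c : ℚ
    c = 2ℚ * ι p + 3ℚ
    eq : ∀ c w u → c * (w * u) ≡ w * (c * u)
    eq = solve-∀ ℚ-ring

  -- For n ≥ 1 the factor 4n² - 1 in both recurrences is positive and the bound propagates. At n = 0
  -- it is -1, so the step to index 1 needs an upper bound on τ at 0; `corrected≤W` provides it
  -- together with part of the error term.
  τ-suc≥ : ∀ p N n → W p * g (suc n) ≤ 2ℚ * τ (suc N) (suc n)
  τ-suc≥ p N zero = cancel-≤ 8ℚ (ℚP.positive⁻¹ 8ℚ)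
    (≤-by (2ℚ * (W p - corrected 0 (suc N)) + 8ℚ * (ι (suc N) * (- v)))
      (0≤+ (0≤2* (≤⇒0≤- (corrected≤W p N)))
           (nonNeg* {8ℚ} (0≤/ 8 0) (nonNeg* (0≤ι (suc N)) (ℚP.neg-antimono-≤ (aρ≤0 0 N)))))
      (by₂ 2ℚ (- W p) (τ-suc (suc N) 0) (g-suc 0) (eq (W p) (g 1) (τ (suc N) 0) (τ (suc N) 1) (ι (suc N)) (a (suc N))
        (β (suc N) 0))))
    where
    v : ℚ
    v = a (suc N) * ρ 0 (suc N)
    eq : ∀ w g t t₁ n x b → 8ℚ * (2ℚ * t₁) ≡
      8ℚ * (w * g) + (2ℚ * (w - (t + 2ℚ * (n * (x * b)))) + 8ℚ * (n * (- (x * b))))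
      + 2ℚ * (4ℚ * (0ℚ + 1ℚ) * (0ℚ + 2ℚ) * t₁ - ((4ℚ * 0ℚ * 0ℚ - 1ℚ) * t - (8ℚ * 0ℚ + 6ℚ) * (x * ((n - 0ℚ) * b))))
      + - w * (4ℚ * (0ℚ + 1ℚ) * (0ℚ + 2ℚ) * g - (4ℚ * 0ℚ * 0ℚ - 1ℚ) * 2ℚ)
    eq = solve-∀ ℚ-ring
  τ-suc≥ p N (suc n) = cancel-≤ (4ℚ * (ν + 1ℚ) * (ν + 2ℚ)) (0<g-den (suc n))
    (≤-by ((4ℚ * ν * ν - 1ℚ) * (2ℚ * t - W p * g (suc n)) + 2ℚ * (8ℚ * ν + 6ℚ) * ((- a (suc N)) * s))
      (0≤+ (nonNeg* (0≤4ι²-1 n) (≤⇒0≤- (τ-suc≥ p N n)))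
        (nonNeg* {2ℚ * (8ℚ * ν + 6ℚ)} (0≤2* (0≤+ (nonNeg* {8ℚ} (0≤/ 8 0) (0≤ι (suc n))) (0≤/ 6 0)))
          (nonNeg* (ℚP.neg-antimono-≤ (a-suc≤0 N)) (0≤[m-n]β (suc N) (suc n)))))
      (by₂ 2ℚ (- W p) (τ-suc (suc N) (suc n)) (g-suc (suc n))
        (eq (W p) (g (suc n)) (g (suc (suc n))) t (τ (suc N) (suc (suc n))) ν (a (suc N)) s)))
    where
    ν t s : ℚ
    ν = ι (suc n)
    t = τ (suc N) (suc n)
    s = (ι (suc N) - ν) * β (suc N) (suc n)
    eq : ∀ w g g′ t t₁ ν x s → 4ℚ * (ν + 1ℚ) * (ν + 2ℚ) * (2ℚ * t₁) ≡ 4ℚ * (ν + 1ℚ) * (ν + 2ℚ) * (w * g′)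
      + ((4ℚ * ν * ν - 1ℚ) * (2ℚ * t - w * g) + 2ℚ * (8ℚ * ν + 6ℚ) * ((- x) * s))
      + 2ℚ * (4ℚ * (ν + 1ℚ) * (ν + 2ℚ) * t₁ - ((4ℚ * ν * ν - 1ℚ) * t - (8ℚ * ν + 6ℚ) * (x * s)))
      + - w * (4ℚ * (ν + 1ℚ) * (ν + 2ℚ) * g′ - (4ℚ * ν * ν - 1ℚ) * g)
    eq = solve-∀ ℚ-ring

  0<4ι+1 : ∀ n → 0ℚ < 4ℚ * ι n + 1ℚ
  0<4ι+1 n = 0<+ (nonNeg* {4ℚ} (0≤/ 4 0) (0≤ι n)) 0<1

  evenSum-one : ∀ b N → evenSum b N 1ℚ ≡ sum (λ n → (4ℚ * ι n + 1ℚ) * b n) N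
  evenSum-one b N = sum-cong N (λ n → trans (cong ((4ℚ * ι n + 1ℚ) * b n *_) (P-one (double n)))
    (ℚP.*-identityʳ ((4ℚ * ι n + 1ℚ) * b n)))

  -- As |P₂ₙ| ≤ 1, the sum of the weighted absolute values is a bound for every y. Only the first of
  -- them can differ from its signed value, by at most 2η.
  evenSum-bound : ∀ {δ η} → 0ℚ ≤ η → - η ≤ δ 0 → (∀ n → 0ℚ ≤ δ (suc n)) → ∀ N y → y * y ≤ 1ℚ →
    ∣ evenSum δ (suc N) y ∣ ≤ sum (λ n → (4ℚ * ι n + 1ℚ) * δ n) (suc N) + 2ℚ * η
  evenSum-bound {δ} {η} 0≤η h₀ h zero y yy≤1 = ∣∣≤-intro
    (≤-by (2ℚ * η) (0≤2* 0≤η) (eq (δ 0) η))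
    (≤-by (2ℚ * (δ 0 - - η)) (0≤2* (≤⇒0≤- h₀)) (eq′ (δ 0) η))
    where
    eq : ∀ d η → 0ℚ + (4ℚ * 0ℚ + 1ℚ) * d + 2ℚ * η ≡ 0ℚ + (4ℚ * 0ℚ + 1ℚ) * d * 1ℚ + 2ℚ * η
    eq = solve-∀ ℚ-ring
    eq′ : ∀ d η → 0ℚ + (4ℚ * 0ℚ + 1ℚ) * d + 2ℚ * η ≡ - (0ℚ + (4ℚ * 0ℚ + 1ℚ) * d * 1ℚ) + 2ℚ * (d - - η)
    eq′ = solve-∀ ℚ-ring
  evenSum-bound {δ} {η} 0≤η h₀ h (suc N) y yy≤1 = subst (∣ evenSum δ (suc (suc N)) y ∣ ≤_)
    (eq (sum (λ n → (4ℚ * ι n + 1ℚ) * δ n) (suc N)) (2ℚ * η) d)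
    (∣+∣≤ (evenSum-bound 0≤η h₀ h N y yy≤1) (∣*∣≤ {d} {Pe (suc N) y} {d} {1ℚ}
      (ℚP.≤-reflexive (ℚP.0≤p⇒∣p∣≡p (nonNeg* (ℚP.<⇒≤ (0<4ι+1 (suc N))) (h N)))) (∣P∣≤1 (double (suc N)) y yy≤1)))
    where
    d : ℚ
    d = (4ℚ * ι (suc N) + 1ℚ) * δ (suc N)
    eq : ∀ s e d → s + e + d * 1ℚ ≡ s + d + e
    eq = solve-∀ ℚ-ring

  -- All the errors τ - W g / 2 but the first are nonnegative, so their absolute
  -- sum is controlled by the value w N at y = 1.
  G-close : ∀ p N y → y * y ≤ 1ℚ →
    ∣ 2ℚ * G (suc N) (y * y) - W p * evenSum g (suc N) y ∣ ≤ 2ℚ * w N + 2ℚ * (2ℚ ÷ (2ℚ * ι p + 3ℚ))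
  G-close p N y yy≤1 = subst (λ z → ∣ z ∣ ≤ 2ℚ * w N + 2ℚ * η) (δ-sum y)
    (ℚP.≤-trans (evenSum-bound {δ} {η} 0≤η δ₀ (λ n → ≤⇒0≤- (τ-suc≥ p N n)) N y yy≤1)
      (ℚP.+-monoˡ-≤ (2ℚ * η) sum≤))
    where
    η : ℚ
    η = 2ℚ ÷ (2ℚ * ι p + 3ℚ)
    0≤η : 0ℚ ≤ η
    0≤η = 0≤÷ {2ℚ} (0≤/ 2 0) (0<2ι+3 p)
    δ : ℕ → ℚ
    δ n = 2ℚ * τ (suc N) n - W p * g n
    δ-sum : ∀ y → evenSum δ (suc N) y ≡ 2ℚ * G (suc N) (y * y) - W p * evenSum g (suc N) y
    δ-sum y = trans (sum-cong (suc N) (λ n → cong (λ z → (4ℚ * ι n + 1ℚ) * z * Pe n y) (eq (τ (suc N) n) (W p) (g n))))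
      (trans (evenSum-linear (λ n → 2ℚ * τ (suc N) n) (- W p) g (suc N) y)
        (trans (cong (_+ (- W p) * evenSum g (suc N) y)
            (trans (sum-cong (suc N) (λ n → eq₂ (4ℚ * ι n + 1ℚ) (τ (suc N) n) (Pe n y)))
              (trans (sum-* 2ℚ (λ n → (4ℚ * ι n + 1ℚ) * τ (suc N) n * Pe n y) (suc N))
                (cong (2ℚ *_) (sym (G-expansion N (suc N) y ℕP.≤-refl))))))
          (eq₃ (2ℚ * G (suc N) (y * y)) (W p) (evenSum g (suc N) y))))
      where
      eq : ∀ t w g → 2ℚ * t - w * g ≡ 2ℚ * t + (- w) * g
      eq = solve-∀ ℚ-ring
      eq₂ : ∀ k t p → k * (2ℚ * t) * p ≡ 2ℚ * (k * t * p)
      eq₂ = solve-∀ ℚ-ring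
      eq₃ : ∀ s w e → s + (- w) * e ≡ s - w * e
      eq₃ = solve-∀ ℚ-ring
    δ₀ : - η ≤ δ 0
    δ₀ = cancel-≤ c (0<2ι+3 p) (≤-by (2ℚ * (c * τ (suc N) 0 - W p * (2ℚ * ι p + 2ℚ)) + 2ℚ * (1ℚ - W p))
        (0≤+ (0≤2* (≤⇒0≤- (τ-zero≥ p N))) (0≤2* (≤⇒0≤- (W≤1 p))))
        (by₁ 1ℚ (÷-*⁺ 2ℚ (0<2ι+3 p)) (eq (ι p) (τ (suc N) 0) (W p) η)))
      where
      c : ℚ
      c = 2ℚ * ι p + 3ℚ
      eq : ∀ π t w η → (2ℚ * π + 3ℚ) * (2ℚ * t - w * 2ℚ) ≡ (2ℚ * π + 3ℚ) * - η
        + (2ℚ * ((2ℚ * π + 3ℚ) * t - w * (2ℚ * π + 2ℚ)) + 2ℚ * (1ℚ - w)) + 1ℚ * (η * (2ℚ * π + 3ℚ) - 2ℚ)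
      eq = solve-∀ ℚ-ring
    sum≤ : sum (λ n → (4ℚ * ι n + 1ℚ) * δ n) (suc N) ≤ 2ℚ * w N
    sum≤ = ≤-by (W p * sum (λ n → (4ℚ * ι n + 1ℚ) * g n) (suc N)) (nonNeg* (0≤W p) (g-sum≥0 N))
      (by₁ (- 1ℚ) (trans (sym (evenSum-one δ (suc N))) (trans (δ-sum 1ℚ)
          (cong₂ (λ u v → 2ℚ * u - W p * v) (trans (G-one (suc N)) (sum-a N)) (evenSum-one g (suc N)))))
        (eq (sum (λ n → (4ℚ * ι n + 1ℚ) * δ n) (suc N)) (W p * sum (λ n → (4ℚ * ι n + 1ℚ) * g n) (suc N)) (w N)))
      where
      eq : ∀ s q v → 2ℚ * v ≡ s + q + - 1ℚ * (s - (2ℚ * v - q))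
      eq = solve-∀ ℚ-ring

-- Cauchy products and the squares of the Taylor polynomials.

module SquareRoot where

  open import Data.Rational.Base using (_+_; _-_; -_; _*_; _/_; _≤_; _<_; ∣_∣; 1/_)
  open Arithmetic
  open TaylorSeries

  antidiagonal : (ℕ → ℕ → ℚ) → ℕ → ℚ
  antidiagonal t zero    = t 0 0
  antidiagonal t (suc j) = t 0 (suc j) + antidiagonal (λ i l → t (suc i) l) j

  antidiagonal-cong : ∀ {t s} j → (∀ i l → t i l ≡ s i l) → antidiagonal t j ≡ antidiagonal s j
  antidiagonal-cong zero    h = h 0 0
  antidiagonal-cong (suc j) h = cong₂ _+_ (h 0 (suc j)) (antidiagonal-cong j (λ i l → h (suc i) l))

  antidiagonal-scale : ∀ c t j → antidiagonal (λ i l → c (i ℕ.+ l) * t i l) j ≡ c j * antidiagonal t j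
  antidiagonal-scale c t zero    = refl
  antidiagonal-scale c t (suc j) = trans
    (cong (λ z → c (suc j) * t 0 (suc j) + z) (antidiagonal-scale (λ i → c (suc i)) (λ i l → t (suc i) l) j))
    (sym (ℚP.*-distribˡ-+ (c (suc j)) (t 0 (suc j)) (antidiagonal (λ i l → t (suc i) l) j)))

  antidiagonal-last : ∀ t j → antidiagonal t (suc j) ≡ antidiagonal (λ i l → t i (suc l)) j + t (suc j) 0
  antidiagonal-last t zero    = refl
  antidiagonal-last t (suc j) = trans (cong (λ z → t 0 (suc (suc j)) + z) (antidiagonal-last (λ i l → t (suc i) l) j))
    (sym (ℚP.+-assoc (t 0 (suc (suc j))) (antidiagonal (λ i l → t (suc i) (suc l)) j) (t (suc (suc j)) 0)))

  antidiagonal-telescope : ∀ t (σ : ℕ → ℕ → ℚ) j → (∀ i l → t i l ≡ σ (suc i) l - σ i (suc l)) →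
                   antidiagonal t j ≡ σ (suc j) 0 - σ 0 (suc j)
  antidiagonal-telescope t σ zero    h = h 0 0
  antidiagonal-telescope t σ (suc j) h = trans
    (cong₂ _+_ (h 0 (suc j)) (antidiagonal-telescope (λ i l → t (suc i) l) (λ i l → σ (suc i) l) j (λ i l →
      h (suc i) l)))
    (eq (σ 1 (suc j)) (σ 0 (suc (suc j))) (σ (suc (suc j)) 0))
    where
    eq : ∀ p q r → p - q + (r - p) ≡ r - q
    eq = solve-∀ ℚ-ring

  0≤antidiagonal : ∀ {t} j → (∀ i l → 0ℚ ≤ t i l) → 0ℚ ≤ antidiagonal t j
  0≤antidiagonal zero    h = h 0 0
  0≤antidiagonal (suc j) h = 0≤+ (h 0 (suc j)) (0≤antidiagonal j (λ i l → h (suc i) l))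

  -- The antidiagonal sums of a i * a l vanish from the second on, since
  -- (i + l) (i + l - 1) a i a l is the difference of an antisymmetric σ.
  a-convolution : ∀ j → antidiagonal (λ i l → a i * a l) (suc (suc j)) ≡ 0ℚ
  a-convolution j = cancelˡ (c (suc (suc j))) (0<⇒≢ 0<c) (trans (sym (antidiagonal-scale c (λ i l →
    a i * a l) (suc (suc j))))
      (trans (antidiagonal-telescope (λ i l → c (i ℕ.+ l) * (a i * a l)) σ (suc (suc j)) step)
        (eq₀ (ι (suc (suc (suc j)))) (a (suc (suc (suc j)))) (c (suc (suc j))))))
    where
    c : ℕ → ℚ
    c n = 4ℚ * (ι n * (ι n - 1ℚ))
    σ : ℕ → ℕ → ℚ
    σ i l = 8ℚ * ((ι i - ι l) * (ι i * a i) * (ι l * a l))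
    eq₀ : ∀ n x c → 8ℚ * ((n - 0ℚ) * (n * x) * (0ℚ * 1ℚ)) - 8ℚ * ((0ℚ - n) * (0ℚ * 1ℚ) * (n * x)) ≡ c * 0ℚ
    eq₀ = solve-∀ ℚ-ring
    eq₁ : ∀ j → (1ℚ + (1ℚ + j)) * (1ℚ + (1ℚ + j) - 1ℚ) ≡ (1ℚ + j) * (1ℚ + (1ℚ + j))
    eq₁ = solve-∀ ℚ-ring
    0<c : 0ℚ < c (suc (suc j))
    0<c = pos* {4ℚ} (ℚP.positive⁻¹ 4ℚ) (subst (0ℚ <_) (sym (eq₁ (ι j))) (pos* (0<ι j) (0<ι (suc j))))
    step : ∀ i l → c (i ℕ.+ l) * (a i * a l) ≡ σ (suc i) l - σ i (suc l)
    step i l = by₃ (4ℚ * (ι i + ι l + ι (i ℕ.+ l) - 1ℚ) * (a i * a l))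
        (- (4ℚ * (ι i + 1ℚ - ι l) * (ι l * a l))) (4ℚ * (ι i - 1ℚ - ι l) * (ι i * a i))
        (ι-+ i l) (a-suc i) (a-suc l) (eq (ι i) (ι l) (ι (i ℕ.+ l)) (a i) (a l) (a (suc i)) (a (suc l)))
      where
      eq : ∀ i l s x y x′ y′ → 4ℚ * (s * (s - 1ℚ)) * (x * y) ≡
        8ℚ * ((1ℚ + i - l) * ((1ℚ + i) * x′) * (l * y)) - 8ℚ * ((i - (1ℚ + l)) * (i * x) * ((1ℚ + l) * y′))
        + 4ℚ * (i + l + s - 1ℚ) * (x * y) * (s - (i + l))
        + - (4ℚ * (i + 1ℚ - l) * (l * y)) * ((2ℚ * i + 2ℚ) * x′ - (2ℚ * i - 1ℚ) * x)
        + 4ℚ * (i - 1ℚ - l) * (i * x) * ((2ℚ * l + 2ℚ) * y′ - (2ℚ * l - 1ℚ) * y)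
      eq = solve-∀ ℚ-ring

  -- Writes √(1 - z) as 1 - z H(z) with nonnegative coefficients, so that truncated products can be
  -- compared by inclusion of index sets.
  h : ℕ → ℚ
  h i = - a (suc i)

  0≤h : ∀ i → 0ℚ ≤ h i
  0≤h i = ℚP.neg-antimono-≤ (a-suc≤0 i)

  -- The coefficients of zH² = 2H - 1, which for z ≠ 0 is the equation (1 - zH)² = 1 - z.
  h-convolution : ∀ j → antidiagonal (λ i l → h i * h l) j ≡ 2ℚ * h (suc j)
  h-convolution j = trans (antidiagonal-cong j (λ i l → eq₁ (a (suc i)) (a (suc l))))
    (by₁ 1ℚ (trans (cong (λ z → 1ℚ * a (suc (suc j)) + z) (sym (antidiagonal-last (λ i l →
      a (suc i) * a l) j))) (a-convolution j))
      (eq (a (suc (suc j))) (antidiagonal (λ i l → a (suc i) * a (suc l)) j)))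
    where
    eq₁ : ∀ x y → - x * - y ≡ x * y
    eq₁ = solve-∀ ℚ-ring
    eq : ∀ x s → s ≡ 2ℚ * - x + 1ℚ * (1ℚ * x + (s + x * 1ℚ) - 0ℚ)
    eq = solve-∀ ℚ-ring

  sum-head : ∀ f n → sum f (suc n) ≡ f 0 + sum (λ i → f (suc i)) n
  sum-head f zero    = ℚP.+-comm 0ℚ (f 0)
  sum-head f (suc n) = trans (cong (_+ f (suc n)) (sum-head f n)) (ℚP.+-assoc (f 0) _ (f (suc n)))

  sum-grow : ∀ {f} m n → (∀ i → 0ℚ ≤ f i) → sum f n ≤ sum f (m ℕ.+ n)
  sum-grow zero    n 0≤f = ℚP.≤-refl
  sum-grow {f} (suc m) n 0≤f = ≤-by (sum f (m ℕ.+ n) - sum f n + f (m ℕ.+ n))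
    (0≤+ (≤⇒0≤- (sum-grow m n 0≤f)) (0≤f (m ℕ.+ n))) (eq (sum f n) (sum f (m ℕ.+ n)) (f (m ℕ.+ n)))
    where
    eq : ∀ s t x → t + x ≡ s + (t - s + x)
    eq = solve-∀ ℚ-ring

  triangle : (ℕ → ℚ) → (ℕ → ℚ) → ℕ → ℚ
  triangle f g = sum (antidiagonal (λ i l → f i * g l))

  triangle-head : ∀ f g n → triangle f g (suc n) ≡ f 0 * sum g (suc n) + triangle (λ i → f (suc i)) g n
  triangle-head f g zero    = eq (f 0) (g 0)
    where
    eq : ∀ x y → 0ℚ + x * y ≡ x * (0ℚ + y) + 0ℚ
    eq = solve-∀ ℚ-ring
  triangle-head f g (suc n) = trans
    (cong (_+ antidiagonal (λ i l → f i * g l) (suc n)) (triangle-head f g n))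
    (eq (f 0) (sum g (suc n)) (triangle (λ i → f (suc i)) g n) (g (suc n)) (antidiagonal (λ i l → f (suc i) * g l) n))
    where
    eq : ∀ x s t y r → x * s + t + (x * y + r) ≡ x * (s + y) + (t + r)
    eq = solve-∀ ℚ-ring

  triangle≤product : ∀ {f g} n → (∀ i → 0ℚ ≤ f i) → (∀ i → 0ℚ ≤ g i) → triangle f g n ≤ sum f n * sum g n
  triangle≤product zero    0≤f 0≤g = ℚP.≤-refl
  triangle≤product {f} {g} (suc n) 0≤f 0≤g = subst₂ _≤_ (sym (triangle-head f g n))
    (trans (sym (ℚP.*-distribʳ-+ (sum g (suc n)) (f 0) (sum f′ n))) (cong (_* sum g (suc n)) (sym (sum-head f n))))
    (ℚP.+-monoʳ-≤ (f 0 * sum g (suc n)) (ℚP.≤-trans (triangle≤product n 0≤f′ 0≤g)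
      (*-monoˡ (sum f′ n) (sum-≥0 n 0≤f′) (sum-grow 1 n 0≤g))))
    where
    f′ : ℕ → ℚ
    f′ i = f (suc i)
    0≤f′ : ∀ i → 0ℚ ≤ f′ i
    0≤f′ i = 0≤f (suc i)

  -- The rectangle i < m, l < n lies in the triangle i + l < m + n, just as the triangle i + l < n
  -- lies in a square in `triangle≤product`.
  product≤triangle : ∀ {f g} m n → (∀ i → 0ℚ ≤ f i) → (∀ i → 0ℚ ≤ g i) → sum f m * sum g n ≤ triangle f g (m ℕ.+ n)
  product≤triangle {f} {g} zero    n 0≤f 0≤g = subst (_≤ triangle f g n) (sym (ℚP.*-zeroˡ (sum g n)))
    (sum-≥0 n (λ j → 0≤antidiagonal j (λ i l → nonNeg* (0≤f i) (0≤g l))))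
  product≤triangle {f} {g} (suc m) n 0≤f 0≤g = subst₂ _≤_
    (trans (sym (ℚP.*-distribʳ-+ (sum g n) (f 0) (sum f′ m))) (cong (_* sum g n) (sym (sum-head f m))))
    (sym (triangle-head f g (m ℕ.+ n)))
    (ℚP.+-mono-≤ (*-monoˡ (f 0) (0≤f 0) (sum-grow (suc m) n 0≤g)) (product≤triangle m n (λ i → 0≤f (suc i)) 0≤g))
    where
    f′ : ℕ → ℚ
    f′ i = f (suc i)

  ^-+ : ∀ z i l → z ^ (i ℕ.+ l) ≡ z ^ i * z ^ l
  ^-+ z zero    l = sym (ℚP.*-identityˡ (z ^ l))
  ^-+ z (suc i) l = trans (cong (z *_) (^-+ z i l)) (sym (ℚP.*-assoc z (z ^ i) (z ^ l)))

  H : ℕ → ℚ → ℚ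
  H n z = sum (λ i → h i * z ^ i) n

  G≡1-zH : ∀ n z → G (suc n) z ≡ 1ℚ - z * H n z
  G≡1-zH zero    z = eq z
    where
    eq : ∀ z → 0ℚ + 1ℚ * 1ℚ ≡ 1ℚ - z * 0ℚ
    eq = solve-∀ ℚ-ring
  G≡1-zH (suc n) z = by₁ 1ℚ (G≡1-zH n z) (eq z (G (suc n) z) (H n z) (a (suc n)) (z ^ n))
    where
    eq : ∀ z s t x p → s + x * (z * p) ≡ 1ℚ - z * (t + (- x) * p) + 1ℚ * (s - (1ℚ - z * t))
    eq = solve-∀ ℚ-ring

  -- Summed over a triangle, zH² = 2H - 1 holds exactly, at the price of one more term of H on the
  -- right.
  triangle-H : ∀ n z → z * triangle (λ i → h i * z ^ i) (λ i → h i * z ^ i) n ≡ 2ℚ * H (suc n) z - 1ℚ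
  triangle-H zero    z = eq z
    where
    eq : ∀ z → z * 0ℚ ≡ 2ℚ * (0ℚ + ½ * 1ℚ) - 1ℚ
    eq = solve-∀ ℚ-ring
  triangle-H (suc n) z = by₂ 1ℚ z (triangle-H n z) term (eq z (triangle f f n) (antidiagonal (λ i l →
    f i * f l) n) (H (suc n) z) (h (suc n)) (z ^ n))
    where
    f : ℕ → ℚ
    f i = h i * z ^ i
    eq₁ : ∀ x p y q → x * p * (y * q) ≡ p * q * (x * y)
    eq₁ = solve-∀ ℚ-ring
    term : antidiagonal (λ i l → f i * f l) n ≡ z ^ n * (2ℚ * h (suc n))
    term = trans (antidiagonal-cong n (λ i l →
      trans (eq₁ (h i) (z ^ i) (h l) (z ^ l)) (cong (_* (h i * h l)) (sym (^-+ z i l)))))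
      (trans (antidiagonal-scale (z ^_) (λ i l → h i * h l) n) (cong (z ^ n *_) (h-convolution n)))
    eq : ∀ z T t s x p → z * (T + t) ≡
      2ℚ * (s + x * (z * p)) - 1ℚ + 1ℚ * (z * T - (2ℚ * s - 1ℚ)) + z * (t - p * (2ℚ * x))
    eq = solve-∀ ℚ-ring

  module _ (z : ℚ) (0≤z : 0ℚ ≤ z) (z≤1 : z ≤ 1ℚ) where

    private
      f : ℕ → ℚ
      f i = h i * z ^ i

      0≤f : ∀ i → 0ℚ ≤ f i
      0≤f i = nonNeg* (0≤h i) (0≤^ i 0≤z)

    -- Later terms are nonpositive and largest in modulus at z = 1, where `sum-a` gives the drop.
    G-drop : ∀ n m → G (suc n) z - G (suc (m ℕ.+ n)) z ≤ w n - w (m ℕ.+ n)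
    G-drop n zero    = ℚP.≤-reflexive (eq (G (suc n) z) (w n))
      where
      eq : ∀ s t → s - s ≡ t - t
      eq = solve-∀ ℚ-ring
    G-drop n (suc m) = ≤-by (w n - w k - (G (suc n) z - G (suc k) z) + h k * (1ℚ - z * z ^ k))
      (0≤+ (≤⇒0≤- (G-drop n m)) (nonNeg* (0≤h k) (≤⇒0≤- (^≤1 (suc k) 0≤z z≤1))))
      (by₂ 1ℚ (- 1ℚ) (sum-a (suc k)) (sum-a k) (eq (w n) (w k) (w (suc k)) (G (suc n) z) (G (suc k) z) (a (suc k))
        (z * z ^ k) (sum a (suc k))))
      where
      k : ℕ
      k = m ℕ.+ n
      eq : ∀ u v v′ s t x p S → u - v′ ≡
        s - (t + x * p) + (u - v - (s - t) + (- x) * (1ℚ - p)) + 1ℚ * (S + x - v′) + - 1ℚ * (S - v)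
      eq = solve-∀ ℚ-ring

    0≤G : ∀ n → 0ℚ ≤ G (suc n) z
    0≤G n = ℚP.≤-trans (0≤w n) (subst (λ k → w k ≤ G (suc k) z) (ℕP.+-identityʳ n)
      (≤-by (w 0 - w (n ℕ.+ 0) - (G 1 z - G (suc (n ℕ.+ 0)) z)) (≤⇒0≤- (G-drop 0 n)) (eq (w (n ℕ.+ 0)) (G (suc
        (n ℕ.+ 0)) z))))
      where
      eq : ∀ v s → s ≡ v + (1ℚ - v - (0ℚ + 1ℚ * 1ℚ - s))
      eq = solve-∀ ℚ-ring

    -- Replace H² in (1 - zH)² by the smaller triangle, for which `triangle-H` leaves 1 - z and a
    -- nonnegative multiple of the next term of H.
    1-z≤G² : ∀ n → 1ℚ - z ≤ G (suc n) z * G (suc n) z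
    1-z≤G² n = ≤-by (z * (z * (H n z * H n z - triangle f f n)) + 2ℚ * (z * (H (suc n) z - H n z)))
      (0≤+ (nonNeg* 0≤z (nonNeg* 0≤z (≤⇒0≤- (triangle≤product n 0≤f 0≤f))))
           (0≤2* (nonNeg* 0≤z (≤⇒0≤- (sum-grow 1 n 0≤f)))))
      (by₂ (G (suc n) z + (1ℚ - z * H n z)) (z) (G≡1-zH n z) (triangle-H n z) (eq z (G (suc n) z) (H n z) (H
        (suc n) z) (triangle f f n)))
      where
      eq : ∀ z s t t′ T → s * s ≡ 1ℚ - z + (z * (z * (t * t - T)) + 2ℚ * (z * (t′ - t)))
        + (s + (1ℚ - z * t)) * (s - (1ℚ - z * t)) + z * (z * T - (2ℚ * t′ - 1ℚ))
      eq = solve-∀ ℚ-ring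

    -- Here H² is enclosed in the triangle of side 2n. This brings in the terms of H from n to 2n,
    -- which `G-drop` bounds by `w n`.
    G²≤ : ∀ n → G (suc n) z * G (suc n) z ≤ 1ℚ - z + 2ℚ * w n
    G²≤ n = ≤-by (z * (z * (triangle f f (n ℕ.+ n) - H n z * H n z)) + 2ℚ * (w n - w m - (G (suc n) z - G (suc m) z)
      + w m))
      (0≤+ (nonNeg* 0≤z (nonNeg* 0≤z (≤⇒0≤- (product≤triangle n n 0≤f 0≤f))))
           (0≤2* (0≤+ (≤⇒0≤- (G-drop n (suc n))) (0≤w m))))
      (by₃ (- (G (suc n) z + (1ℚ - z * H n z)) + 2ℚ) (- 2ℚ) (- z) (G≡1-zH n z) (G≡1-zH m z) (triangle-H (n ℕ.+ n) z)
        (eq z (G (suc n) z) (G (suc m) z) (H n z) (H m z) (triangle f f (n ℕ.+ n)) (w n) (w m)))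
      where
      m : ℕ
      m = suc n ℕ.+ n
      eq : ∀ z s s′ t t′ T u u′ → 1ℚ - z + 2ℚ * u ≡ s * s + (z * (z * (T - t * t)) + 2ℚ * (u - u′ - (s - s′) + u′))
        + (- (s + (1ℚ - z * t)) + 2ℚ) * (s - (1ℚ - z * t)) + - 2ℚ * (s′ - (1ℚ - z * t′))
          + - z * (z * T - (2ℚ * t′ - 1ℚ))
      eq = solve-∀ ℚ-ring

-- Null sequences, Euler's transformation and the integrals of cosⁿ.

module LeibnizSeries where

  open import Data.Rational.Base using (_+_; _-_; -_; _*_; _/_; _≤_; _<_; ∣_∣; 1/_)
  open Arithmetic
  open import Defs using (sign; leibnizSum; leibnizTerm; ∣sign∣)
  open TaylorSeries
  open LegendreCoefficients

  Null : (ℕ → ℚ) → Set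
  Null s = ∀ ε → 0ℚ < ε → ∃ λ N → ∀ n → N ℕ.≤ n → ∣ s n ∣ ≤ ε

  null-+ : ∀ {s t : ℕ → ℚ} → Null s → Null t → Null (λ n → s n + t n)
  null-+ {s} {t} hs ht ε 0<ε with hs (ε * ½) (half>0 0<ε) | ht (ε * ½) (half>0 0<ε)
  ... | M , f | K , f′ = M ℕ.⊔ K , λ n h → subst (∣ s n + t n ∣ ≤_) (half+half ε)
    (∣+∣≤ (f n (ℕP.m⊔n≤o⇒m≤o M K h)) (f′ n (ℕP.m⊔n≤o⇒n≤o M K h)))

  null-bounded* : ∀ {s t : ℕ → ℚ} B → (∀ n → ∣ s n ∣ ≤ B) → Null t → Null (λ n → s n * t n)
  null-bounded* {s} {t} B hs ht ε 0<ε with scale (nonNeg+pos 0≤B 0<1) 0<ε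
    where
    0≤B : 0ℚ ≤ B
    0≤B = ℚP.≤-trans (ℚP.0≤∣p∣ (s 0)) (hs 0)
  ... | δ , 0<δ , eq with ht δ 0<δ
  ... | N , f = N , λ n h → subst (∣ s n * t n ∣ ≤_) eq
          (∣*∣≤ {s n} {t n} (ℚP.≤-trans (hs n) (≤-by 1ℚ 0≤1 refl)) (f n h))

  null-* : ∀ {s} c → Null s → Null (λ n → c * s n)
  null-* {s} c = null-bounded* {λ _ → c} {s} ∣ c ∣ (λ _ → ℚP.≤-refl)

  null-cong : ∀ {s t : ℕ → ℚ} → (∀ n → s n ≡ t n) → Null s → Null t
  null-cong eq hs ε 0<ε with hs ε 0<ε
  ... | N , f = N , λ n h → subst (λ z → ∣ z ∣ ≤ ε) (eq n) (f n h)

  null-squeeze : ∀ {s t : ℕ → ℚ} → (∀ n → ∣ s n ∣ ≤ t n) → Null t → Null s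
  null-squeeze {t = t} s≤t ht ε 0<ε with ht ε 0<ε
  ... | N , f = N , λ n h → ℚP.≤-trans (s≤t n) (ℚP.≤-trans (p≤∣p∣ (t n)) (f n h))

  null-shift : ∀ {s} k → Null (λ n → s (k ℕ.+ n)) → Null s
  null-shift {s} k hs ε 0<ε with hs ε 0<ε
  ... | N , f = k ℕ.+ N , λ n h → subst (λ m → ∣ s m ∣ ≤ ε) (ℕP.m+[n∸m]≡n (ℕP.m+n≤o⇒m≤o k h))
    (f (n ℕ.∸ k) (subst (ℕ._≤ n ℕ.∸ k) (ℕP.m+n∸m≡n k N) (ℕP.∸-monoˡ-≤ k h)))

  null-recip : Null (λ n → 1ℚ ÷ ι (suc n))
  null-recip ε 0<ε with archimedean 1 ε 0<ε
  ... | N , f = N , λ n h → ∣nonNeg∣≤ (0≤÷ 0≤1 (0<ι n)) (÷≤ (0<ι n) (ℚP.≤-trans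
      (ℚP.≤-reflexive (sym (/-*ι 1 n))) (*-monoʳ (ι (suc n)) (ℚP.<⇒≤ (0<ι n)) (ℚP.<⇒≤ (f n h)))))

  null-rate : ∀ {s} c → (∀ n → ∣ s n ∣ * ι (suc n) ≤ c) → Null s
  null-rate {s} c h = null-squeeze {t = λ n → c * (1ℚ ÷ ι (suc n))}
      (λ n → cancel-≤ (ι (suc n)) (0<ι n) (subst₂ _≤_ (ℚP.*-comm ∣ s n ∣ (ι (suc n)))
        (by₁ (- c) (÷-*⁺ 1ℚ (0<ι n)) (eq c (ι (suc n)) (1ℚ ÷ ι (suc n)))) (h n)))
      (null-* c null-recip)
    where
    eq : ∀ c n r → c ≡ n * (c * r) + - c * (r * n - 1ℚ)
    eq = solve-∀ ℚ-ring

  -- The integral of t²ʲ (1 - t²)ᴷ over [0, 1].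
  D : ℕ → ℕ → ℚ
  D zero    j = 1ℚ ÷ (2ℚ * ι j + 1ℚ)
  D (suc K) j = (2ℚ * ι K + 2ℚ) * D K j ÷ (2ℚ * ι j + (2ℚ * ι K + 3ℚ))

  D-sucˡ : ∀ K j → D (suc K) j * (2ℚ * ι j + (2ℚ * ι K + 3ℚ)) ≡ (2ℚ * ι K + 2ℚ) * D K j
  D-sucˡ K j = ÷-*⁺ _ (0<den j K)

  D-sucʳ : ∀ K j → (2ℚ * ι j + (2ℚ * ι K + 3ℚ)) * D K (suc j) ≡ (2ℚ * ι j + 1ℚ) * D K j
  D-sucʳ zero    j = ρ-sucʳ 0 j
  D-sucʳ (suc K) j = cancelˡ (2ℚ * ι j + (2ℚ * ι K + 3ℚ)) (0<⇒≢ (0<den j K))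
    (by₃ (2ℚ * ι j + (2ℚ * ι K + 3ℚ)) (2ℚ * ι K + 2ℚ) (- (2ℚ * ι j + 1ℚ)) (D-sucˡ K (suc j)) (D-sucʳ K j) (D-sucˡ K j)
      (eq (ι j) (ι K) (D K j) (D K (suc j)) (D (suc K) j) (D (suc K) (suc j))))
    where
    eq : ∀ j k d d₁ d′ d₁′ → (2ℚ * j + (2ℚ * k + 3ℚ)) * ((2ℚ * j + (2ℚ * (1ℚ + k) + 3ℚ)) * d₁′) ≡
      (2ℚ * j + (2ℚ * k + 3ℚ)) * ((2ℚ * j + 1ℚ) * d′)
      + (2ℚ * j + (2ℚ * k + 3ℚ)) * (d₁′ * (2ℚ * (1ℚ + j) + (2ℚ * k + 3ℚ)) - (2ℚ * k + 2ℚ) * d₁)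
      + (2ℚ * k + 2ℚ) * ((2ℚ * j + (2ℚ * k + 3ℚ)) * d₁ - (2ℚ * j + 1ℚ) * d)
      + - (2ℚ * j + 1ℚ) * (d′ * (2ℚ * j + (2ℚ * k + 3ℚ)) - (2ℚ * k + 2ℚ) * d)
    eq = solve-∀ ℚ-ring

  -- Splits off one factor 1 - t² under the integral. Hence `D K` is, up to the usual sign, the K-th
  -- difference of the sequence 1/(2j + 1), as Euler's transformation requires.
  D-difference : ∀ K j → D (suc K) j ≡ D K j - D K (suc j)
  D-difference K j = cancelˡ (2ℚ * ι j + (2ℚ * ι K + 3ℚ)) (0<⇒≢ (0<den j K))
    (by₂ 1ℚ 1ℚ (D-sucˡ K j) (D-sucʳ K j) (eq (ι j) (ι K) (D K j) (D K (suc j)) (D (suc K) j)))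
    where
    eq : ∀ j k d d₁ d′ → (2ℚ * j + (2ℚ * k + 3ℚ)) * d′ ≡ (2ℚ * j + (2ℚ * k + 3ℚ)) * (d - d₁)
      + 1ℚ * (d′ * (2ℚ * j + (2ℚ * k + 3ℚ)) - (2ℚ * k + 2ℚ) * d)
      + 1ℚ * ((2ℚ * j + (2ℚ * k + 3ℚ)) * d₁ - (2ℚ * j + 1ℚ) * d)
    eq = solve-∀ ℚ-ring

  0≤D : ∀ K j → 0ℚ ≤ D K j
  0≤D zero    j = 0≤ρ 0 j
  0≤D (suc K) j = 0≤÷ (nonNeg* (ℚP.<⇒≤ (0<2ι+2 K)) (0≤D K j)) (0<den j K)

  0≤-⇒≤ : ∀ {p q} → 0ℚ ≤ q - p → p ≤ q
  0≤-⇒≤ {p} {q} h = ≤-by (q - p) h (eq p q)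
    where
    eq : ∀ p q → q ≡ p + (q - p)
    eq = solve-∀ ℚ-ring

  D-antitoneʳ : ∀ K j → D K (suc j) ≤ D K j
  D-antitoneʳ K j = 0≤-⇒≤ (subst (0ℚ ≤_) (D-difference K j) (0≤D (suc K) j))

  D≤D₀ : ∀ K j → D K j ≤ D 0 j
  D≤D₀ zero    j = ℚP.≤-refl
  D≤D₀ (suc K) j = ℚP.≤-trans (≤-by (D K (suc j)) (0≤D K (suc j)) (by₁ (- 1ℚ) (D-difference K j) (eq (D K j) (D K
    (suc j)) (D (suc K) j))))
    (D≤D₀ K j)
    where
    eq : ∀ d d₁ d′ → d ≡ d′ + d₁ + - 1ℚ * (d′ - (d - d₁))
    eq = solve-∀ ℚ-ring

  -- Peeling from the front, unlike `leibnizSum`, leaves an alternating sum of the same kind; the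
  -- bounds for alternating series and Euler's step both induct on that.
  alternating : (ℕ → ℚ) → ℕ → ℚ
  alternating f zero    = 0ℚ
  alternating f (suc J) = f 0 - alternating (λ j → f (suc j)) J

  alternating-cong : ∀ {f f′} J → (∀ j → f j ≡ f′ j) → alternating f J ≡ alternating f′ J
  alternating-cong zero    h = refl
  alternating-cong (suc J) h = cong₂ _-_ (h 0) (alternating-cong J (λ j → h (suc j)))

  alternating-last : ∀ f J → alternating f (suc J) ≡ alternating f J + sign J * f J
  alternating-last f zero    = eq (f 0)
    where
    eq : ∀ x → x - 0ℚ ≡ 0ℚ + 1ℚ * x
    eq = solve-∀ ℚ-ring
  alternating-last f (suc J) = by₁ (- 1ℚ) (alternating-last (λ j → f (suc j)) J)
      (eq (f 0) (alternating (λ j → f (suc j)) (suc J)) (alternating (λ j → f (suc j)) J) (sign J) (f (suc J)))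
    where
    eq : ∀ x t t′ s y → x - t ≡ x - t′ + (- s) * y + - 1ℚ * (t - (t′ + s * y))
    eq = solve-∀ ℚ-ring

  alternating-bounds : ∀ f J → (∀ j → 0ℚ ≤ f j) → (∀ j → f (suc j) ≤ f j) → 0ℚ ≤ alternating f J × alternating f J ≤ f 0
  alternating-bounds f zero    0≤f f↓ = ℚP.≤-refl , 0≤f 0
  alternating-bounds f (suc J) 0≤f f↓ with alternating-bounds (λ j → f (suc j)) J (λ j → 0≤f (suc j)) (λ j → f↓ (suc j))
  ... | 0≤t , t≤ = ≤⇒0≤- (ℚP.≤-trans t≤ (f↓ 0)) , ≤-by _ 0≤t (eq (f 0) _)
    where
    eq : ∀ x t → x ≡ x - t + t
    eq = solve-∀ ℚ-ring

  -- One step of Euler's transformation.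
  alternating-difference : ∀ f J → alternating (λ j → f j - f (suc j)) J + f 0 ≡ 2ℚ * alternating f J + sign J * f J
  alternating-difference f zero    = eq (f 0)
    where
    eq : ∀ x → 0ℚ + x ≡ 2ℚ * 0ℚ + 1ℚ * x
    eq = solve-∀ ℚ-ring
  alternating-difference f (suc J) = by₁ (- 1ℚ) (alternating-difference (λ j → f (suc j)) J)
      (eq (f 0) (f 1) (alternating (λ j → f (suc j) - f (suc (suc j))) J) (alternating (λ j →
        f (suc j)) J) (sign J) (f (suc J)))
    where
    eq : ∀ x y t t′ s v → x - y - t + x ≡ 2ℚ * (x - t′) + (- s) * v + - 1ℚ * (t + y - (2ℚ * t′ + s * v))
    eq = solve-∀ ℚ-ring

  -- e m = m! / (2m + 1)!!.
  e : ℕ → ℚ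
  e zero    = 1ℚ
  e (suc m) = (ι m + 1ℚ) * e m ÷ (2ℚ * ι m + 3ℚ)

  e-suc : ∀ m → e (suc m) * (2ℚ * ι m + 3ℚ) ≡ (ι m + 1ℚ) * e m
  e-suc m = ÷-*⁺ _ (0<2ι+3 m)

  0≤e : ∀ m → 0ℚ ≤ e m
  0≤e zero    = 0≤1
  0≤e (suc m) = 0≤÷ (nonNeg* (ℚP.<⇒≤ (0<1ℚ+ι m)) (0≤e m)) (0<2ι+3 m)

  2e-suc≤e : ∀ m → 2ℚ * e (suc m) ≤ e m
  2e-suc≤e m = cancel-≤ (2ℚ * ι m + 3ℚ) (0<2ι+3 m) (≤-by (e m) (0≤e m)
    (by₁ (- 2ℚ) (e-suc m) (eq (ι m) (e m) (e (suc m)))))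
    where
    eq : ∀ m x y → (2ℚ * m + 3ℚ) * x ≡ (2ℚ * m + 3ℚ) * (2ℚ * y) + x + - 2ℚ * (y * (2ℚ * m + 3ℚ) - (m + 1ℚ) * x)
    eq = solve-∀ ℚ-ring

  -- The K-th term of Euler's transformed series is D K 0 / 2^(K+1), that is, half of `e K`.
  ½^*D≡e : ∀ K → ½ ^ K * D K 0 ≡ e K
  ½^*D≡e zero    = refl
  ½^*D≡e (suc K) = cancelˡ (2ℚ * ι K + 3ℚ) (0<⇒≢ (0<2ι+3 K))
    (by₃ (½ ^ suc K) (ι K + 1ℚ) (- 1ℚ) (D-sucˡ K 0) (½^*D≡e K) (e-suc K)
      (eq (ι K) (½ ^ K) (D K 0) (D (suc K) 0) (e K) (e (suc K))))
    where
    eq : ∀ k p d d′ x y → (2ℚ * k + 3ℚ) * (½ * p * d′) ≡ (2ℚ * k + 3ℚ) * y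
      + ½ * p * (d′ * (2ℚ * 0ℚ + (2ℚ * k + 3ℚ)) - (2ℚ * k + 2ℚ) * d)
      + (k + 1ℚ) * (p * d - x) + - 1ℚ * (y * (2ℚ * k + 3ℚ) - (k + 1ℚ) * x)
    eq = solve-∀ ℚ-ring

  0≤½^ : ∀ n → 0ℚ ≤ ½ ^ n
  0≤½^ n = 0≤^ n (0≤/ 1 1)

  -- Step M on a sum of J terms leaves a last term of size D M J / 2^(M+1), at most D 0 J / 2^(M+1).
  -- These bounds add up to the right side.
  euler-transform : ∀ M J →
    ∣ alternating (D 0) J - (½ * sum e M + ½ ^ M * alternating (D M) J) ∣ ≤ (1ℚ - ½ ^ M) * D 0 J
  euler-transform zero J = subst (λ z → ∣ z ∣ ≤ (1ℚ - 1ℚ) * D 0 J) (eq (alternating (D 0) J))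
      (ℚP.≤-reflexive (sym (ℚP.*-zeroˡ (D 0 J))))
    where
    eq : ∀ x → 0ℚ ≡ x - (½ * 0ℚ + 1ℚ * x)
    eq = solve-∀ ℚ-ring
  euler-transform (suc M) J = subst (∣ alternating (D 0) J - x′ ∣ ≤_) (eq₁ (½ ^ M) (D 0 J))
      (∣-∣≤-trans {alternating (D 0) J} {x} {x′} (euler-transform M J) step)
    where
    x x′ : ℚ
    x  = ½ * sum e M + ½ ^ M * alternating (D M) J
    x′ = ½ * sum e (suc M) + ½ ^ suc M * alternating (D (suc M)) J
    eq₁ : ∀ p d → (1ℚ - p) * d + ½ * p * d ≡ (1ℚ - ½ * p) * d
    eq₁ = solve-∀ ℚ-ring
    x-x′ : x - x′ ≡ ½ ^ suc M * (- sign J * D M J)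
    x-x′ = by₂ (- (½ ^ suc M)) ½ (trans (cong (_+ D M 0) (alternating-cong J (D-difference M)))
      (alternating-difference (D M) J)) (½^*D≡e M)
      (eq (sum e M) (e M) (½ ^ M) (alternating (D M) J) (alternating (D (suc M)) J) (D M 0) (sign J) (D M J))
      where
      eq : ∀ s x p t t′ d σ dj → ½ * s + p * t - (½ * (s + x) + ½ * p * t′) ≡ ½ * p * (- σ * dj)
        + - (½ * p) * (t′ + d - (2ℚ * t + σ * dj)) + ½ * (p * d - x)
      eq = solve-∀ ℚ-ring
    step : ∣ x - x′ ∣ ≤ ½ ^ suc M * D 0 J
    step = subst (λ z → ∣ z ∣ ≤ ½ ^ suc M * D 0 J) (sym x-x′)
      (∣*∣≤ {½ ^ suc M} {(- sign J * D M J)} (∣nonNeg∣≤ (0≤½^ (suc M)) ℚP.≤-refl)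
        (subst (∣ - sign J * D M J ∣ ≤_) (ℚP.*-identityˡ (D 0 J))
          (∣*∣≤ { - sign J} {D M J} (ℚP.≤-reflexive (trans (ℚP.∣-p∣≡∣p∣ (sign J)) (∣sign∣ J))) (∣nonNeg∣≤ (0≤D M J)
            (D≤D₀ M J)))))

  euler-close : ∀ M J → ∣ alternating (D 0) J - ½ * sum e M ∣ ≤ ½ ^ M + D 0 J
  euler-close M J = subst (∣ alternating (D 0) J - ½ * sum e M ∣ ≤_) (ℚP.+-comm (D 0 J) (½ ^ M))
    (subst (λ z → ∣ z ∣ ≤ D 0 J + ½ ^ M) (eq (alternating (D 0) J) (½ * sum e M) (½ ^ M * t))
      (∣+∣≤ (ℚP.≤-trans (euler-transform M J) (≤-by (½ ^ M * D 0 J) (nonNeg* (0≤½^ M) (0≤D 0 J)) (eq₁ (½ ^ M) (D 0 J))))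
        (∣nonNeg∣≤ (nonNeg* (0≤½^ M) (proj₁ bounds)) (subst (½ ^ M * t ≤_) (ℚP.*-identityʳ (½ ^ M))
          (*-monoˡ (½ ^ M) (0≤½^ M) (ℚP.≤-trans (proj₂ bounds) (D≤D₀ M 0)))))))
    where
    t : ℚ
    t = alternating (D M) J
    bounds : 0ℚ ≤ t × t ≤ D M 0
    bounds = alternating-bounds (D M) J (0≤D M) (D-antitoneʳ M)
    eq : ∀ x y z → x - (y + z) + z ≡ x - y
    eq = solve-∀ ℚ-ring
    eq₁ : ∀ p d → d ≡ (1ℚ - p) * d + p * d
    eq₁ = solve-∀ ℚ-ring

  leibnizSum≡ : ∀ J → leibnizSum J ≡ 4ℚ * alternating (D 0) J
  leibnizSum≡ zero    = refl
  leibnizSum≡ (suc J) = by₃ 1ℚ (sign J) (- 4ℚ) (leibnizSum≡ J) term (alternating-last (D 0) J)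
    (eq (leibnizSum J) (sign J) (leibnizTerm J) (alternating (D 0) J) (alternating (D 0) (suc J)) (D 0 J))
    where
    eq : ∀ L s t x x′ d → L + s * t ≡ 4ℚ * x′ + 1ℚ * (L - 4ℚ * x) + s * (t - 4ℚ * d) + - 4ℚ * (x′ - (x + s * d))
    eq = solve-∀ ℚ-ring
    term : leibnizTerm J ≡ 4ℚ * D 0 J
    term = cancelˡ (2ℚ * ι J + 1ℚ) (0<⇒≢ (0<2ι+1 J))
      (by₃ 1ℚ (- leibnizTerm J) (- 4ℚ) (/-*ι 4 (2 ℕ.* J)) (ι-* 2 J) (β-zero J) (eq₁ (ι J) (leibnizTerm J) (ι
        (2 ℕ.* J)) (D 0 J)))
      where
      eq₁ : ∀ j t i d → (2ℚ * j + 1ℚ) * t ≡ (2ℚ * j + 1ℚ) * (4ℚ * d) + 1ℚ * (t * (1ℚ + i) - 4ℚ)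
        + - t * (i - 2ℚ * j) + - 4ℚ * (d * (2ℚ * j + 1ℚ) - 1ℚ)
      eq₁ = solve-∀ ℚ-ring

  bin : ℕ → ℕ → ℚ
  bin m       zero    = 1ℚ
  bin zero    (suc n) = 0ℚ
  bin (suc m) (suc n) = bin m (suc n) + bin m n

  0≤bin : ∀ m n → 0ℚ ≤ bin m n
  0≤bin zero    zero    = 0≤1
  0≤bin (suc m) zero    = 0≤1
  0≤bin zero    (suc n) = ℚP.≤-refl
  0≤bin (suc m) (suc n) = 0≤+ (0≤bin m (suc n)) (0≤bin m n)

  bin-suc : ∀ m n → (ι m - ι n) * bin m n ≡ (ι n + 1ℚ) * bin m (suc n)
  bin-suc zero zero = refl
  bin-suc zero (suc n) = eq (ι n)
    where
    eq : ∀ n → (0ℚ - (1ℚ + n)) * 0ℚ ≡ (1ℚ + n + 1ℚ) * 0ℚ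
    eq = solve-∀ ℚ-ring
  bin-suc (suc m) zero = by₁ 1ℚ (bin-suc m zero) (eq (ι m) (bin m 0) (bin m 1))
    where
    eq : ∀ m b b₁ → (1ℚ + m - 0ℚ) * 1ℚ ≡ (0ℚ + 1ℚ) * (b₁ + 1ℚ) + 1ℚ * ((m - 0ℚ) * 1ℚ - (0ℚ + 1ℚ) * b₁)
    eq = solve-∀ ℚ-ring
  bin-suc (suc m) (suc n) = by₂ 1ℚ 1ℚ (bin-suc m (suc n)) (bin-suc m n) (eq (ι m) (ι n) (bin m n) (bin m (suc n))
    (bin m (suc (suc n))))
    where
    eq : ∀ m n b b₁ b₂ → (1ℚ + m - (1ℚ + n)) * (b₁ + b) ≡ (1ℚ + n + 1ℚ) * (b₂ + b₁)
      + 1ℚ * ((m - (1ℚ + n)) * b₁ - (1ℚ + n + 1ℚ) * b₂) + 1ℚ * ((m - n) * b - (n + 1ℚ) * b₁)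
    eq = solve-∀ ℚ-ring

  -- A n tends to the integral of cosⁿ over [0, π/2]: expand 1/(1 + t²)ⁿ⁺¹ in
  -- powers of (1 - t²)/2 after the substitution t = tan(θ/2).
  A : ℕ → ℕ → ℚ
  A n M = sum (λ m → bin m n * e m) M

  -- In the limit this is the reduction formula for the integrals of cosⁿ. The last term results
  -- from telescoping in M; `boundary-null` disposes of it.
  A-suc-suc : ∀ n M → (ι n + 2ℚ) * A (suc (suc n)) M ≡ (ι n + 1ℚ) * A n M - (2ℚ * ι M + 1ℚ) * (bin M (suc n) * e M)
  A-suc-suc n zero    = eq (ι n)
    where
    eq : ∀ n → (n + 2ℚ) * 0ℚ ≡ (n + 1ℚ) * 0ℚ - (2ℚ * 0ℚ + 1ℚ) * (0ℚ * 1ℚ)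
    eq = solve-∀ ℚ-ring
  A-suc-suc n (suc M) = by₁ 1ℚ (A-suc-suc n M)
    (by₃ (bin M (suc n) + bin M n) (e M) (- e M) (e-suc M) (bin-suc M n) (bin-suc M (suc n))
      (eq (ι n) (ι M) (A n M) (A (suc (suc n)) M) (bin M n) (bin M (suc n)) (bin M (suc (suc n))) (e M) (e (suc M))))
    where
    eq : ∀ n m x x₂ b b₁ b₂ y y′ → (n + 2ℚ) * (x₂ + b₂ * y) ≡
      (n + 1ℚ) * (x + b * y) - (2ℚ * (1ℚ + m) + 1ℚ) * ((b₁ + b) * y′)
      + 1ℚ * ((n + 2ℚ) * x₂ - ((n + 1ℚ) * x - (2ℚ * m + 1ℚ) * (b₁ * y)))
      + (b₁ + b) * (y′ * (2ℚ * m + 3ℚ) - (m + 1ℚ) * y)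
      + y * ((m - n) * b - (n + 1ℚ) * b₁)
      + - y * ((m - (1ℚ + n)) * b₁ - (1ℚ + n + 1ℚ) * b₂)
    eq = solve-∀ ℚ-ring

  A-one : ∀ M → A 1 M ≡ 1ℚ - (2ℚ * ι M + 1ℚ) * e M
  A-one zero    = refl
  A-one (suc M) = by₁ 1ℚ (A-one M) (by₂ 1ℚ (- e M) (e-suc M) (bin-suc M 0)
      (eq (ι M) (A 1 M) (bin M 1) (e M) (e (suc M))))
    where
    eq : ∀ m x b y y′ → x + b * y ≡ 1ℚ - (2ℚ * (1ℚ + m) + 1ℚ) * y′
      + 1ℚ * (x - (1ℚ - (2ℚ * m + 1ℚ) * y)) + 1ℚ * (y′ * (2ℚ * m + 3ℚ) - (m + 1ℚ) * y)
      + - y * ((m - 0ℚ) * 1ℚ - (0ℚ + 1ℚ) * b)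
    eq = solve-∀ ℚ-ring

  -- Termwise comparison fails, since bin m n - bin m (n + 1) changes sign. Carrying the left side
  -- as a surplus lets the induction close, by `2e-suc≤e`; it also bounds single terms in `bin*e≤1`.
  A-gap : ∀ n M → 2ℚ * (bin M (suc n) * e M) ≤ A n M - A (suc n) M
  A-gap n zero    = ℚP.≤-refl
  A-gap n (suc M) = ≤-by
    (A n M - A (suc n) M - 2ℚ * (b₁ * e M) + (b₁ + b) * (e M - 2ℚ * e (suc M)))
    (0≤+ (≤⇒0≤- (A-gap n M)) (nonNeg* (0≤+ (0≤bin M (suc n)) (0≤bin M n)) (≤⇒0≤- (2e-suc≤e M))))
    (eq (A n M) (A (suc n) M) b b₁ (e M) (e (suc M)))
    where
    b b₁ : ℚ
    b  = bin M n
    b₁ = bin M (suc n)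
    eq : ∀ x x₁ b b₁ y y′ → x + b * y - (x₁ + b₁ * y) ≡
      2ℚ * ((b₁ + b) * y′) + (x - x₁ - 2ℚ * (b₁ * y) + (b₁ + b) * (y - 2ℚ * y′))
    eq = solve-∀ ℚ-ring

  0≤bin*e : ∀ n M → 0ℚ ≤ bin M n * e M
  0≤bin*e n M = nonNeg* (0≤bin M n) (0≤e M)

  A-antitone : ∀ n M → A (suc n) M ≤ A n M
  A-antitone n M = 0≤-⇒≤ (ℚP.≤-trans (0≤2* (0≤bin*e (suc n) M)) (A-gap n M))

  A-zero : ∀ M → A 0 M ≡ sum e M
  A-zero M = sum-cong M (λ m → trans (cong (_* e m) (bin-zero m)) (ℚP.*-identityˡ (e m)))
    where
    bin-zero : ∀ m → bin m 0 ≡ 1ℚ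
    bin-zero zero    = refl
    bin-zero (suc m) = refl

  sum-e≤2 : ∀ M → sum e M ≤ 2ℚ - 2ℚ * e M
  sum-e≤2 zero    = ℚP.≤-refl
  sum-e≤2 (suc M) = ≤-by (2ℚ - 2ℚ * e M - sum e M + (e M - 2ℚ * e (suc M)))
    (0≤+ (≤⇒0≤- (sum-e≤2 M)) (≤⇒0≤- (2e-suc≤e M))) (eq (sum e M) (e M) (e (suc M)))
    where
    eq : ∀ s x y → 2ℚ - 2ℚ * y ≡ s + x + (2ℚ - 2ℚ * x - s + (x - 2ℚ * y))
    eq = solve-∀ ℚ-ring

  A≤2 : ∀ n M → A n M ≤ 2ℚ
  A≤2 zero    M = subst (_≤ 2ℚ) (sym (A-zero M)) (ℚP.≤-trans (sum-e≤2 M)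
      (≤-by (2ℚ * e M) (0≤2* (0≤e M)) (eq (e M))))
    where
    eq : ∀ x → 2ℚ ≡ 2ℚ - 2ℚ * x + 2ℚ * x
    eq = solve-∀ ℚ-ring
  A≤2 (suc n) M = ℚP.≤-trans (A-antitone n M) (A≤2 n M)

  bin*e≤1 : ∀ n M → bin M (suc n) * e M ≤ 1ℚ
  bin*e≤1 n M = cancel-≤ 2ℚ (ℚP.positive⁻¹ 2ℚ) (ℚP.≤-trans (A-gap n M) (ℚP.≤-trans
    (≤-by (A (suc n) M) (sum-≥0 M (λ m → 0≤bin*e (suc n) m)) (eq (A n M) (A (suc n) M))) (A≤2 n M)))
    where
    eq : ∀ x y → x ≡ x - y + y
    eq = solve-∀ ℚ-ring

  -- By `bin*e≤1` the product of bin M (n + 2) and e M stays bounded. Lowering the index twice gains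
  -- a factor of order 1/M², which beats 2M + 1.
  boundary-null : ∀ n → Null (λ M → (2ℚ * ι M + 1ℚ) * (bin M n * e M))
  boundary-null n = null-shift (suc (suc n)) (null-rate c λ t → bound t)
    where
    ν c : ℚ
    ν = ι n
    -- With M = n + 2 + t the two index steps have the denominators t + 2 and t + 1, and 2M + 1 ≤
    -- (2n + 5)(t + 2).
    c = (2ℚ * ν + 5ℚ) * ((ν + 1ℚ) * (ν + 2ℚ))
    0≤c₁ : 0ℚ ≤ (ν + 1ℚ) * (ν + 2ℚ)
    0≤c₁ = nonNeg* (ℚP.<⇒≤ (0<1ℚ+ι n)) (0≤+ (0≤ι n) (0≤/ 2 0))
    bound : ∀ t → ∣ (2ℚ * ι (suc (suc n) ℕ.+ t)
      + 1ℚ) * (bin (suc (suc n) ℕ.+ t) n * e (suc (suc n) ℕ.+ t)) ∣ * ι (suc t) ≤ c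
    bound t = subst (λ z → z * ι (suc t) ≤ c) (sym (ℚP.0≤p⇒∣p∣≡p (nonNeg* (ℚP.<⇒≤ (0<2ι+1 M)) (0≤bin*e n M))))
      (cancel-≤ (ι t + 2ℚ) (0<+ (0≤ι t) (ℚP.positive⁻¹ 2ℚ))
        (≤-by ((2ℚ * ι M + 1ℚ) * ((ν + 1ℚ) * (ν + 2ℚ)) * (1ℚ - b₂ * e M) + ((2ℚ * ν + 3ℚ) * ι (suc t) + 2ℚ) * ((ν
          + 1ℚ) * (ν + 2ℚ)))
          (0≤+ (nonNeg* (nonNeg* (ℚP.<⇒≤ (0<2ι+1 M)) 0≤c₁) (≤⇒0≤- (bin*e≤1 (suc n) M)))
               (nonNeg* (0≤+ (nonNeg* (ℚP.<⇒≤ (0<2ι+3 n)) (0≤ι (suc t))) (0≤/ 2 0)) 0≤c₁))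
          (by₃ k₁ (- (x * (ι M - (1ℚ + ν)))) (- (x * (ν + 1ℚ))) ιM (bin-suc M n) (bin-suc M (suc n))
            (eq ν (ι t) (ι M) b b₁ b₂ (e M)))))
      where
      M : ℕ
      M = suc (suc n) ℕ.+ t
      b b₁ b₂ x k₁ : ℚ
      b  = bin M n
      b₁ = bin M (suc n)
      b₂ = bin M (suc (suc n))
      x = (2ℚ * ι M + 1ℚ) * e M
      k₁ = x * b * (ι M + ι t + 1ℚ - ν) - 2ℚ * ((ν + 1ℚ) * (ν + 2ℚ))
      ιM : ι M ≡ ν + ι t + 2ℚ
      ιM = trans (cong (λ z → 1ℚ + (1ℚ + z)) (ι-+ n t)) (eq₀ ν (ι t))
        where
        eq₀ : ∀ n t → 1ℚ + (1ℚ + (n + t)) ≡ n + t + 2ℚ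
        eq₀ = solve-∀ ℚ-ring
      eq : ∀ n t m b b₁ b₂ y → (t + 2ℚ) * ((2ℚ * n + 5ℚ) * ((n + 1ℚ) * (n + 2ℚ))) ≡
        (t + 2ℚ) * ((2ℚ * m + 1ℚ) * (b * y) * (1ℚ + t))
        + ((2ℚ * m + 1ℚ) * ((n + 1ℚ) * (n + 2ℚ)) * (1ℚ - b₂ * y) + ((2ℚ * n + 3ℚ) * (1ℚ + t) + 2ℚ) * ((n + 1ℚ) * (n
          + 2ℚ)))
        + ((2ℚ * m + 1ℚ) * y * b * (m + t + 1ℚ - n) - 2ℚ * ((n + 1ℚ) * (n + 2ℚ))) * (m - (n + t + 2ℚ))
        + - ((2ℚ * m + 1ℚ) * y * (m - (1ℚ + n))) * ((m - n) * b - (n + 1ℚ) * b₁)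
        + - ((2ℚ * m + 1ℚ) * y * (n + 1ℚ)) * ((m - (1ℚ + n)) * b₁ - (1ℚ + n + 1ℚ) * b₂)
      eq = solve-∀ ℚ-ring

-- Wallis's product and its link with Leibniz's series.

module WallisProduct where

  open import Data.Rational.Base using (_+_; _-_; -_; _*_; _/_; _≤_; _<_; ∣_∣; 1/_)
  open Arithmetic
  open LegendrePolynomials
  open TaylorSeries
  open LegendreCoefficients
  open LeibnizSeries

  0<w : ∀ n → 0ℚ < w n
  0<w zero    = 0<1
  0<w (suc n) = cancel-< (2ℚ * ι n + 2ℚ) (0<2ι+2 n) (subst₂ _<_ (sym (ℚP.*-zeroʳ (2ℚ * ι n + 2ℚ)))
    (trans (sym (w-suc n)) (ℚP.*-comm (w (suc n)) (2ℚ * ι n + 2ℚ))) (pos* (0<2ι+1 n) (0<w n)))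

  null-zero : Null (λ _ → 0ℚ)
  null-zero ε 0<ε = 0 , λ n h → ℚP.<⇒≤ 0<ε

  -- Stated relative to `A 0`, whose limit π/2 is not rational; the odd integrals are rational and
  -- need no such reference.
  A-even-limit : ∀ p → Null (λ M → A (double p) M - w p * A 0 M)
  A-even-limit zero    = null-cong (λ M → eq (A 0 M)) null-zero
    where
    eq : ∀ x → 0ℚ ≡ x - 1ℚ * x
    eq = solve-∀ ℚ-ring
  A-even-limit (suc p) = null-cong step (null-* r (null-+ (null-* (2ℚ * ι p + 1ℚ) (A-even-limit p))
      (null-* (- 1ℚ) (boundary-null (suc (double p))))))
    where
    r : ℚ
    r = 1ℚ ÷ (2ℚ * ι p + 2ℚ)
    step : ∀ M → r * ((2ℚ * ι p + 1ℚ) * (A (double p) M - w p * A 0 M)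
        + - 1ℚ * ((2ℚ * ι M + 1ℚ) * (bin M (suc (double p)) * e M))) ≡ A (double (suc p)) M - w (suc p) * A 0 M
    step M = cancelˡ (2ℚ * ι p + 2ℚ) (0<⇒≢ (0<2ι+2 p))
      (by₂ R (- 1ℚ) (÷-*⁺ 1ℚ (0<2ι+2 p)) (A-suc-suc (double p) M)
        (by₂ (A (double (suc p)) M - A (double p) M) (A 0 M) (ι-double p) (w-suc p)
          (eq (ι p) r (A (double p) M) (A (double (suc p)) M) (A 0 M) (w p) (w (suc p)) ((2ℚ * ι M
            + 1ℚ) * (bin M (suc (double p)) * e M)) (ι (double p)))))
      where
      R : ℚ
      R = (2ℚ * ι p + 1ℚ) * (A (double p) M - w p * A 0 M) + - 1ℚ * ((2ℚ * ι M + 1ℚ) * (bin M (suc (double p)) * e M))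
      eq : ∀ p r x x₂ x₀ u u′ b δ → (2ℚ * p + 2ℚ) * (r * ((2ℚ * p + 1ℚ) * (x - u * x₀) + - 1ℚ * b)) ≡
        (2ℚ * p + 2ℚ) * (x₂ - u′ * x₀)
        + ((2ℚ * p + 1ℚ) * (x - u * x₀) + - 1ℚ * b) * (r * (2ℚ * p + 2ℚ) - 1ℚ)
        + - 1ℚ * ((δ + 2ℚ) * x₂ - ((δ + 1ℚ) * x - b))
        + (x₂ - x) * (δ - 2ℚ * p)
        + x₀ * (u′ * (2ℚ * p + 2ℚ) - (2ℚ * p + 1ℚ) * u)
      eq = solve-∀ ℚ-ring

  -- The integral of cos²ᵖ⁺¹ over [0, π/2], usually written (2p)!!/(2p + 1)!!. In this form its
  -- quotient by w (p + 1), the factor of the next even integral, displays `W p`.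
  v : ℕ → ℚ
  v p = 2ℚ * W p * w (suc p)

  v-suc : ∀ p → (2ℚ * ι p + 3ℚ) * v (suc p) ≡ (2ℚ * ι p + 2ℚ) * v p
  v-suc p = cancelˡ (d * (2ℚ * ι p + 4ℚ)) (0<⇒≢ (pos* (0<2ι+3 p) (0<2ι+4 p)))
    (by₂ (2ℚ * (2ℚ * ι p + 4ℚ) * w (suc (suc p))) (2ℚ * ((2ℚ * ι p + 2ℚ) * (2ℚ * ι p + 4ℚ)) * W p)
      (W-suc p) (w-suc (suc p)) (eq (ι p) (W p) (W (suc p)) (w (suc p)) (w (suc (suc p)))))
    where
    d : ℚ
    d = 2ℚ * ι p + 3ℚ
    eq : ∀ p x x′ u u′ → (2ℚ * p + 3ℚ) * (2ℚ * p + 4ℚ) * ((2ℚ * p + 3ℚ) * (2ℚ * x′ * u′)) ≡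
      (2ℚ * p + 3ℚ) * (2ℚ * p + 4ℚ) * ((2ℚ * p + 2ℚ) * (2ℚ * x * u))
      + 2ℚ * (2ℚ * p + 4ℚ) * u′ * (x′ * ((2ℚ * p + 3ℚ) * (2ℚ * p + 3ℚ)) - (2ℚ * p + 2ℚ) * (2ℚ * p + 4ℚ) * x)
      + 2ℚ * ((2ℚ * p + 2ℚ) * (2ℚ * p + 4ℚ)) * x * (u′ * (2ℚ * (1ℚ + p) + 2ℚ) - (2ℚ * (1ℚ + p) + 1ℚ) * u)
    eq = solve-∀ ℚ-ring

  A-odd-limit : ∀ p → Null (λ M → A (suc (double p)) M - v p)
  A-odd-limit zero = null-cong (λ M →
    sym (by₁ 1ℚ (A-one M) (eq (A 1 M) (2ℚ * ι M + 1ℚ) (e M)))) (null-* (- 1ℚ) (boundary-null 0))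
    where
    eq : ∀ x k y → x - 1ℚ ≡ - 1ℚ * (k * (1ℚ * y)) + 1ℚ * (x - (1ℚ - k * y))
    eq = solve-∀ ℚ-ring
  A-odd-limit (suc p) = null-cong step (null-* r (null-+ (null-* (2ℚ * ι p + 2ℚ) (A-odd-limit p))
      (null-* (- 1ℚ) (boundary-null (suc (suc (double p)))))))
    where
    r : ℚ
    r = 1ℚ ÷ (2ℚ * ι p + 3ℚ)
    step : ∀ M → r * ((2ℚ * ι p + 2ℚ) * (A (suc (double p)) M - v p)
        + - 1ℚ * ((2ℚ * ι M + 1ℚ) * (bin M (suc (suc (double p))) * e M))) ≡ A (suc (double (suc p))) M - v (suc p)
    step M = cancelˡ (2ℚ * ι p + 3ℚ) (0<⇒≢ (0<2ι+3 p))
      (by₂ R (- 1ℚ) (÷-*⁺ 1ℚ (0<2ι+3 p)) (A-suc-suc (suc (double p)) M)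
        (by₂ (A (suc (double (suc p))) M - A (suc (double p)) M) 1ℚ (ι-double p) (v-suc p)
          (eq (ι p) r (A (suc (double p)) M) (A (suc (double (suc p))) M) (v p) (v (suc p)) ((2ℚ * ι M
            + 1ℚ) * (bin M (suc (suc (double p))) * e M)) (ι (double p)))))
      where
      R : ℚ
      R = (2ℚ * ι p + 2ℚ) * (A (suc (double p)) M - v p) + - 1ℚ * ((2ℚ * ι M
        + 1ℚ) * (bin M (suc (suc (double p))) * e M))
      eq : ∀ p r x x₂ u u′ b δ → (2ℚ * p + 3ℚ) * (r * ((2ℚ * p + 2ℚ) * (x - u) + - 1ℚ * b)) ≡
        (2ℚ * p + 3ℚ) * (x₂ - u′)
        + ((2ℚ * p + 2ℚ) * (x - u) + - 1ℚ * b) * (r * (2ℚ * p + 3ℚ) - 1ℚ)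
        + - 1ℚ * ((1ℚ + δ + 2ℚ) * x₂ - ((1ℚ + δ + 1ℚ) * x - b))
        + (x₂ - x) * (δ - 2ℚ * p)
        + 1ℚ * ((2ℚ * p + 3ℚ) * u′ - (2ℚ * p + 2ℚ) * u)
      eq = solve-∀ ℚ-ring

  -- The partial sums of Leibniz's series for π/4.
  quarter : ℕ → ℚ
  quarter = alternating (D 0)

  ∣quarter∣≤1 : ∀ J → ∣ quarter J ∣ ≤ 1ℚ
  ∣quarter∣≤1 J = ∣nonNeg∣≤ (proj₁ bounds) (ℚP.≤-trans (proj₂ bounds) (ℚP.≤-reflexive (ρ-zero 0)))
    where
    bounds : 0ℚ ≤ quarter J × quarter J ≤ D 0 0
    bounds = alternating-bounds (D 0) J (0≤D 0) (D-antitoneʳ 0)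

  ½^-rate : ∀ n → ½ ^ n * ι (suc n) ≤ 1ℚ
  ½^-rate zero    = ℚP.≤-refl
  ½^-rate (suc n) = ℚP.≤-trans (≤-by (½ * (½ ^ n * ι n)) (nonNeg* {½} (0≤/ 1 1) (nonNeg* (0≤½^ n) (0≤ι n)))
      (eq (½ ^ n) (ι n))) (½^-rate n)
    where
    eq : ∀ p n → p * (1ℚ + n) ≡ ½ * p * (1ℚ + (1ℚ + n)) + ½ * (p * n)
    eq = solve-∀ ℚ-ring

  D₀-rate : ∀ j → D 0 j * ι (suc j) ≤ 1ℚ
  D₀-rate j = ≤-by (D 0 j * ι j) (nonNeg* (0≤D 0 j) (0≤ι j)) (by₁ (- 1ℚ) (β-zero j) (eq (D 0 j) (ι j)))
    where
    eq : ∀ d j → 1ℚ ≡ d * (1ℚ + j) + d * j + - 1ℚ * (d * (2ℚ * j + 1ℚ) - 1ℚ)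
    eq = solve-∀ ℚ-ring

  -- `euler-close` with as many Euler steps as terms, so that both error terms tend to 0 together.
  quarter-A : Null (λ J → quarter J - ½ * A 0 J)
  quarter-A = null-squeeze {λ J → quarter J - ½ * A 0 J} {λ J → ½ ^ J + D 0 J}
    (λ J → subst (λ z → ∣ quarter J - ½ * z ∣ ≤ ½ ^ J + D 0 J) (sym (A-zero J)) (euler-close J J))
    (null-+ {½ ^_} {D 0} (null-rate 1ℚ (λ n → subst (λ z →
      z * ι (suc n) ≤ 1ℚ) (sym (ℚP.0≤p⇒∣p∣≡p (0≤½^ n))) (½^-rate n)))
            (null-rate 1ℚ (λ n → subst (λ z → z * ι (suc n) ≤ 1ℚ) (sym (ℚP.0≤p⇒∣p∣≡p (0≤D 0 n))) (D₀-rate n))))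

  -- In the limit A (2p + 2) ≤ A (2p + 1) reads w (p + 1) π/2 ≤ 2 W p w (p + 1). The null sequence
  -- `t` collects the errors at finite J.
  quarter≤W : ∀ p → ∃ λ t → Null t × (∀ J → quarter J ≤ W p + t J)
  quarter≤W p = t , null-+ quarter-A (null-* ½ (null-* c (null-+ (A-odd-limit p) (null-* (- 1ℚ) (A-even-limit
    (suc p)))))) , bound
    where
    c : ℚ
    c = 1ℚ ÷ w (suc p)
    t : ℕ → ℚ
    t J = (quarter J - ½ * A 0 J) + ½ * (c * ((A (suc (double p)) J - v p)
      + - 1ℚ * (A (double (suc p)) J - w (suc p) * A 0 J)))
    bound : ∀ J → quarter J ≤ W p + t J
    bound J = cancel-≤ (2ℚ * w (suc p)) (0<2* (0<w (suc p)))
      (≤-by (A (suc (double p)) J - A (double (suc p)) J) (≤⇒0≤- (A-antitone (suc (double p)) J))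
        (by₁ (A (suc (double p)) J - v p + - 1ℚ * (A (double (suc p)) J - w (suc p) * A 0 J)) (÷-*⁺ 1ℚ (0<w (suc p)))
          (eq (quarter J) (W p) (w (suc p)) c (A (suc (double p)) J) (A (double (suc p)) J) (A 0 J))))
      where
      eq : ∀ q x u c a₁ a₂ a₀ → 2ℚ * u * (x + ((q - ½ * a₀) + ½ * (c * (a₁ - 2ℚ * x * u + - 1ℚ * (a₂ - u * a₀))))) ≡
        2ℚ * u * q + (a₁ - a₂) + (a₁ - 2ℚ * x * u + - 1ℚ * (a₂ - u * a₀)) * (c * u - 1ℚ)
      eq = solve-∀ ℚ-ring

  -- The same with A (2p + 3) ≤ A (2p + 2). The quotient of v (p + 1) by v p is 1 - 1/(2p + 3),
  -- which costs the extra summand since W p ≤ 1.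
  W≤quarter : ∀ p → ∃ λ t → Null t × (∀ J → W p ≤ quarter J + 1ℚ ÷ (2ℚ * ι p + 3ℚ) + t J)
  W≤quarter p = t , null-+ (null-* (- 1ℚ) quarter-A) (null-* ½ (null-* c (null-+ (A-even-limit (suc p)) (null-*
    (- 1ℚ) (A-odd-limit (suc p)))))) , bound
    where
    c η d : ℚ
    c = 1ℚ ÷ w (suc p)
    d = 2ℚ * ι p + 3ℚ
    η = 1ℚ ÷ d
    t : ℕ → ℚ
    t J = - 1ℚ * (quarter J - ½ * A 0 J) + ½ * (c * ((A (double (suc p)) J - w (suc p) * A 0 J)
      + - 1ℚ * (A (suc (double (suc p))) J - v (suc p))))
    bound : ∀ J → W p ≤ quarter J + η + t J
    bound J = cancel-≤ (d * (2ℚ * w (suc p))) (pos* (0<2ι+3 p) (0<2* (0<w (suc p))))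
      (≤-by (d * (A (double (suc p)) J - A (suc (double (suc p))) J) + 2ℚ * w (suc p) * (1ℚ - W p))
        (0≤+ (nonNeg* (ℚP.<⇒≤ (0<2ι+3 p)) (≤⇒0≤- (A-antitone (double (suc p)) J)))
             (nonNeg* (0≤2* (0≤w (suc p))) (≤⇒0≤- (W≤1 p))))
        (by₃ (d * (A (double (suc p)) J - w (suc p) * A 0 J + - 1ℚ * (A (suc (double (suc p))) J - v (suc p))))
          (2ℚ * w (suc p)) 1ℚ (÷-*⁺ 1ℚ (0<w (suc p))) (÷-*⁺ 1ℚ (0<2ι+3 p)) (v-suc p)
          (eq (quarter J) (W p) (w (suc p)) c (ι p) η (A (double (suc p)) J) (A (suc (double (suc p))) J) (A 0 J) (v
            (suc p)))))
      where
      eq : ∀ q x u c p η a₂ a₃ a₀ v′ →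
        (2ℚ * p + 3ℚ) * (2ℚ * u) * (q + η + (- 1ℚ * (q - ½ * a₀) + ½ * (c * (a₂ - u * a₀ + - 1ℚ * (a₃ - v′))))) ≡
        (2ℚ * p + 3ℚ) * (2ℚ * u) * x + ((2ℚ * p + 3ℚ) * (a₂ - a₃) + 2ℚ * u * (1ℚ - x))
        + (2ℚ * p + 3ℚ) * (a₂ - u * a₀ + - 1ℚ * (a₃ - v′)) * (c * u - 1ℚ)
        + 2ℚ * u * (η * (2ℚ * p + 3ℚ) - 1ℚ)
        + 1ℚ * ((2ℚ * p + 3ℚ) * v′ - (2ℚ * p + 2ℚ) * (2ℚ * x * u))
      eq = solve-∀ ℚ-ring

  V-monotone : ∀ i p → V p ≤ V (i ℕ.+ p)
  V-monotone zero    p = ℚP.≤-refl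
  V-monotone (suc i) p = ℚP.≤-trans (V-monotone i p) (cancel-≤ n (pos* (0<2ι+2 k) (0<2ι+4 k))
      (≤-by (V k) (0≤V k) (by₁ 1ℚ (V-suc k) (eq (ι k) (V k) (V (suc k))))))
    where
    k : ℕ
    k = i ℕ.+ p
    n : ℚ
    n = (2ℚ * ι k + 2ℚ) * (2ℚ * ι k + 4ℚ)
    eq : ∀ k x y → (2ℚ * k + 2ℚ) * (2ℚ * k + 4ℚ) * y ≡ (2ℚ * k + 2ℚ) * (2ℚ * k + 4ℚ) * x + x
      + 1ℚ * (y * ((2ℚ * k + 2ℚ) * (2ℚ * k + 4ℚ)) - (2ℚ * k + 3ℚ) * (2ℚ * k + 3ℚ) * x)
    eq = solve-∀ ℚ-ring

  -- V k (2k + 3) / (2k + 2) decreases, with the denominators cleared.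
  V-scaled-antitone : ∀ i p →
    V (i ℕ.+ p) * (2ℚ * ι (i ℕ.+ p) + 3ℚ) * (2ℚ * ι p + 2ℚ) ≤ V p * (2ℚ * ι p + 3ℚ) * (2ℚ * ι (i ℕ.+ p) + 2ℚ)
  V-scaled-antitone zero    p = ℚP.≤-refl
  V-scaled-antitone (suc i) p = cancel-≤ n (pos* (0<2ι+2 k) (0<2ι+4 k))
    (≤-by (((2ℚ * κ + 3ℚ) * (2ℚ * κ + 5ℚ)) * (V p * (2ℚ * ι p + 3ℚ) * (2ℚ * κ + 2ℚ) - V k * (2ℚ * κ
      + 3ℚ) * (2ℚ * ι p + 2ℚ))
        + V p * (2ℚ * ι p + 3ℚ) * (2ℚ * κ + 2ℚ))
      (0≤+ (nonNeg* (nonNeg* (ℚP.<⇒≤ (0<2ι+3 k)) (0≤+ (0≤2ι k) (0≤/ 5 0))) (≤⇒0≤- (V-scaled-antitone i p)))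
           (nonNeg* (nonNeg* (0≤V p) (ℚP.<⇒≤ (0<2ι+3 p))) (ℚP.<⇒≤ (0<2ι+2 k))))
      (by₁ (- ((2ℚ * κ + 5ℚ) * (2ℚ * ι p + 2ℚ))) (V-suc k) (eq κ (ι p) (V p) (V k) (V (suc k)))))
    where
    k : ℕ
    k = i ℕ.+ p
    κ n : ℚ
    κ = ι k
    n = (2ℚ * κ + 2ℚ) * (2ℚ * κ + 4ℚ)
    eq : ∀ k p x₀ x y → (2ℚ * k + 2ℚ) * (2ℚ * k + 4ℚ) * (x₀ * (2ℚ * p + 3ℚ) * (2ℚ * (1ℚ + k) + 2ℚ)) ≡
      (2ℚ * k + 2ℚ) * (2ℚ * k + 4ℚ) * (y * (2ℚ * (1ℚ + k) + 3ℚ) * (2ℚ * p + 2ℚ))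
      + ((2ℚ * k + 3ℚ) * (2ℚ * k + 5ℚ) * (x₀ * (2ℚ * p + 3ℚ) * (2ℚ * k + 2ℚ) - x * (2ℚ * k + 3ℚ) * (2ℚ * p + 2ℚ))
        + x₀ * (2ℚ * p + 3ℚ) * (2ℚ * k + 2ℚ))
      + - ((2ℚ * k + 5ℚ) * (2ℚ * p + 2ℚ)) * (y * ((2ℚ * k + 2ℚ) * (2ℚ * k + 4ℚ)) - (2ℚ * k + 3ℚ) * (2ℚ * k + 3ℚ) * x)
    eq = solve-∀ ℚ-ring

  -- Follows from `V-scaled-antitone` because (2k + 3) / (2k + 2) exceeds 1. It gives V the explicit
  -- modulus of convergence in `V-close`.
  V-growth : ∀ i p → V (i ℕ.+ p) * (2ℚ * ι p + 2ℚ) ≤ V p * (2ℚ * ι p + 3ℚ)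
  V-growth i p = cancel-≤ (2ℚ * κ + 2ℚ) (0<2ι+2 k)
    (≤-by (V p * (2ℚ * ι p + 3ℚ) * (2ℚ * κ + 2ℚ) - V k * (2ℚ * κ + 3ℚ) * (2ℚ * ι p + 2ℚ) + V k * (2ℚ * ι p + 2ℚ))
      (0≤+ (≤⇒0≤- (V-scaled-antitone i p)) (nonNeg* (0≤V k) (ℚP.<⇒≤ (0<2ι+2 p))))
      (eq κ (ι p) (V p) (V k)))
    where
    k : ℕ
    k = i ℕ.+ p
    κ : ℚ
    κ = ι k
    eq : ∀ k p x₀ x → (2ℚ * k + 2ℚ) * (x₀ * (2ℚ * p + 3ℚ)) ≡ (2ℚ * k + 2ℚ) * (x * (2ℚ * p + 2ℚ))
      + (x₀ * (2ℚ * p + 3ℚ) * (2ℚ * k + 2ℚ) - x * (2ℚ * k + 3ℚ) * (2ℚ * p + 2ℚ) + x * (2ℚ * p + 2ℚ))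
    eq = solve-∀ ℚ-ring

  V≤2 : ∀ p → V p ≤ 2ℚ
  V≤2 p = cancel-≤ 2ℚ (ℚP.positive⁻¹ 2ℚ) (ℚP.≤-trans
    (subst (_≤ 3ℚ) (trans (cong (λ k → V k * 2ℚ) (ℕP.+-identityʳ p)) (ℚP.*-comm (V p) 2ℚ)) (V-growth p 0))
    (≤-by 1ℚ 0≤1 refl))

  ∣V∣≤2 : ∀ p → ∣ V p ∣ ≤ 2ℚ
  ∣V∣≤2 p = ∣nonNeg∣≤ (0≤V p) (V≤2 p)

  V-close : ∀ {p k} → p ℕ.≤ k → ∣ V k - V p ∣ ≤ 1ℚ ÷ ι (suc p)
  V-close {p} {k} p≤k = subst (λ k → ∣ V k - V p ∣ ≤ 1ℚ ÷ ι (suc p)) (ℕP.m∸n+n≡m p≤k)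
    (∣nonNeg∣≤ (≤⇒0≤- (V-monotone i p)) (cancel-≤ (2ℚ * ι (suc p)) (0<2* (0<ι p))
      (≤-by (V p * (2ℚ * ι p + 3ℚ) - V (i ℕ.+ p) * (2ℚ * ι p + 2ℚ) + (2ℚ - V p))
        (0≤+ (≤⇒0≤- (V-growth i p)) (≤⇒0≤- (V≤2 p)))
        (by₁ 2ℚ (÷-*⁺ 1ℚ (0<ι p)) (eq (ι p) (V p) (V (i ℕ.+ p)) (1ℚ ÷ ι (suc p)))))))
    where
    i : ℕ
    i = k ℕ.∸ p
    eq : ∀ p x y r → 2ℚ * (1ℚ + p) * r ≡ 2ℚ * (1ℚ + p) * (y - x) + (x * (2ℚ * p + 3ℚ) - y * (2ℚ * p + 2ℚ) + (2ℚ - x))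
      + 2ℚ * (r * (1ℚ + p) - 1ℚ)
    eq = solve-∀ ℚ-ring

  private
    -- The index p is fixed first and J afterwards. As W p V p = 1, the error is q (V J - V p) + (q
    -- - W p) V p with q = `quarter J`; the parts are at most r and 2 (r + ε/4), where r = 1/(p +
    -- 1).
    quarter*V-bound : ∀ p ε → 5ℚ * (1ℚ ÷ ι (suc p)) ≤ ε * ½ → (t t′ : ℕ → ℚ) →
      (∀ J → quarter J ≤ W p + t J) → (∀ J → W p ≤ quarter J + 1ℚ ÷ (2ℚ * ι p + 3ℚ) + t′ J) →
      ∀ J → p ℕ.≤ J → ∣ 2ℚ * t J ∣ ≤ ε * ½ → ∣ 2ℚ * t′ J ∣ ≤ ε * ½ → ∣ quarter J * V J - 1ℚ ∣ ≤ ε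
    quarter*V-bound p ε 5r≤ t t′ h h′ = bound
      where
      r : ℚ
      r = 1ℚ ÷ ι (suc p)
      0≤r : 0ℚ ≤ r
      0≤r = 0≤÷ 0≤1 (0<ι p)
      η≤r : 1ℚ ÷ (2ℚ * ι p + 3ℚ) ≤ r
      η≤r = ÷≤ (0<2ι+3 p) (≤-by (r * (ι p + 2ℚ)) (nonNeg* 0≤r (0≤+ (0≤ι p) (0≤/ 2 0)))
          (by₁ 1ℚ (÷-*⁺ 1ℚ (0<ι p)) (eq (ι p) r)))
        where
        eq : ∀ p r → r * (2ℚ * p + 3ℚ) ≡ 1ℚ + r * (p + 2ℚ) + 1ℚ * (r * (1ℚ + p) - 1ℚ)
        eq = solve-∀ ℚ-ring
      bound : ∀ J → p ℕ.≤ J → ∣ 2ℚ * t J ∣ ≤ ε * ½ → ∣ 2ℚ * t′ J ∣ ≤ ε * ½ → ∣ quarter J * V J - 1ℚ ∣ ≤ ε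
      bound J p≤J tJ t′J = subst₂ _≤_ (cong ∣_∣ rewriting) (eq₁ ε)
          (ℚP.≤-trans (∣+∣≤ {quarter J * (V J - V p)} {(quarter J - W p) * V p}
              (∣*∣≤ {quarter J} {V J - V p} (∣quarter∣≤1 J) (V-close p≤J))
              (∣*∣≤ {quarter J - W p} {V p} close (∣V∣≤2 p)))
            (≤-by (ε * ½ - 5ℚ * r + 2ℚ * r) (0≤+ (≤⇒0≤- 5r≤) (0≤2* 0≤r)) (eq₃ ε r)))
        where
        eq : ∀ q x y z → q * (x - y) + (q - z) * y ≡ q * x - 1ℚ + - 1ℚ * (z * y - 1ℚ)
        eq = solve-∀ ℚ-ring
        rewriting : quarter J * (V J - V p) + (quarter J - W p) * V p ≡ quarter J * V J - 1ℚ
        rewriting = by₁ (- 1ℚ) (W*V p) (eq (quarter J) (V J) (V p) (W p))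
        eq₁ : ∀ ε → ε * ½ + ε * ½ ≡ ε
        eq₁ = half+half
        eq₃ : ∀ ε r → ε * ½ + ε * ½ ≡ 1ℚ * r + (r + ε * ½ * ½) * 2ℚ + (ε * ½ - 5ℚ * r + 2ℚ * r)
        eq₃ = solve-∀ ℚ-ring
        half : ∀ {x} → ∣ 2ℚ * x ∣ ≤ ε * ½ → x ≤ ε * ½ * ½
        half {x} hx = cancel-≤ 2ℚ (ℚP.positive⁻¹ 2ℚ) (ℚP.≤-trans (p≤∣p∣ (2ℚ * x)) (ℚP.≤-trans hx (ℚP.≤-reflexive
          (eq₂ ε))))
          where
          eq₂ : ∀ ε → ε * ½ ≡ 2ℚ * (ε * ½ * ½)
          eq₂ = solve-∀ ℚ-ring
        close : ∣ quarter J - W p ∣ ≤ r + ε * ½ * ½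
        close = ∣∣≤-intro
          (≤-by (W p + t J - quarter J + (ε * ½ * ½ - t J) + r) (0≤+ (0≤+ (≤⇒0≤- (h J)) (≤⇒0≤- (half {t J} tJ))) 0≤r)
            (eq₄ (quarter J) (W p) r (ε * ½ * ½) (t J)))
          (≤-by (quarter J + 1ℚ ÷ (2ℚ * ι p + 3ℚ) + t′ J - W p + (ε * ½ * ½ - t′ J) + (r - 1ℚ ÷ (2ℚ * ι p + 3ℚ)))
            (0≤+ (0≤+ (≤⇒0≤- (h′ J)) (≤⇒0≤- (half {t′ J} t′J))) (≤⇒0≤- η≤r))
            (eq₅ (quarter J) (W p) r (ε * ½ * ½) (t′ J) (1ℚ ÷ (2ℚ * ι p + 3ℚ))))
          where
          eq₄ : ∀ q x r δ t → r + δ ≡ q - x + (x + t - q + (δ - t) + r)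
          eq₄ = solve-∀ ℚ-ring
          eq₅ : ∀ q x r δ t η → r + δ ≡ - (q - x) + (q + η + t - x + (δ - t) + (r - η))
          eq₅ = solve-∀ ℚ-ring

  quarter*V : Null (λ J → quarter J * V J - 1ℚ)
  quarter*V ε 0<ε = combine (null-* 5ℚ null-recip (ε * ½) (half>0 0<ε))
    where
    combine : (∃ λ N → ∀ n → N ℕ.≤ n → ∣ 5ℚ * (1ℚ ÷ ι (suc n)) ∣ ≤ ε * ½) →
              ∃ λ N → ∀ J → N ℕ.≤ J → ∣ quarter J * V J - 1ℚ ∣ ≤ ε
    combine (p , f) = combine₂ (quarter≤W p) (W≤quarter p)
      where
      combine₂ : (∃ λ (t : ℕ → ℚ) → Null t × (∀ J → quarter J ≤ W p + t J)) →
                 (∃ λ (t : ℕ → ℚ) → Null t × (∀ J → W p ≤ quarter J + 1ℚ ÷ (2ℚ * ι p + 3ℚ) + t J)) →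
                 ∃ λ N → ∀ J → N ℕ.≤ J → ∣ quarter J * V J - 1ℚ ∣ ≤ ε
      combine₂ (t , tn , h) (t′ , tn′ , h′) = combine₃ (null-* 2ℚ tn (ε * ½) (half>0 0<ε)) (null-* 2ℚ tn′ (ε * ½)
        (half>0 0<ε))
        where
        combine₃ : (∃ λ N → ∀ n → N ℕ.≤ n → ∣ 2ℚ * t n ∣ ≤ ε * ½) → (∃ λ N → ∀ n → N ℕ.≤ n → ∣ 2ℚ * t′ n ∣ ≤ ε * ½) →
                   ∃ λ N → ∀ J → N ℕ.≤ J → ∣ quarter J * V J - 1ℚ ∣ ≤ ε
        combine₃ (N , g) (N′ , g′) = p ℕ.⊔ (N ℕ.⊔ N′) , λ J hJ →
          quarter*V-bound p ε (ℚP.≤-trans (p≤∣p∣ (5ℚ * (1ℚ ÷ ι (suc p)))) (f p ℕP.≤-refl)) t t′ h h′ J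
            (ℕP.m⊔n≤o⇒m≤o p (N ℕ.⊔ N′) hJ)
            (g J (ℕP.m⊔n≤o⇒m≤o N N′ (ℕP.m⊔n≤o⇒n≤o p (N ℕ.⊔ N′) hJ)))
            (g′ J (ℕP.m⊔n≤o⇒n≤o N N′ (ℕP.m⊔n≤o⇒n≤o p (N ℕ.⊔ N′) hJ)))

-- The coefficients of the theorem and multiplication by 1 - y².

module SeriesCoefficients where

  open import Data.Rational.Base using (_+_; _-_; -_; _*_; _/_; _≤_; _<_; ∣_∣; 1/_)
  open Arithmetic
  open import Data.Nat.Combinatorics using (_C_; nCk+nC[k+1]≡[n+1]C[k+1])
  open import Data.Nat.DivMod using () renaming (_/_ to _div_)
  import Data.Nat.DivMod as ℕD
  open import Defs using (rising; ½-n+i≢0; centralRatio; coefficient; denominator; denominator-nonZero)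
  open LegendrePolynomials
  open TaylorSeries
  open LegendreCoefficients
  open LeibnizSeries

  C≡bin : ∀ m n → ι (m C n) ≡ bin m n
  C≡bin m       zero    = refl
  C≡bin zero    (suc n) = refl
  C≡bin (suc m) (suc n) = trans (cong ι (sym (nCk+nC[k+1]≡[n+1]C[k+1] m n)))
    (trans (ι-+ (m C n) (m C suc n)) (trans (cong₂ _+_ (C≡bin m n) (C≡bin m (suc n))) (ℚP.+-comm (bin m n) (bin m
      (suc n)))))

  central-suc : ∀ n → (ι n + 1ℚ) * bin (double (suc n)) (suc n) ≡ 2ℚ * (2ℚ * ι n + 1ℚ) * bin (double n) n
  central-suc n = by₃ 1ℚ (- 2ℚ) (2ℚ * c - c₁) (bin-suc (suc (double n)) n) (bin-suc (double n) n) (ι-double n)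
      (eq (ι n) (ι (double n)) c b₁ c₁)
    where
    c b₁ c₁ : ℚ
    c  = bin (double n) n
    b₁ = bin (double n) (suc n)
    c₁ = bin (suc (double n)) n
    eq : ∀ n δ c b₁ c₁ → (n + 1ℚ) * (b₁ + c + c₁) ≡ 2ℚ * (2ℚ * n + 1ℚ) * c
      + 1ℚ * ((1ℚ + δ - n) * c₁ - (n + 1ℚ) * (b₁ + c))
      + - 2ℚ * ((δ - n) * c - (n + 1ℚ) * b₁)
      + (2ℚ * c - c₁) * (δ - 2ℚ * n)
    eq = solve-∀ ℚ-ring

  /-*ι′ : ∀ a d .{{_ : ℕ.NonZero d}} → + a / d * ι d ≡ ι a
  /-*ι′ a zero    = contradiction refl (ℕ.≢-nonZero⁻¹ 0)
  /-*ι′ a (suc d) = /-*ι a d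

  0<ι′ : ∀ d .{{_ : ℕ.NonZero d}} → 0ℚ < ι d
  0<ι′ zero    = contradiction refl (ℕ.≢-nonZero⁻¹ 0)
  0<ι′ (suc d) = 0<ι d

  w*4^ : ∀ n → w n * ι (4 ℕ.^ n) ≡ bin (double n) n
  w*4^ zero    = refl
  w*4^ (suc n) = cancelˡ (2ℚ * ι n + 2ℚ) (0<⇒≢ (0<2ι+2 n))
    (by₂ (4ℚ * ι (4 ℕ.^ n)) ((2ℚ * ι n + 2ℚ) * w (suc n)) (w-suc n) (ι-* 4 (4 ℕ.^ n))
      (by₂ (4ℚ * (2ℚ * ι n + 1ℚ)) (- 2ℚ) (w*4^ n) (central-suc n)
        (eq (ι n) (w n) (w (suc n)) (ι (4 ℕ.^ n)) (ι (4 ℕ.^ suc n)) (bin (double n) n) (bin (double (suc n)) (suc n)))))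
    where
    eq : ∀ n u u′ p p′ c c′ → (2ℚ * n + 2ℚ) * (u′ * p′) ≡ (2ℚ * n + 2ℚ) * c′
      + 4ℚ * p * (u′ * (2ℚ * n + 2ℚ) - (2ℚ * n + 1ℚ) * u)
      + (2ℚ * n + 2ℚ) * u′ * (p′ - 4ℚ * p)
      + 4ℚ * (2ℚ * n + 1ℚ) * (u * p - c)
      + - 2ℚ * ((n + 1ℚ) * c′ - 2ℚ * (2ℚ * n + 1ℚ) * c)
    eq = solve-∀ ℚ-ring

  centralRatio≡w : ∀ n → centralRatio n ≡ w n
  centralRatio≡w n = cancelˡ (ι (4 ℕ.^ n)) (0<⇒≢ (0<ι′ (4 ℕ.^ n) {{ℕP.m^n≢0 4 n}}))
    (trans (ℚP.*-comm (ι (4 ℕ.^ n)) (centralRatio n)) (trans (/-*ι′ ((2 ℕ.* n) C n) (4 ℕ.^ n) {{ℕP.m^n≢0 4 n}})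
      (trans (C≡bin (2 ℕ.* n) n) (trans (cong (λ m → bin m n) (2*≡double n))
        (trans (sym (w*4^ n)) (ℚP.*-comm (w n) (ι (4 ℕ.^ n))))))))

  rising-suc : ∀ x j → rising x (suc j) ≡ rising x j * (x + ι j)
  rising-suc x j = cong (λ z → rising x j * (x + z)) (/1≡ι j)

  rising-shift : ∀ x j → rising (x + 1ℚ) j * x ≡ rising x j * (x + ι j)
  rising-shift x zero    = cong (1ℚ *_) (sym (ℚP.+-identityʳ x))
  rising-shift x (suc j) = by₃ x (- (x + ι (suc j))) (x + 1ℚ + ι j) (rising-suc (x
    + 1ℚ) j) (rising-suc x j) (rising-shift x j)
    (eq x (ι j) (rising x j) (rising x (suc j)) (rising (x + 1ℚ) j) (rising (x + 1ℚ) (suc j)))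
    where
    eq : ∀ x j r r₁ s s₁ → s₁ * x ≡ r₁ * (x + (1ℚ + j)) + x * (s₁ - s * (x + 1ℚ + j))
      + - (x + (1ℚ + j)) * (r₁ - r * (x + j)) + (x + 1ℚ + j) * (s * x - r * (x + j))
    eq = solve-∀ ℚ-ring

  den : ℕ → ℕ → ℚ
  den j n = rising (ι n + 1ℚ) j * rising (½ - ι n) j

  half-odd : ∀ j → (suc (double j) ℕ.+ 1) div 2 ≡ suc j
  half-odd j = trans (cong (_div 2) (trans (ℕP.+-comm (suc (double j)) 1) (trans (cong (λ m →
    suc (suc m)) (sym (2*≡double j)))
    (trans (sym (cong suc (ℕP.+-suc j (j ℕ.+ 0)))) (ℕP.*-comm 2 (suc j)))))) (ℕD.m*n/n≡m (suc j) 2)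

  denominator≡den : ∀ j n → denominator (suc (double j)) n ≡ den (suc j) n
  denominator≡den j n = trans (cong (λ i → rising (+ (n ℕ.+ 1) / 1) i * rising (½ - + n / 1) i) (half-odd j))
    (cong₂ (λ x y → rising x (suc j) * rising (½ - y) (suc j)) (trans (/1≡ι (n ℕ.+ 1)) (ι-+ n 1)) (/1≡ι n))

  nonZero⇒≢ : ∀ p → NonZero p → p ≢ 0ℚ
  nonZero⇒≢ .0ℚ record { nonZero = () } refl

  den≢0 : ∀ j n → den (suc j) n ≢ 0ℚ
  den≢0 j n eq = nonZero⇒≢ (denominator (suc (double j)) n) (denominator-nonZero (suc (double j)) n)
    (trans (denominator≡den j n) eq)

  den-sucʲ : ∀ j n → den (suc j) n ≡ den j n * ((ι n + 1ℚ + ι j) * (½ - ι n + ι j))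
  den-sucʲ j n = trans (cong₂ _*_ (rising-suc (ι n + 1ℚ) j) (rising-suc (½ - ι n) j))
    (eq (rising (ι n + 1ℚ) j) (rising (½ - ι n) j) (ι n + 1ℚ + ι j) (½ - ι n + ι j))
    where
    eq : ∀ r s x y → r * x * (s * y) ≡ r * s * (x * y)
    eq = solve-∀ ℚ-ring

  den-sucʳ : ∀ j n → den j (suc n) * ((ι n + 1ℚ) * (ι j - ½ - ι n)) ≡ den j n * ((ι n + 1ℚ + ι j) * (- ½ - ι n))
  den-sucʳ j n = trans (cong (λ x →
    rising x j * rising (½ - ι (suc n)) j * ((ι n + 1ℚ) * (ι j - ½ - ι n))) (cong (_+ 1ℚ) (ℚP.+-comm 1ℚ (ι n))))
    (trans (cong (λ x → rising (ι n + 1ℚ + 1ℚ) j * rising x j * ((ι n + 1ℚ) * (ι j - ½ - ι n))) (eq₁ (ι n)))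
      (by₃ (rising y j * (ι j - ½ - ι n)) (- (rising (ι n + 1ℚ) j * (ι n + 1ℚ + ι j))) (rising (ι n + 1ℚ) j * (ι n
        + 1ℚ + ι j) * y)
        (rising-shift (ι n + 1ℚ) j) (rising-shift y j) (cong (λ x → rising x j) (eq₂ (ι n)))
        (eq (ι n) (ι j) (rising (ι n + 1ℚ) j) (rising (ι n + 1ℚ + 1ℚ) j) (rising y j) (rising (y
          + 1ℚ) j) (rising (½ - ι n) j))))
    where
    y : ℚ
    y = - ½ - ι n
    eq₁ : ∀ n → ½ - (1ℚ + n) ≡ - ½ - n
    eq₁ = solve-∀ ℚ-ring
    eq₂ : ∀ n → - ½ - n + 1ℚ ≡ ½ - n
    eq₂ = solve-∀ ℚ-ring
    eq : ∀ n j r r′ s s′ t → r′ * s * ((n + 1ℚ) * (j - ½ - n)) ≡ r * t * ((n + 1ℚ + j) * (- ½ - n))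
      + s * (j - ½ - n) * (r′ * (n + 1ℚ) - r * (n + 1ℚ + j))
      + - (r * (n + 1ℚ + j)) * (s′ * (- ½ - n) - s * (- ½ - n + j))
      + r * (n + 1ℚ + j) * (- ½ - n) * (s′ - t)
    eq = solve-∀ ℚ-ring

  -- coefficient (2j + 1) n / (4n + 1).
  γ : ℕ → ℕ → ℚ
  γ j n = w n * w n ÷ den (suc j) n

  γ*den : ∀ j n → γ j n * den (suc j) n ≡ w n * w n
  γ*den j n = ÷-* (w n * w n) (den≢0 j n)

  coefficient≡γ : ∀ j n → coefficient (suc (double j)) n ≡ (4ℚ * ι n + 1ℚ) * γ j n
  coefficient≡γ j n = cancelˡ (den (suc j) n) (den≢0 j n) (trans (ℚP.*-comm (den (suc j) n) c)
      (trans (cong (c *_) (sym (denominator≡den j n))) (trans (ℚP.*-assoc num (1/ d) d)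
        (trans (cong (num *_) (ℚP.*-inverseˡ d)) (trans (ℚP.*-identityʳ num)
          (trans (cong₂ (λ x y → x * (y * y)) 4n+1 (centralRatio≡w n))
            (by₁ (- (4ℚ * ι n + 1ℚ)) (γ*den j n) (eq (4ℚ * ι n + 1ℚ) (w n * w n) (γ j n) (den (suc j) n)))))))))
    where
    c num d : ℚ
    c = coefficient (suc (double j)) n
    num = + (4 ℕ.* n ℕ.+ 1) / 1 * (centralRatio n * centralRatio n)
    d = denominator (suc (double j)) n
    instance
      d≢0 : NonZero d
      d≢0 = denominator-nonZero (suc (double j)) n
    4n+1 : + (4 ℕ.* n ℕ.+ 1) / 1 ≡ 4ℚ * ι n + 1ℚ
    4n+1 = trans (/1≡ι (4 ℕ.* n ℕ.+ 1)) (trans (ι-+ (4 ℕ.* n) 1) (cong (_+ 1ℚ) (ι-* 4 n)))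
    eq : ∀ k u g d → k * u ≡ d * (k * g) + - k * (g * d - u)
    eq = solve-∀ ℚ-ring

  halfOdd≢0 : ∀ i n → ½ - ι n + ι i ≢ 0ℚ
  halfOdd≢0 i n eq = ½-n+i≢0 n i (trans (cong₂ (λ x y → ½ - x + y) (/1≡ι n) (/1≡ι i)) eq)

  0<n+j : ∀ n j → 0ℚ < ι n + (ι j + 2ℚ)
  0<n+j n j = 0<+ (0≤ι n) (0<+ (0≤ι j) (ℚP.positive⁻¹ 2ℚ))

  γ-sucʲ : ∀ j n → (ι n + (ι j + 2ℚ)) * (½ - ι n + ι (suc j)) * γ (suc j) n ≡ γ j n
  γ-sucʲ j n = cancelˡ (den (suc j) n) (den≢0 j n)
    (by₃ (- γ (suc j) n) 1ℚ (- 1ℚ) (den-sucʲ (suc j) n) (γ*den (suc j) n) (γ*den j n)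
      (eq (ι n) (ι j) (den (suc j) n) (den (suc (suc j)) n) (γ j n) (γ (suc j) n) (w n * w n)))
    where
    eq : ∀ n j d d′ g g′ u → d * ((n + (j + 2ℚ)) * (½ - n + (1ℚ + j)) * g′) ≡ d * g
      + - g′ * (d′ - d * ((n + 1ℚ + (1ℚ + j)) * (½ - n + (1ℚ + j)))) + 1ℚ * (g′ * d′ - u) + - 1ℚ * (g * d - u)
    eq = solve-∀ ℚ-ring

  γ-sucʳ : ∀ j n → 4ℚ * (ι n + 1ℚ) * (ι n + (ι j + 2ℚ)) * γ j (suc n) ≡
    (2ℚ * ι n + 1ℚ) * (2ℚ * ι n - 1ℚ - 2ℚ * ι j) * γ j n
  γ-sucʳ j n = cancelˡ (d * (- ½ - ν)) (λ eq → d*≢0 eq)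
    (by₂ (- (4ℚ * (ν + 1ℚ) * γ j (suc n))) ((2ℚ * ν + 2ℚ) * (2ℚ * ν + 2ℚ) * (ι j
      + ½ - ν)) (den-sucʳ (suc j) n) (γ*den j (suc n))
      (by₂ (((w (suc n) * (2ℚ * ν + 2ℚ)) + (2ℚ * ν + 1ℚ) * w n) * (ι j + ½ - ν)) ((2ℚ * ν + 1ℚ) * (2ℚ * ν
        + 1ℚ) * (- (ι j + ½ - ν))) (w-suc n) (γ*den j n)
        (eq ν (ι j) d (den (suc j) (suc n)) (γ j n) (γ j (suc n)) (w n) (w (suc n)))))
    where
    ν d : ℚ
    ν = ι n
    d = den (suc j) n
    d*≢0 : d * (- ½ - ν) ≢ 0ℚ
    d*≢0 h = den≢0 j n (cancelˡ (½ + ν) (0<⇒≢ (0<+′)) (by₁ (- 1ℚ) h (eq₀ ν d)))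
      where
      0<+′ : 0ℚ < ½ + ν
      0<+′ = pos+nonNeg (ℚP.positive⁻¹ ½) (0≤ι n)
      eq₀ : ∀ ν d → (½ + ν) * d ≡ (½ + ν) * 0ℚ + - 1ℚ * (d * (- ½ - ν) - 0ℚ)
      eq₀ = solve-∀ ℚ-ring
    eq : ∀ ν j d d′ g g′ u u′ → d * (- ½ - ν) * (4ℚ * (ν + 1ℚ) * (ν + (j + 2ℚ)) * g′) ≡
      d * (- ½ - ν) * ((2ℚ * ν + 1ℚ) * (2ℚ * ν - 1ℚ - 2ℚ * j) * g)
      + - (4ℚ * (ν + 1ℚ) * g′) * (d′ * ((ν + 1ℚ) * (1ℚ + j - ½ - ν)) - d * ((ν + 1ℚ + (1ℚ + j)) * (- ½ - ν)))
      + (2ℚ * ν + 2ℚ) * (2ℚ * ν + 2ℚ) * (j + ½ - ν) * (g′ * d′ - u′ * u′)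
      + (u′ * (2ℚ * ν + 2ℚ) + (2ℚ * ν + 1ℚ) * u) * (j + ½ - ν) * (u′ * (2ℚ * ν + 2ℚ) - (2ℚ * ν + 1ℚ) * u)
      + (2ℚ * ν + 1ℚ) * (2ℚ * ν + 1ℚ) * (- (j + ½ - ν)) * (g * d - u * u)
    eq = solve-∀ ℚ-ring

  γ₀≡g : ∀ n → γ 0 n ≡ g n
  γ₀≡g zero    = cancelˡ (den 1 0) (den≢0 0 0) (trans (ℚP.*-comm (den 1 0) (γ 0 0)) (γ*den 0 0))
  γ₀≡g (suc n) = cancelˡ (4ℚ * (ι n + 1ℚ) * (ι n + 2ℚ)) (0<⇒≢ (pos* {4ℚ * (ι n
    + 1ℚ)} (pos* {4ℚ} (ℚP.positive⁻¹ 4ℚ) (0<1ℚ+ι n)) (0<+ (0≤ι n) (ℚP.positive⁻¹ 2ℚ))))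
    (by₃ 1ℚ (- 1ℚ) (4ℚ * ι n * ι n - 1ℚ) (γ-sucʳ 0 n) (g-suc n) (γ₀≡g n) (eq (ι n) (γ 0 n) (γ 0 (suc n)) (g n) (g
      (suc n))))
    where
    eq : ∀ n x x′ y y′ → 4ℚ * (n + 1ℚ) * (n + 2ℚ) * x′ ≡ 4ℚ * (n + 1ℚ) * (n + 2ℚ) * y′
      + 1ℚ * (4ℚ * (n + 1ℚ) * (n + (0ℚ + 2ℚ)) * x′ - (2ℚ * n + 1ℚ) * (2ℚ * n - 1ℚ - 2ℚ * 0ℚ) * x)
      + - 1ℚ * (4ℚ * (n + 1ℚ) * (n + 2ℚ) * y′ - (4ℚ * n * n - 1ℚ) * y)
      + (4ℚ * n * n - 1ℚ) * (x - y)
    eq = solve-∀ ℚ-ring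

  -- Multiplication by y takes the coefficients (4n + 1) γ j n to (4n + 3) γₒ j n.
  γₒ : ℕ → ℕ → ℚ
  γₒ j n = (2ℚ * ι n + 1ℚ) * γ j n ÷ (2ℚ * (ι n + (ι j + 2ℚ)))

  private
    0<2[n+j] : ∀ n j → 0ℚ < 2ℚ * (ι n + (ι j + 2ℚ))
    0<2[n+j] n j = 0<2* (0<n+j n j)

  γₒ-def : ∀ j n → γₒ j n * (2ℚ * (ι n + (ι j + 2ℚ))) ≡ (2ℚ * ι n + 1ℚ) * γ j n
  γₒ-def j n = ÷-*⁺ _ (0<2[n+j] n j)

  γₒ≡ : ∀ j n → 2ℚ * γₒ j n ≡ (2ℚ * ι n + 1ℚ) * (½ - ι n + ι (suc j)) * γ (suc j) n
  γₒ≡ j n = cancelˡ (2ℚ * (ι n + (ι j + 2ℚ))) (0<⇒≢ (0<2[n+j] n j))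
    (by₂ 2ℚ (- (2ℚ * (2ℚ * ι n + 1ℚ))) (γₒ-def j n) (γ-sucʲ j n) (eq (ι n) (ι j) (γₒ j n) (γ j n) (γ (suc j) n)))
    where
    eq : ∀ n j o g g′ → 2ℚ * (n + (j + 2ℚ)) * (2ℚ * o) ≡ 2ℚ * (n + (j + 2ℚ)) * ((2ℚ * n + 1ℚ) * (½ - n + (1ℚ + j)) * g′)
      + 2ℚ * (o * (2ℚ * (n + (j + 2ℚ))) - (2ℚ * n + 1ℚ) * g)
      + - (2ℚ * (2ℚ * n + 1ℚ)) * ((n + (j + 2ℚ)) * (½ - n + (1ℚ + j)) * g′ - g)
    eq = solve-∀ ℚ-ring

  -- With `γₒ≡` and `γ-sucʲ` this turns every term of the odd-to-even rule at n + 1 into a multiple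
  -- of `γ (suc j) (suc n)`. The cancelled factor 1/2 - n + j is half an odd integer, so nonzero.
  γₒ-shift : ∀ j n → γₒ j n ≡ - ((ι n + 1ℚ) * (ι (suc n) + (ι j + 2ℚ)) * γ (suc j) (suc n))
  γₒ-shift j n = cancelˡ (X * d) (λ h →
    halfOdd≢0 j n (cancelˡ d (0<⇒≢ (0<2[n+j] n j)) (trans (ℚP.*-comm d X) (trans h (sym (ℚP.*-zeroʳ d))))))
    (by₃ X ½ (d * (ν + 1ℚ)) (γₒ-def j n) (γ-sucʳ j n) (γ-sucʲ j (suc n))
      (eq ν (ι j) (γₒ j n) (γ j n) (γ j (suc n)) (γ (suc j) (suc n))))
    where
    ν X d : ℚ
    ν = ι n
    X = ½ - ν + ι j
    d = 2ℚ * (ν + (ι j + 2ℚ))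
    eq : ∀ n j o g g₁ g′ → (½ - n + j) * (2ℚ * (n + (j + 2ℚ))) * o ≡
      (½ - n + j) * (2ℚ * (n + (j + 2ℚ))) * - ((n + 1ℚ) * (1ℚ + n + (j + 2ℚ)) * g′)
      + (½ - n + j) * (o * (2ℚ * (n + (j + 2ℚ))) - (2ℚ * n + 1ℚ) * g)
      + ½ * (4ℚ * (n + 1ℚ) * (n + (j + 2ℚ)) * g₁ - (2ℚ * n + 1ℚ) * (2ℚ * n - 1ℚ - 2ℚ * j) * g)
      + 2ℚ * (n + (j + 2ℚ)) * (n + 1ℚ) * ((1ℚ + n + (j + 2ℚ)) * (½ - (1ℚ + n) + (1ℚ + j)) * g′ - g₁)
    eq = solve-∀ ℚ-ring

  -- This is ((k + 2)/2)² for k = 2j + 1: the prefactors for k + 2 and k have the ratio (k + 2)²/16,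
  -- and 1 - y² is 4x(1 - x).
  quarterSq : ℕ → ℚ
  quarterSq j = ½ * ½ * ((2ℚ * ι j + 3ℚ) * (2ℚ * ι j + 3ℚ))

  -- The coefficients that y² f must have if (1 - y²) f is to be `quarterSq j` times the next
  -- series.
  γ′ : ℕ → ℕ → ℚ
  γ′ j n = γ j n - quarterSq j * γ (suc j) n

  private
    even→odd : ∀ j n → (4ℚ * ι n + 3ℚ) * γₒ j n ≡ (2ℚ * ι n + 1ℚ) * γ j n + (2ℚ * ι n + 2ℚ) * γ j (suc n)
    even→odd j n = cancelˡ (2ℚ * (ι n + (ι j + 2ℚ))) (0<⇒≢ (0<2[n+j] n j))
      (by₂ (4ℚ * ι n + 3ℚ) (- 1ℚ) (γₒ-def j n) (γ-sucʳ j n) (eq (ι n) (ι j) (γₒ j n) (γ j n) (γ j (suc n))))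
      where
      eq : ∀ n j o g g₁ → 2ℚ * (n + (j + 2ℚ)) * ((4ℚ * n + 3ℚ) * o) ≡
        2ℚ * (n + (j + 2ℚ)) * ((2ℚ * n + 1ℚ) * g + (2ℚ * n + 2ℚ) * g₁)
        + (4ℚ * n + 3ℚ) * (o * (2ℚ * (n + (j + 2ℚ))) - (2ℚ * n + 1ℚ) * g)
        + - 1ℚ * (4ℚ * (n + 1ℚ) * (n + (j + 2ℚ)) * g₁ - (2ℚ * n + 1ℚ) * (2ℚ * n - 1ℚ - 2ℚ * j) * g)
      eq = solve-∀ ℚ-ring

    odd→even₀ : ∀ j → γ′ j 0 ≡ γₒ j 0
    odd→even₀ j = by₂ (- 1ℚ) (- ½) (γ-sucʲ j 0) (γₒ≡ j 0) (eq (ι j) (γₒ j 0) (γ j 0) (γ (suc j) 0))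
      where
      eq : ∀ j o g g′ → g - ½ * ½ * ((2ℚ * j + 3ℚ) * (2ℚ * j + 3ℚ)) * g′ ≡ o
        + - 1ℚ * ((0ℚ + (j + 2ℚ)) * (½ - 0ℚ + (1ℚ + j)) * g′ - g)
        + - ½ * (2ℚ * o - (2ℚ * 0ℚ + 1ℚ) * (½ - 0ℚ + (1ℚ + j)) * g′)
      eq = solve-∀ ℚ-ring

    odd→even : ∀ j n → (4ℚ * ι n + 5ℚ) * γ′ j (suc n) ≡ (2ℚ * ι n + 3ℚ) * γₒ j (suc n) + (2ℚ * ι n + 2ℚ) * γₒ j n
    odd→even j n = by₃ (- (4ℚ * ι n + 5ℚ)) (- (½ * (2ℚ * ι n + 3ℚ))) (- (2ℚ * ι n + 2ℚ))
      (γ-sucʲ j (suc n)) (γₒ≡ j (suc n)) (γₒ-shift j n)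
      (eq (ι n) (ι j) (γₒ j n) (γₒ j (suc n)) (γ j (suc n)) (γ (suc j) (suc n)))
      where
      eq : ∀ n j o o₁ g g′ → (4ℚ * n + 5ℚ) * (g - ½ * ½ * ((2ℚ * j + 3ℚ) * (2ℚ * j + 3ℚ)) * g′) ≡
        (2ℚ * n + 3ℚ) * o₁ + (2ℚ * n + 2ℚ) * o
        + - (4ℚ * n + 5ℚ) * ((1ℚ + n + (j + 2ℚ)) * (½ - (1ℚ + n) + (1ℚ + j)) * g′ - g)
        + - (½ * (2ℚ * n + 3ℚ)) * (2ℚ * o₁ - (2ℚ * (1ℚ + n) + 1ℚ) * (½ - (1ℚ + n) + (1ℚ + j)) * g′)
        + - (2ℚ * n + 2ℚ) * (o - - ((n + 1ℚ) * (1ℚ + n + (j + 2ℚ)) * g′))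
      eq = solve-∀ ℚ-ring

  -- The subtracted summand is what the cut at N leaves: `γₒ j N` already contains `γ j (suc N)`,
  -- and y times the polynomial of degree 2N + 1 reaches degree 2N + 2. `remainder` bounds it.
  γ-step : ∀ j N y → (1ℚ - y * y) * evenSum (γ j) (suc N) y ≡ quarterSq j * evenSum (γ (suc j)) (suc N) y
    - (2ℚ * ι N + 2ℚ) * (γₒ j N * Pe (suc N) y - y * (γ j (suc N) * Po N y))
  γ-step j N y = by₂ (- 1ℚ) (- 1ℚ) (multiply-y² (γ j) (γₒ j) (γ′ j) (even→odd j) (odd→even₀ j) (odd→even j) N y)
      (trans (sum-cong (suc N) (λ n → cong (λ x →
        (4ℚ * ι n + 1ℚ) * x * Pe n y) (eq₁ (γ j n) (quarterSq j) (γ (suc j) n))))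
        (evenSum-linear (γ j) (- quarterSq j) (γ (suc j)) (suc N) y))
      (eq (y * y) (evenSum (γ j) (suc N) y) (evenSum (γ′ j) (suc N) y) (evenSum (γ (suc j)) (suc N) y) (quarterSq j)
        ((2ℚ * ι N + 2ℚ) * (γₒ j N * Pe (suc N) y - y * (γ j (suc N) * Po N y))))
    where
    eq₁ : ∀ g q g′ → g - q * g′ ≡ g + (- q) * g′
    eq₁ = solve-∀ ℚ-ring
    eq : ∀ z s s′ s₁ q B → (1ℚ - z) * s ≡ q * s₁ - B + - 1ℚ * (z * s - (s′ + B)) + - 1ℚ * (s′ - (s + (- q) * s₁))
    eq = solve-∀ ℚ-ring

-- Uniform approximation of odd powers of √(1 - y²).

module OddPowers where

  open import Data.Rational.Base using (_+_; _-_; -_; _*_; _/_; _≤_; _<_; ∣_∣; 1/_)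
  open Arithmetic
  open LegendrePolynomials
  open TaylorSeries
  open LegendreCoefficients
  open SquareRoot
  open LeibnizSeries
  open WallisProduct
  open SeriesCoefficients

  ½≤∣halfOdd∣ : ∀ i n → ½ ≤ ∣ ½ - ι n + ι i ∣
  ½≤∣halfOdd∣ i n with n ℕP.≤? i
  ... | yes n≤i = ℚP.≤-trans (≤-by (ι i - ι n) (≤⇒0≤- (ι-mono n≤i)) (eq (ι i) (ι n))) (p≤∣p∣ (½ - ι n + ι i))
    where
    eq : ∀ i n → ½ - n + i ≡ ½ + (i - n)
    eq = solve-∀ ℚ-ring
  ... | no  n≰i = ℚP.≤-trans (≤-by (ι n - ι (suc i)) (≤⇒0≤- (ι-mono (ℕP.≰⇒> n≰i))) (eq (ι i) (ι n))) (-p≤∣p∣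
    (½ - ι n + ι i))
    where
    eq : ∀ i n → - (½ - n + i) ≡ ½ + (n - (1ℚ + i))
    eq = solve-∀ ℚ-ring

  ∣γ-suc∣≤ : ∀ j n → ∣ γ (suc j) n ∣ ≤ 2ℚ * ∣ γ j n ∣
  ∣γ-suc∣≤ j n = ≤-by (2ℚ * ((ι n + (ι j + 2ℚ)) * x * y - ½ * y))
      (0≤2* (≤⇒0≤- (*-monoʳ y (ℚP.0≤∣p∣ (γ (suc j) n)) ½≤)))
      (by₁ (- 2ℚ) ∣∣-eq (eq ∣ γ j n ∣ ((ι n + (ι j + 2ℚ)) * x) y))
    where
    x y : ℚ
    x = ∣ ½ - ι n + ι (suc j) ∣
    y = ∣ γ (suc j) n ∣
    ∣∣-eq : (ι n + (ι j + 2ℚ)) * x * y ≡ ∣ γ j n ∣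
    ∣∣-eq = trans (cong (λ z → z * x * y) (sym (ℚP.0≤p⇒∣p∣≡p (ℚP.<⇒≤ (0<n+j n j)))))
      (trans (cong (_* y) (sym (ℚP.∣p*q∣≡∣p∣*∣q∣ (ι n + (ι j + 2ℚ)) (½ - ι n + ι (suc j)))))
        (trans (sym (ℚP.∣p*q∣≡∣p∣*∣q∣ ((ι n + (ι j + 2ℚ)) * (½ - ι n
          + ι (suc j))) (γ (suc j) n))) (cong ∣_∣ (γ-sucʲ j n))))
    ½≤ : ½ ≤ (ι n + (ι j + 2ℚ)) * x
    ½≤ = ℚP.≤-trans (½≤∣halfOdd∣ (suc j) n) (≤-by ((ι n + (ι j + 1ℚ)) * x)
      (nonNeg* (0≤+ (0≤ι n) (ℚP.<⇒≤ (0<1ℚ+ι j))) (ℚP.0≤∣p∣ (½ - ι n + ι (suc j)))) (eq₁ (ι n) (ι j) x))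
      where
      eq₁ : ∀ n j x → (n + (j + 2ℚ)) * x ≡ x + (n + (j + 1ℚ)) * x
      eq₁ = solve-∀ ℚ-ring
    eq : ∀ g k y → 2ℚ * g ≡ y + 2ℚ * (k * y - ½ * y) + - 2ℚ * (k * y - g)
    eq = solve-∀ ℚ-ring

  -- From (2n + 1) (w n)² ≤ 1 and |1/2 - n| ≥ 1/2; each level costs at most a factor 2. Quadratic
  -- decay makes the boundary term of `γ-step`, which carries the factor 2n + 2, vanish like 1/n.
  γ-bound : ∀ j n → (ι n + 1ℚ) * (2ℚ * ι n + 1ℚ) * ∣ γ j n ∣ ≤ 2ℚ ^ suc j
  γ-bound zero n = ≤-by (2ℚ * (1ℚ - (2ℚ * ι n + 1ℚ) * (w n * w n)) + 2ℚ * ((2ℚ * ι n + 1ℚ) * (ι n + 1ℚ) * y * (x - ½)))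
      (0≤+ (0≤2* (≤⇒0≤- (w²≤ n)))
        (0≤2* (nonNeg* (nonNeg* (nonNeg* (ℚP.<⇒≤ (0<2ι+1 n)) (ℚP.<⇒≤ (0<1ℚ+ι n))) (ℚP.0≤∣p∣ (γ 0 n))) (≤⇒0≤-
          (½≤∣halfOdd∣ 0 n)))))
      (by₁ (- (2ℚ * (2ℚ * ι n + 1ℚ))) ∣∣-eq (eq (ι n) x y (w n * w n)))
    where
    x y : ℚ
    x = ∣ ½ - ι n + ι 0 ∣
    y = ∣ γ 0 n ∣
    ∣∣-eq : y * ((ι n + 1ℚ) * x) ≡ w n * w n
    ∣∣-eq = trans (cong (λ z → y * (z * x)) (sym (ℚP.0≤p⇒∣p∣≡p (ℚP.<⇒≤ (0<1ℚ+ι n)))))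
      (trans (cong (y *_) (sym (ℚP.∣p*q∣≡∣p∣*∣q∣ (ι n + 1ℚ) (½ - ι n + ι 0))))
        (trans (sym (ℚP.∣p*q∣≡∣p∣*∣q∣ (γ 0 n) ((ι n + 1ℚ) * (½ - ι n + ι 0))))
          (trans (cong ∣_∣ (trans (eq₀ (γ 0 n) (ι n
            + 1ℚ) (½ - ι n)) (trans (cong (γ 0 n *_) (sym (den-sucʲ 0 n))) (γ*den 0 n))))
            (ℚP.0≤p⇒∣p∣≡p (0≤sq (w n))))))
      where
      eq₀ : ∀ g a b → g * (a * (b + 0ℚ)) ≡ g * (1ℚ * 1ℚ * ((a + 0ℚ) * (b + 0ℚ)))
      eq₀ = solve-∀ ℚ-ring
    eq : ∀ n x y u → 2ℚ * 1ℚ ≡ (n + 1ℚ) * (2ℚ * n + 1ℚ) * y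
      + (2ℚ * (1ℚ - (2ℚ * n + 1ℚ) * u) + 2ℚ * ((2ℚ * n + 1ℚ) * (n + 1ℚ) * y * (x - ½)))
      + - (2ℚ * (2ℚ * n + 1ℚ)) * (y * ((n + 1ℚ) * x) - u)
    eq = solve-∀ ℚ-ring
  γ-bound (suc j) n = ℚP.≤-trans (*-monoˡ k (nonNeg* (ℚP.<⇒≤ (0<1ℚ+ι n)) (ℚP.<⇒≤ (0<2ι+1 n))) (∣γ-suc∣≤ j n))
    (subst (_≤ 2ℚ * 2ℚ ^ suc j) (eq k ∣ γ j n ∣) (*-monoˡ 2ℚ (0≤/ 2 0) (γ-bound j n)))
    where
    k : ℚ
    k = (ι n + 1ℚ) * (2ℚ * ι n + 1ℚ)
    eq : ∀ k x → 2ℚ * (k * x) ≡ k * (2ℚ * x)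
    eq = solve-∀ ℚ-ring

  null-nonNeg-rate : ∀ {s} c → (∀ n → 0ℚ ≤ s n) → (∀ n → s n * ι (suc n) ≤ c) → Null s
  null-nonNeg-rate {s} c 0≤s h = null-rate {s} c (λ n → subst (λ z →
    z * ι (suc n) ≤ c) (sym (ℚP.0≤p⇒∣p∣≡p (0≤s n))) (h n))

  remainder : ℕ → ℕ → ℚ
  remainder j n = (2ℚ * ι n + 2ℚ) * ∣ γₒ j n ∣ + (2ℚ * ι n + 2ℚ) * ∣ γ j (suc n) ∣

  remainder-null : ∀ j → Null (remainder j)
  remainder-null j = null-+ {λ n → (2ℚ * ι n + 2ℚ) * ∣ γₒ j n ∣} {λ n → (2ℚ * ι n + 2ℚ) * ∣ γ j (suc n) ∣}
    (null-nonNeg-rate (2ℚ ^ suc j) (λ n → nonNeg* (ℚP.<⇒≤ (0<2ι+2 n)) (ℚP.0≤∣p∣ (γₒ j n))) odd)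
    (null-nonNeg-rate (2ℚ ^ suc j) (λ n → nonNeg* (ℚP.<⇒≤ (0<2ι+2 n)) (ℚP.0≤∣p∣ (γ j (suc n)))) even)
    where
    odd : ∀ n → (2ℚ * ι n + 2ℚ) * ∣ γₒ j n ∣ * ι (suc n) ≤ 2ℚ ^ suc j
    odd n = ℚP.≤-trans (≤-by (2ℚ * (ι j + 1ℚ) * y * ι (suc n))
        (nonNeg* (nonNeg* (0≤2* (ℚP.<⇒≤ (0<1ℚ+ι j))) (ℚP.0≤∣p∣ (γₒ j n))) (0≤ι (suc n)))
        (by₁ (- ι (suc n)) ∣∣-eq (eq (ι n) (ι j) y ∣ γ j n ∣))) (γ-bound j n)
      where
      y : ℚ
      y = ∣ γₒ j n ∣
      ∣∣-eq : y * (2ℚ * (ι n + (ι j + 2ℚ))) ≡ (2ℚ * ι n + 1ℚ) * ∣ γ j n ∣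
      ∣∣-eq = trans (cong (y *_) (sym (ℚP.0≤p⇒∣p∣≡p (0≤2* (ℚP.<⇒≤ (0<n+j n j))))))
        (trans (sym (ℚP.∣p*q∣≡∣p∣*∣q∣ (γₒ j n) (2ℚ * (ι n + (ι j + 2ℚ)))))
          (trans (cong ∣_∣ (γₒ-def j n)) (trans (ℚP.∣p*q∣≡∣p∣*∣q∣ (2ℚ * ι n + 1ℚ) (γ j n))
            (cong (_* ∣ γ j n ∣) (ℚP.0≤p⇒∣p∣≡p (ℚP.<⇒≤ (0<2ι+1 n)))))))
      eq : ∀ n j y g → (n + 1ℚ) * (2ℚ * n + 1ℚ) * g ≡ (2ℚ * n + 2ℚ) * y * (1ℚ + n) + 2ℚ * (j + 1ℚ) * y * (1ℚ + n)
        + - (1ℚ + n) * (y * (2ℚ * (n + (j + 2ℚ))) - (2ℚ * n + 1ℚ) * g)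
      eq = solve-∀ ℚ-ring
    even : ∀ n → (2ℚ * ι n + 2ℚ) * ∣ γ j (suc n) ∣ * ι (suc n) ≤ 2ℚ ^ suc j
    even n = ℚP.≤-trans (≤-by ((3ℚ * ι n + 4ℚ) * y)
        (nonNeg* (0≤+ (nonNeg* {3ℚ} (0≤/ 3 0) (0≤ι n)) (0≤/ 4 0)) (ℚP.0≤∣p∣ (γ j (suc n))))
        (eq (ι n) y)) (γ-bound j (suc n))
      where
      y : ℚ
      y = ∣ γ j (suc n) ∣
      eq : ∀ n y → (1ℚ + n + 1ℚ) * (2ℚ * (1ℚ + n) + 1ℚ) * y ≡ (2ℚ * n + 2ℚ) * y * (1ℚ + n) + (3ℚ * n + 4ℚ) * y
      eq = solve-∀ ℚ-ring

  0<quarterSq : ∀ j → 0ℚ < quarterSq j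
  0<quarterSq j = pos* {½ * ½} (ℚP.positive⁻¹ (½ * ½)) (pos* (0<2ι+3 j) (0<2ι+3 j))

  -- Hence the division by `quarterSq j` in `approximates-suc` does not enlarge errors.
  1≤quarterSq : ∀ j → 1ℚ ≤ quarterSq j
  1≤quarterSq j = ≤-by (ι j * ι j + 3ℚ * ι j + 5ℚ * (½ * ½))
      (0≤+ (0≤+ (nonNeg* (0≤ι j) (0≤ι j)) (nonNeg* {3ℚ} (0≤/ 3 0) (0≤ι j))) (nonNeg* {5ℚ} (0≤/ 5 0) (nonNeg* {½} {½}
        (0≤/ 1 1) (0≤/ 1 1))))
      (eq (ι j))
    where
    eq : ∀ j → ½ * ½ * ((2ℚ * j + 3ℚ) * (2ℚ * j + 3ℚ)) ≡ 1ℚ + (j * j + 3ℚ * j + 5ℚ * (½ * ½))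
    eq = solve-∀ ℚ-ring

  -- 2ᵏ / (k!!)² for k = 2j + 1.
  κ : ℕ → ℚ
  κ zero    = 2ℚ
  κ (suc j) = κ j ÷ quarterSq j

  κ-suc : ∀ j → κ (suc j) * quarterSq j ≡ κ j
  κ-suc j = ÷-*⁺ (κ j) (0<quarterSq j)

  0≤κ : ∀ j → 0ℚ ≤ κ j
  0≤κ zero    = 0≤/ 2 0
  0≤κ (suc j) = 0≤÷ (0≤κ j) (0<quarterSq j)

  -- The partial sums approach (4 / π) κ √(1 - y²)ᵏ, k = 2j + 1, uniformly in y
  -- and in any r whose square is near 1 - y².
  Approximates : ℕ → Set
  Approximates j = ∀ ε → 0ℚ < ε → ∃ λ N → ∃ λ δ → 0ℚ < δ × (∀ n → N ℕ.≤ n → ∀ y r → y * y ≤ 1ℚ → 0ℚ ≤ r → r ≤ 1ℚ →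
    ∣ r * r - (1ℚ - y * y) ∣ ≤ δ → ∣ evenSum (γ j) (suc n) y - κ j * V n * r ^ suc (double j) ∣ ≤ ε)

  -- For p ≥ q, p² - q² is (p - q)² plus a nonnegative term, and symmetrically. A bound of this kind
  -- is needed near y² = 1, where the square root is not Lipschitz.
  ∣-∣≤-of-squares : ∀ {p q η} → 0ℚ ≤ p → 0ℚ ≤ q → 0ℚ ≤ η → ∣ p * p - q * q ∣ ≤ η * η → ∣ p - q ∣ ≤ η
  ∣-∣≤-of-squares {p} {q} {η} 0≤p 0≤q 0≤η h = sq≤⇒∣∣≤ 0≤η (ℚP.≤-trans sq≤ h)
    where
    eq : ∀ p q → p * p - q * q ≡ (p - q) * (p - q) + 2ℚ * (q * (p - q))
    eq = solve-∀ ℚ-ring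
    eq′ : ∀ p q → - (p * p - q * q) ≡ (p - q) * (p - q) + 2ℚ * (p * (q - p))
    eq′ = solve-∀ ℚ-ring
    sq≤ : (p - q) * (p - q) ≤ ∣ p * p - q * q ∣
    sq≤ with ℚP.≤-total q p
    ... | inj₁ q≤p = ℚP.≤-trans (≤-by _ (0≤2* (nonNeg* 0≤q (≤⇒0≤- q≤p))) (eq p q)) (p≤∣p∣ (p * p - q * q))
    ... | inj₂ p≤q = ℚP.≤-trans (≤-by _ (0≤2* (nonNeg* 0≤p (≤⇒0≤- p≤q))) (eq′ p q)) (-p≤∣p∣ (p * p - q * q))

  w-null : Null w
  w-null ε 0<ε = combine (null-recip (ε * ε) (pos* 0<ε 0<ε))
    where
    combine : (∃ λ N → ∀ n → N ℕ.≤ n → ∣ 1ℚ ÷ ι (suc n) ∣ ≤ ε * ε) → ∃ λ N → ∀ n → N ℕ.≤ n → ∣ w n ∣ ≤ ε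
    combine (N , f) = N , λ n N≤n →
      sq≤⇒∣∣≤ (ℚP.<⇒≤ 0<ε) (ℚP.≤-trans (w²≤recip n) (ℚP.≤-trans (p≤∣p∣ (1ℚ ÷ ι (suc n))) (f n N≤n)))
      where
      eq : ∀ n u r → (1ℚ + n) * r ≡ (1ℚ + n) * u + (1ℚ - (2ℚ * n + 1ℚ) * u + n * u) + 1ℚ * (r * (1ℚ + n) - 1ℚ)
      eq = solve-∀ ℚ-ring
      w²≤recip : ∀ n → w n * w n ≤ 1ℚ ÷ ι (suc n)
      w²≤recip n = cancel-≤ (ι (suc n)) (0<ι n) (≤-by (1ℚ - (2ℚ * ι n + 1ℚ) * (w n * w n) + ι n * (w n * w n))
        (0≤+ (≤⇒0≤- (w²≤ n)) (nonNeg* (0≤ι n) (0≤sq (w n))))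
        (by₁ 1ℚ (÷-*⁺ 1ℚ (0<ι n)) (eq (ι n) (w n * w n) (1ℚ ÷ ι (suc n)))))

  G-error : ℕ → ℚ
  G-error n = 2ℚ * w n + 2ℚ * (2ℚ ÷ (2ℚ * ι n + 3ℚ))

  G-error-null : Null G-error
  G-error-null = null-+ {λ n → 2ℚ * w n} {λ n → 2ℚ * (2ℚ ÷ (2ℚ * ι n + 3ℚ))} (null-* 2ℚ w-null) (null-* 2ℚ
    (null-nonNeg-rate 1ℚ (λ n → 0≤÷ {2ℚ} (0≤/ 2 0) (0<2ι+3 n)) rate))
    where
    eq : ∀ n q → 1ℚ ≡ q * (1ℚ + n) + ½ * q + - ½ * (q * (2ℚ * n + 3ℚ) - 2ℚ)
    eq = solve-∀ ℚ-ring
    rate : ∀ n → (2ℚ ÷ (2ℚ * ι n + 3ℚ)) * ι (suc n) ≤ 1ℚ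
    rate n = ≤-by (½ * (2ℚ ÷ (2ℚ * ι n + 3ℚ))) (nonNeg* {½} (0≤/ 1 1) (0≤÷ {2ℚ} (0≤/ 2 0) (0<2ι+3 n)))
      (by₁ (- ½) (÷-*⁺ 2ℚ (0<2ι+3 n)) (eq (ι n) (2ℚ ÷ (2ℚ * ι n + 3ℚ))))

  ∣G²-[1-z]∣≤ : ∀ n z → 0ℚ ≤ z → z ≤ 1ℚ → ∣ (1ℚ - z) - G (suc n) z * G (suc n) z ∣ ≤ 2ℚ * w n
  ∣G²-[1-z]∣≤ n z 0≤z z≤1 = ∣∣≤-intro
    (≤-by (G² - (1ℚ - z) + 2ℚ * w n) (0≤+ (≤⇒0≤- (1-z≤G² z 0≤z z≤1 n)) (0≤2* (0≤w n))) (eq G² z (w n)))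
    (≤-by (1ℚ - z + 2ℚ * w n - G²) (≤⇒0≤- (G²≤ z 0≤z z≤1 n)) (eq′ G² z (w n)))
    where
    G² : ℚ
    G² = G (suc n) z * G (suc n) z
    eq : ∀ g z u → 2ℚ * u ≡ 1ℚ - z - g + (g - (1ℚ - z) + 2ℚ * u)
    eq = solve-∀ ℚ-ring
    eq′ : ∀ g z u → 2ℚ * u ≡ - (1ℚ - z - g) + (1ℚ - z + 2ℚ * u - g)
    eq′ = solve-∀ ℚ-ring

  -- As W n V n = 1, the error is -V n (2G - W n s) + 2 V n (G - r), where s is the partial sum.
  -- `G-close` with p = n bounds the first part, comparison of squares the second.
  approximates-zero : Approximates 0
  approximates-zero ε 0<ε = combine (null-* 2ℚ w-null (η * η * ½) (half>0 (pos* 0<η 0<η))) (null-* 2ℚ G-error-null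
    (ε * ½) (half>0 0<ε))
    where
    -- `2ℚ * V n` is at most 4, so an error η in `g₀ - r` costs ε/2. The squares may differ by η²,
    -- shared equally between the defect of r² and that of the Taylor polynomial.
    η : ℚ
    η = ε * ½ * ½ * ½
    0<η : 0ℚ < η
    0<η = half>0 (half>0 (half>0 0<ε))
    combine : (∃ λ N → ∀ n → N ℕ.≤ n → ∣ 2ℚ * w n ∣ ≤ η * η * ½) → (∃ λ N → ∀ n → N ℕ.≤ n →
      ∣ 2ℚ * G-error n ∣ ≤ ε * ½) →
      ∃ λ N → ∃ λ δ → 0ℚ < δ × (∀ n → N ℕ.≤ n → ∀ y r → y * y ≤ 1ℚ → 0ℚ ≤ r → r ≤ 1ℚ →
        ∣ r * r - (1ℚ - y * y) ∣ ≤ δ → ∣ evenSum (γ 0) (suc n) y - κ 0 * V n * r ^ 1 ∣ ≤ ε)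
    combine (M , f) (K , f′) = M ℕ.⊔ K , η * η * ½ , half>0 (pos* 0<η 0<η) , λ n h y r yy≤1 0≤r r≤1 close →
        bound n y r yy≤1 0≤r close (f n (ℕP.m⊔n≤o⇒m≤o M K h)) (f′ n (ℕP.m⊔n≤o⇒n≤o M K h))
      where
      bound : ∀ n y r → y * y ≤ 1ℚ → 0ℚ ≤ r → ∣ r * r - (1ℚ - y * y) ∣ ≤ η * η * ½ → ∣ 2ℚ * w n ∣ ≤ η * η * ½ →
        ∣ 2ℚ * G-error n ∣ ≤ ε * ½ →
        ∣ evenSum (γ 0) (suc n) y - κ 0 * V n * r ^ 1 ∣ ≤ ε
      bound n y r yy≤1 0≤r close wn en = subst₂ _≤_ (cong ∣_∣ rewriting) (eq₁ ε)
          (∣+∣≤ {(- V n) * (2ℚ * g₀ - W n * s)} {2ℚ * V n * (g₀ - r)}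
            (ℚP.≤-trans (∣*∣≤ { - V n} {2ℚ * g₀ - W n * s} (subst (_≤ 2ℚ) (sym (ℚP.∣-p∣≡∣p∣ (V n))) (∣V∣≤2 n))
              (G-close n n y yy≤1))
              (ℚP.≤-trans (p≤∣p∣ (2ℚ * G-error n)) en))
            (∣*∣≤ {2ℚ * V n} {g₀ - r} (∣*∣≤ {2ℚ} {V n} {2ℚ} ℚP.≤-refl (∣V∣≤2 n)) g₀-r))
        where
        z s g₀ : ℚ
        z = y * y
        s = evenSum g (suc n) y
        g₀ = G (suc n) z
        g₀-r : ∣ g₀ - r ∣ ≤ η
        g₀-r = subst (_≤ η) (∣∣-sym r g₀) (∣-∣≤-of-squares 0≤r (0≤G z (0≤sq y) yy≤1 n) (ℚP.<⇒≤ 0<η)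
          (subst (∣ r * r - g₀ * g₀ ∣ ≤_) (half+half (η * η))
            (∣-∣≤-trans {r * r} {1ℚ - z} {g₀ * g₀} close
              (ℚP.≤-trans (∣G²-[1-z]∣≤ n z (0≤sq y) yy≤1) (ℚP.≤-trans (p≤∣p∣ (2ℚ * w n)) wn)))))
        eq : ∀ v u s g r → (- v) * (2ℚ * g - u * s) + 2ℚ * v * (g - r) ≡ s - 2ℚ * v * (r * 1ℚ) + s * (u * v - 1ℚ)
        eq = solve-∀ ℚ-ring
        rewriting : (- V n) * (2ℚ * g₀ - W n * s) + 2ℚ * V n * (g₀ - r) ≡ evenSum (γ 0) (suc n) y - κ 0 * V n * r ^ 1
        rewriting = trans (by₁ s (W*V n) (eq (V n) (W n) s g₀ r))
          (cong (_- κ 0 * V n * r ^ 1) (sum-cong (suc n) (λ i → cong (λ x →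
            (4ℚ * ι i + 1ℚ) * x * Pe i y) (sym (γ₀≡g i)))))
        eq₁ : ∀ ε → ε * ½ + 2ℚ * 2ℚ * (ε * ½ * ½ * ½) ≡ ε
        eq₁ = solve-∀ ℚ-ring

  -- By `γ-step`, the new error times `quarterSq j` is (1 - y²) times the old one, plus the boundary
  -- term, minus κ j V n rᵏ (r² - (1 - y²)) with k = 2j + 1. The three parts are allowed ε/2, ε/4
  -- and ε/4.
  approximates-suc : ∀ j → Approximates j → Approximates (suc j)
  approximates-suc j h ε 0<ε = combine (h ε₁ (half>0 0<ε)) (remainder-null j ε₂ (half>0 (half>0 0<ε))) (scale
    (nonNeg+pos 0≤c 0<1) (half>0 (half>0 0<ε)))
    where
    ε₁ ε₂ c : ℚ
    ε₁ = ε * ½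
    ε₂ = ε * ½ * ½
    c = κ j * 2ℚ
    0≤c : 0ℚ ≤ c
    0≤c = nonNeg* (0≤κ j) (0≤/ 2 0)
    combine : (∃ λ N → ∃ λ δ → 0ℚ < δ × (∀ n → N ℕ.≤ n → ∀ y r → y * y ≤ 1ℚ → 0ℚ ≤ r → r ≤ 1ℚ →
        ∣ r * r - (1ℚ - y * y) ∣ ≤ δ → ∣ evenSum (γ j) (suc n) y - κ j * V n * r ^ suc (double j) ∣ ≤ ε₁)) →
      (∃ λ N → ∀ n → N ℕ.≤ n → ∣ remainder j n ∣ ≤ ε₂) → (∃ λ δ → 0ℚ < δ × (c + 1ℚ) * δ ≡ ε₂) →
      ∃ λ N → ∃ λ δ → 0ℚ < δ × (∀ n → N ℕ.≤ n → ∀ y r → y * y ≤ 1ℚ → 0ℚ ≤ r → r ≤ 1ℚ →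
        ∣ r * r - (1ℚ - y * y) ∣ ≤ δ →
          ∣ evenSum (γ (suc j)) (suc n) y - κ (suc j) * V n * r ^ suc (double (suc j)) ∣ ≤ ε)
    combine (M , δ₁ , 0<δ₁ , f) (K , f′)
      (δ₂ , 0<δ₂ , δ₂-eq) = M ℕ.⊔ K , δ₁ ℚ.⊓ δ₂ , 0<⊓ , λ n hn y r yy≤1 0≤r r≤1 close →
        bound n y r yy≤1 0≤r r≤1 (ℚP.≤-trans close (ℚP.p⊓q≤q δ₁ δ₂))
          (f n (ℕP.m⊔n≤o⇒m≤o M K hn) y r yy≤1 0≤r r≤1 (ℚP.≤-trans close (ℚP.p⊓q≤p δ₁ δ₂)))
          (f′ n (ℕP.m⊔n≤o⇒n≤o M K hn))
      where
      0<⊓ : 0ℚ < δ₁ ℚ.⊓ δ₂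
      0<⊓ with ℚP.≤-total δ₁ δ₂
      ... | inj₁ le = subst (0ℚ <_) (sym (ℚP.p≤q⇒p⊓q≡p le)) 0<δ₁
      ... | inj₂ le = subst (0ℚ <_) (sym (ℚP.p≥q⇒p⊓q≡q le)) 0<δ₂
      bound : ∀ n y r → y * y ≤ 1ℚ → 0ℚ ≤ r → r ≤ 1ℚ → ∣ r * r - (1ℚ - y * y) ∣ ≤ δ₂ →
        ∣ evenSum (γ j) (suc n) y - κ j * V n * r ^ suc (double j) ∣ ≤ ε₁ → ∣ remainder j n ∣ ≤ ε₂ →
        ∣ evenSum (γ (suc j)) (suc n) y - κ (suc j) * V n * r ^ suc (double (suc j)) ∣ ≤ ε
      bound n y r yy≤1 0≤r r≤1 close h₁ h₂ = cancel-≤ Q (0<quarterSq j) (ℚP.≤-trans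
          (subst (_≤ 1ℚ * ε₁ + ε₂ + c * 1ℚ * δ₂) (trans (cong ∣_∣ rewriting) (trans (ℚP.∣p*q∣≡∣p∣*∣q∣ Q X)
              (cong (_* ∣ X ∣) (ℚP.0≤p⇒∣p∣≡p (ℚP.<⇒≤ (0<quarterSq j))))))
            (∣+∣≤ {(1ℚ - y * y) * E + B} {(- (κ j * V n) * p) * (r * r - (1ℚ - y * y))}
              (∣+∣≤ {(1ℚ - y * y) * E} {B} (∣*∣≤ {1ℚ - y * y} {E} 1-yy h₁) B≤)
              (∣*∣≤ { - (κ j * V n) * p} {r * r - (1ℚ - y * y)} (∣*∣≤ { - (κ j * V n)} {p} κV≤ p≤) close)))
          (ℚP.≤-trans (≤-by δ₂ (ℚP.<⇒≤ 0<δ₂) (by₁ (- 1ℚ) δ₂-eq (eq₁ ε c δ₂)))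
            (subst (_≤ Q * ε) (ℚP.*-identityˡ ε) (*-monoʳ ε (ℚP.<⇒≤ 0<ε) (1≤quarterSq j)))))
        where
        Q X E B p : ℚ
        Q = quarterSq j
        X = evenSum (γ (suc j)) (suc n) y - κ (suc j) * V n * r ^ suc (double (suc j))
        p = r ^ suc (double j)
        E = evenSum (γ j) (suc n) y - κ j * V n * p
        B = (2ℚ * ι n + 2ℚ) * (γₒ j n * Pe (suc n) y - y * (γ j (suc n) * Po n y))
        eq₁ : ∀ ε c d → ε ≡ 1ℚ * (ε * ½) + ε * ½ * ½ + c * 1ℚ * d + d + - 1ℚ * ((c + 1ℚ) * d - ε * ½ * ½)
        eq₁ = solve-∀ ℚ-ring
        eq : ∀ z k k′ v p r s s₁ Q b → (1ℚ - z) * (s - k * v * p) + b + (- (k * v) * p) * (r * r - (1ℚ - z)) ≡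
          Q * (s₁ - k′ * v * (r * (r * p))) + v * (r * (r * p)) * (k′ * Q - k) + ((1ℚ - z) * s - (Q * s₁ - b))
        eq = solve-∀ ℚ-ring
        rewriting : (1ℚ - y * y) * E + B + (- (κ j * V n) * p) * (r * r - (1ℚ - y * y)) ≡ Q * X
        rewriting = by₂ (V n * (r * (r * p))) 1ℚ (κ-suc j) (γ-step j n y)
          (trans (eq (y * y) (κ j) (κ (suc j)) (V n) p r (evenSum (γ j) (suc n) y) (evenSum (γ (suc j)) (suc n) y) Q B)
            (cong (λ u → Q * X + V n * (r * (r * p)) * (κ (suc j) * Q - κ j) + u) (sym (ℚP.*-identityˡ _))))
        1-yy : ∣ 1ℚ - y * y ∣ ≤ 1ℚ
        1-yy = ∣nonNeg∣≤ (≤⇒0≤- yy≤1) (≤-by (y * y) (0≤sq y) (eq₂ (y * y)))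
          where
          eq₂ : ∀ z → 1ℚ ≡ 1ℚ - z + z
          eq₂ = solve-∀ ℚ-ring
        κV≤ : ∣ - (κ j * V n) ∣ ≤ c
        κV≤ = subst (_≤ c) (sym (ℚP.∣-p∣≡∣p∣ (κ j * V n))) (∣*∣≤ {κ j} {V n} (∣nonNeg∣≤ (0≤κ j) ℚP.≤-refl) (∣V∣≤2 n))
        p≤ : ∣ p ∣ ≤ 1ℚ
        p≤ = ∣nonNeg∣≤ (0≤^ (suc (double j)) 0≤r) (^≤1 (suc (double j)) 0≤r r≤1)
        ∣y∣≤1 : ∣ y ∣ ≤ 1ℚ
        ∣y∣≤1 = sq≤⇒∣∣≤ {y} {1ℚ} 0≤1 yy≤1
        o g₁ : ℚ
        o = γₒ j n
        g₁ = γ j (suc n)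
        eq₃ : ∀ k o g → k * (o * 1ℚ + 1ℚ * (g * 1ℚ)) ≡ k * o + k * g
        eq₃ = solve-∀ ℚ-ring
        B≤ : ∣ B ∣ ≤ ε₂
        B≤ = ℚP.≤-trans (ℚP.≤-trans (subst (∣ B ∣ ≤_) (eq₃ (2ℚ * ι n + 2ℚ) ∣ o ∣ ∣ g₁ ∣)
            (∣*∣≤ {2ℚ * ι n + 2ℚ} {o * Pe (suc n) y - y * (g₁ * Po n y)} (∣nonNeg∣≤ (ℚP.<⇒≤ (0<2ι+2 n)) ℚP.≤-refl)
              (∣+∣≤ {o * Pe (suc n) y} { - (y * (g₁ * Po n y))}
                (∣*∣≤ {o} {Pe (suc n) y} ℚP.≤-refl (∣P∣≤1 (double (suc n)) y yy≤1))
                (subst (_≤ 1ℚ * (∣ g₁ ∣ * 1ℚ)) (sym (ℚP.∣-p∣≡∣p∣ (y * (g₁ * Po n y))))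
                  (∣*∣≤ {y} {g₁ * Po n y} ∣y∣≤1 (∣*∣≤ {g₁} {Po n y} ℚP.≤-refl (∣P∣≤1 (suc (double n)) y yy≤1)))))))
            (p≤∣p∣ (remainder j n))) h₂

  approximates : ∀ j → Approximates j
  approximates zero    = approximates-zero
  approximates (suc j) = approximates-suc j (approximates j)

-- Passage to real arguments.

module Reals where

  open import Data.Rational.Base using (_+_; _-_; -_; _*_; _/_; _≤_; _<_; ∣_∣; 1/_)
  open Arithmetic
  open import Data.Nat.Divisibility using (divides)
  open import Data.Rational.Base using (_⊔_; _⊓_)
  open import Data.Sum.Base using (_⊎_)
  open import Defs using (ℝ; mkℝ; seq; fromℚ; fromℕ; legendre; partialSum; _SumsTo_; _≃_; √_; _^[_/2]; _!!;
      leibnizSum; coefficient; prefactor; lower-spec; width; width>0; width-bound)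
    renaming (_-_ to _-ᵣ_; _*_ to _*ᵣ_; _^_ to _^ᵣ_; _≤_ to _≤ᵣ_)
  open LegendrePolynomials
  open LegendreCoefficients
  open LeibnizSeries
  open WallisProduct
  open SeriesCoefficients
  open OddPowers

  half< : ∀ {ε} → 0ℚ < ε → ε * ½ < ε
  half< {ε} 0<ε = subst₂ _<_ (ℚP.+-identityʳ (ε * ½)) (half+half ε) (ℚP.+-monoʳ-< (ε * ½) (half>0 0<ε))

  null-*-null : ∀ {s t : ℕ → ℚ} → Null s → Null t → Null (λ n → s n * t n)
  null-*-null {s} {t} hs ht ε 0<ε = combine (hs 1ℚ 0<1) (ht ε 0<ε)
    where
    combine : (∃ λ N → ∀ n → N ℕ.≤ n → ∣ s n ∣ ≤ 1ℚ) → (∃ λ N → ∀ n → N ℕ.≤ n → ∣ t n ∣ ≤ ε) →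
              ∃ λ N → ∀ n → N ℕ.≤ n → ∣ s n * t n ∣ ≤ ε
    combine (M , f) (K , f′) = M ℕ.⊔ K , λ n h → subst (∣ s n * t n ∣ ≤_) (ℚP.*-identityˡ ε)
      (∣*∣≤ {s n} {t n} (f n (ℕP.m⊔n≤o⇒m≤o M K h)) (f′ n (ℕP.m⊔n≤o⇒n≤o M K h)))

  -- The points s may leave [-1, 1], where `∣P∣≤1` says nothing, so products are expanded around t,
  -- which stays inside.
  P-continuous : ∀ {s t : ℕ → ℚ} → (∀ i → t i * t i ≤ 1ℚ) → Null (λ i → s i - t i) →
                 ∀ m → Null (λ i → P m (s i) - P m (t i))
  P-continuous {s} {t} tt≤1 s-t zero = null-zero
  P-continuous {s} {t} tt≤1 s-t (suc zero) = s-t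
  P-continuous {s} {t} tt≤1 s-t (suc (suc m)) = null-cong step
    (null-* c (null-+ {λ i → A′ * (u i * d i + (P (suc m) (t i) * u i + t i * d i))} {λ i → (- B′) * d₀ i}
      (null-* A′ (null-+ {λ i → u i * d i} {λ i →
        P (suc m) (t i) * u i + t i * d i} (null-*-null {u} {d} s-t (P-continuous {s} {t} tt≤1 s-t (suc m)))
        (null-+ {λ i → P (suc m) (t i) * u i} {λ i → t i * d i}
          (null-bounded* {λ i → P (suc m) (t i)} {u} 1ℚ (λ i → ∣P∣≤1 (suc m) (t i) (tt≤1 i)) s-t)
          (null-bounded* {t} {d} 1ℚ (λ i → sq≤⇒∣∣≤ {t i} {1ℚ} 0≤1 (tt≤1 i)) (P-continuous {s} {t} tt≤1 s-t (suc m))))))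
      (null-* (- B′) (P-continuous {s} {t} tt≤1 s-t m))))
    where
    c A′ B′ : ℚ
    c = + 1 / (2 ℕ.+ m)
    A′ = + (2 ℕ.* m ℕ.+ 3) / 1
    B′ = + (m ℕ.+ 1) / 1
    u d d₀ : ℕ → ℚ
    u i = s i - t i
    d i = P (suc m) (s i) - P (suc m) (t i)
    d₀ i = P m (s i) - P m (t i)
    eq : ∀ c A B s t p q p₀ q₀ → c * (A * ((s - t) * (p - q) + (q * (s - t) + t * (p - q))) + (- B) * (p₀ - q₀)) ≡
      c * (A * s * p - B * p₀) - c * (A * t * q - B * q₀)
    eq = solve-∀ ℚ-ring
    step : ∀ i → c * (A′ * (u i * d i + (P (suc m) (t i) * u i + t i * d i)) + (- B′) * d₀ i) ≡
      P (suc (suc m)) (s i) - P (suc (suc m)) (t i)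
    step i = eq c A′ B′ (s i) (t i) (P (suc m) (s i)) (P (suc m) (t i)) (P m (s i)) (P m (t i))

  evenSum-continuous : ∀ b {s t : ℕ → ℚ} → (∀ i → t i * t i ≤ 1ℚ) → Null (λ i → s i - t i) →
                       ∀ n → Null (λ i → evenSum b n (s i) - evenSum b n (t i))
  evenSum-continuous b tt≤1 s-t zero = null-zero
  evenSum-continuous b {s} {t} tt≤1 s-t (suc n) = null-cong
    (λ i → eq (evenSum b n (s i)) (evenSum b n (t i)) ((4ℚ * ι n + 1ℚ) * b n) (Pe n (s i)) (Pe n (t i)))
    (null-+ {λ i → evenSum b n (s i) - evenSum b n (t i)} {λ i → (4ℚ * ι n + 1ℚ) * b n * (Pe n (s i) - Pe n (t i))}
      (evenSum-continuous b {s} {t} tt≤1 s-t n)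
      (null-* ((4ℚ * ι n + 1ℚ) * b n) (P-continuous {s} {t} tt≤1 s-t (double n))))
    where
    eq : ∀ x y k p q → x - y + k * (p - q) ≡ x + k * p - (y + k * q)
    eq = solve-∀ ℚ-ring

  -- The hypotheses 0 ≤ x ≤ 1 confine the entries of x only eventually and up to ε. The estimates
  -- for y² ≤ 1 are applied at clamped entries, which differ from the true ones by a null sequence.
  clamp : ℚ → ℚ
  clamp q = (q ⊔ 0ℚ) ⊓ 1ℚ

  data Clamped (q : ℚ) : Set where
    below  : q ≤ 0ℚ → clamp q ≡ 0ℚ → Clamped q
    within : 0ℚ ≤ q → q ≤ 1ℚ → clamp q ≡ q → Clamped q
    above  : 1ℚ ≤ q → clamp q ≡ 1ℚ → Clamped q

  clamped : ∀ q → Clamped q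
  clamped q with ℚP.≤-total q 0ℚ | ℚP.≤-total q 1ℚ
  ... | inj₁ q≤0 | _        = below q≤0 (trans (cong (_⊓ 1ℚ) (ℚP.p≤q⇒p⊔q≡q q≤0)) (ℚP.p≤q⇒p⊓q≡p 0≤1))
  ... | inj₂ 0≤q | inj₁ q≤1 = within 0≤q q≤1 (trans (cong (_⊓ 1ℚ) (ℚP.p≥q⇒p⊔q≡p 0≤q)) (ℚP.p≤q⇒p⊓q≡p q≤1))
  ... | inj₂ 0≤q | inj₂ 1≤q = above 1≤q (trans (cong (_⊓ 1ℚ) (ℚP.p≥q⇒p⊔q≡p 0≤q)) (ℚP.p≥q⇒p⊓q≡q 1≤q))

  clamp-close : ∀ {ε} q → 0ℚ ≤ ε → 0ℚ ≤ q + ε → q ≤ 1ℚ + ε → ∣ q - clamp q ∣ ≤ ε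
  clamp-close {ε} q 0≤ε lo hi with clamped q
  ... | below q≤0 eq = subst (λ c → ∣ q - c ∣ ≤ ε) (sym eq) (∣∣≤-intro
          (≤-by (ε - q) (0≤+ 0≤ε (ℚP.neg-antimono-≤ q≤0)) (e₁ q ε)) (≤-by (q + ε) lo (e₂ q ε)))
    where
    e₁ : ∀ q ε → ε ≡ q - 0ℚ + (ε - q)
    e₁ = solve-∀ ℚ-ring
    e₂ : ∀ q ε → ε ≡ - (q - 0ℚ) + (q + ε)
    e₂ = solve-∀ ℚ-ring
  ... | within _ _ eq = subst (λ c → ∣ q - c ∣ ≤ ε) (sym eq) (subst (λ z → ∣ z ∣ ≤ ε) (sym (ℚP.+-inverseʳ q)) 0≤ε)
  ... | above 1≤q eq = subst (λ c →
    ∣ q - c ∣ ≤ ε) (sym eq) (∣nonNeg∣≤ (≤⇒0≤- 1≤q) (≤-by (1ℚ + ε - q) (≤⇒0≤- hi) (e₁ q ε)))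
    where
    e₁ : ∀ q ε → ε ≡ q - 1ℚ + (1ℚ + ε - q)
    e₁ = solve-∀ ℚ-ring

  -- Outside [0, 1] both sides are 0.
  clamp-product : ∀ q → q * (1ℚ - q) ⊔ 0ℚ ≡ clamp q * (1ℚ - clamp q)
  clamp-product q with clamped q
  ... | below q≤0 eq = trans (ℚP.p≤q⇒p⊔q≡q (subst (_≤ 0ℚ) (ℚP.*-comm (1ℚ - q) q) (neg* (≤⇒0≤-
    (ℚP.≤-trans q≤0 0≤1)) q≤0)))
          (sym (cong (λ c → c * (1ℚ - c)) eq))
  ... | within 0≤q q≤1 eq = trans (ℚP.p≥q⇒p⊔q≡p (nonNeg* 0≤q (≤⇒0≤- q≤1))) (sym (cong (λ c → c * (1ℚ - c)) eq))
  ... | above 1≤q eq = trans (ℚP.p≤q⇒p⊔q≡q (neg* (ℚP.≤-trans 0≤1 1≤q) (subst (_≤ 0ℚ) (e₁ q) (ℚP.neg-antimono-≤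
    (≤⇒0≤- 1≤q)))))
          (sym (cong (λ c → c * (1ℚ - c)) eq))
    where
    e₁ : ∀ q → - (q - 1ℚ) ≡ 1ℚ - q
    e₁ = solve-∀ ℚ-ring

  -- The real number 4/π, as `quarter*V` shows.
  Vᵣ : ℝ
  Vᵣ = mkℝ V λ ε 0<ε → combine ε 0<ε (null-recip (ε * ½ * ½) (half>0 (half>0 0<ε)))
    where
    combine : ∀ ε → 0ℚ < ε → (∃ λ N → ∀ n → N ℕ.≤ n → ∣ 1ℚ ÷ ι (suc n) ∣ ≤ ε * ½ * ½) →
              ∃ λ N → ∀ m n → N ℕ.≤ m → N ℕ.≤ n → ∣ V m - V n ∣ < ε
    combine ε 0<ε (N , f) = N , λ m n N≤m N≤n → ℚP.≤-<-trans
        (∣-∣≤-trans {V m} {V N} {V n} (close N≤m) (subst (_≤ ε * ½ * ½) (∣∣-sym (V n) (V N)) (close N≤n)))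
        (subst (_< ε) (sym (half+half (ε * ½))) (half< 0<ε))
      where
      close : ∀ {m} → N ℕ.≤ m → ∣ V m - V N ∣ ≤ ε * ½ * ½
      close N≤m = ℚP.≤-trans (V-close N≤m) (ℚP.≤-trans (p≤∣p∣ (1ℚ ÷ ι (suc N))) (f N ℕP.≤-refl))

  seq-^ : ∀ x k i → seq (x ^ᵣ k) i ≡ seq x i ^ k
  seq-^ x zero    i = refl
  seq-^ x (suc k) i = cong (seq x i *_) (seq-^ x k i)

  seq-legendre : ∀ n x i → seq (legendre n x) i ≡ P n (seq x i)
  seq-legendre zero          x i = refl
  seq-legendre (suc zero)    x i = refl
  seq-legendre (suc (suc n)) x i = cong₂
    (λ p q → + 1 / (2 ℕ.+ n) * (+ (2 ℕ.* n ℕ.+ 3) / 1 * seq x i * p - + (n ℕ.+ 1) / 1 * q))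
    (seq-legendre (suc n) x i) (seq-legendre n x i)

  private
    k : ℕ → ℕ
    k j = suc (double j)

  shifted : ℝ → ℕ → ℚ
  shifted x i = 2ℚ * seq x i - 1ℚ

  seq-partialSum : ∀ j x n i → seq (partialSum (λ n →
    fromℚ (coefficient (suc (double j)) n) *ᵣ legendre (2 ℕ.* n) (fromℕ 2 *ᵣ x -ᵣ fromℕ 1)) n) i ≡
    evenSum (γ j) n (shifted x i)
  seq-partialSum j x zero    i = refl
  seq-partialSum j x (suc n) i = cong₂ _+_ (seq-partialSum j x n i) (cong₂ _*_ (coefficient≡γ j n)
    (trans (seq-legendre (2 ℕ.* n) (fromℕ 2 *ᵣ x -ᵣ fromℕ 1) i) (cong (λ m → P m (shifted x i)) (2*≡double n))))

  ι-^ : ∀ m → ι (4 ℕ.^ m) ≡ 2ℚ ^ m * 2ℚ ^ m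
  ι-^ zero    = refl
  ι-^ (suc m) = trans (ι-* 4 (4 ℕ.^ m)) (trans (cong (4ℚ *_) (ι-^ m)) (eq (2ℚ ^ m)))
    where
    eq : ∀ p → 4ℚ * (p * p) ≡ 2ℚ * p * (2ℚ * p)
    eq = solve-∀ ℚ-ring

  κ-!! : ∀ j → κ j * (ι (k j !!) * ι (k j !!)) ≡ 2ℚ ^ k j
  κ-!! zero    = refl
  κ-!! (suc j) = by₃ (κ (suc j) * (ι (k (suc j) !!) + (2ℚ * ι j + 3ℚ) * ι (k j !!))) (4ℚ * (ι (k j !!) * ι (k j !!))) 4ℚ
      !!-suc (κ-suc j) (κ-!! j) (eq (ι j) (κ j) (κ (suc j)) (ι (k j !!)) (ι (k (suc j) !!)) (2ℚ ^ k j))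
    where
    !!-suc : ι (k (suc j) !!) ≡ (2ℚ * ι j + 3ℚ) * ι (k j !!)
    !!-suc = trans (ι-* (k (suc j)) (k j !!)) (by₁ (ι (k j !!)) (ι-double j) (eq′ (ι j) (ι (double j)) (ι (k j !!))))
      where
      eq′ : ∀ j d u → (1ℚ + (1ℚ + (1ℚ + d))) * u ≡ (2ℚ * j + 3ℚ) * u + u * (d - 2ℚ * j)
      eq′ = solve-∀ ℚ-ring
    eq : ∀ j x x′ u u′ p → x′ * (u′ * u′) ≡ 2ℚ * (2ℚ * p)
      + x′ * (u′ + (2ℚ * j + 3ℚ) * u) * (u′ - (2ℚ * j + 3ℚ) * u)
      + 4ℚ * (u * u) * (x′ * (½ * ½ * ((2ℚ * j + 3ℚ) * (2ℚ * j + 3ℚ))) - x)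
      + 4ℚ * (x * (u * u) - p)
    eq = solve-∀ ℚ-ring

  ratio : ℕ → ℚ
  ratio j = (+ (k j !! ℕ.* k j !!) / 4 ℕ.^ (k j ℕ.+ 1)) {{ℕP.m^n≢0 4 (k j ℕ.+ 1)}}

  -- The rational factors of `prefactor` and of `limit` multiply to 1/4; the missing 4 is the
  -- product of π and `Vᵣ`.
  ratio-inverse : ∀ j → 4ℚ * (ratio j * (κ j * 2ℚ ^ k j)) ≡ 1ℚ
  ratio-inverse j = cancelˡ d (0<⇒≢ (0<ι′ (4 ℕ.^ (k j ℕ.+ 1)) {{ℕP.m^n≢0 4 (k j ℕ.+ 1)}}))
    (by₂ (4ℚ * (κ j * p)) (4ℚ * (κ j * p)) (/-*ι′ (k j !! ℕ.* k j !!) (4 ℕ.^ (k j ℕ.+ 1)) {{ℕP.m^n≢0 4 (k j ℕ.+ 1)}})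
      (ι-* (k j !!) (k j !!))
      (by₂ (4ℚ * p) (- 1ℚ) (κ-!! j) d≡ (eq d (ratio j) (κ j) p (ι (k j !! ℕ.* k j !!)) (ι (k j !!)))))
    where
    d p : ℚ
    d = ι (4 ℕ.^ (k j ℕ.+ 1))
    p = 2ℚ ^ k j
    d≡ : d ≡ 2ℚ * p * (2ℚ * p)
    d≡ = trans (cong (λ m → ι (4 ℕ.^ m)) (ℕP.+-comm (k j) 1)) (ι-^ (suc (k j)))
    eq : ∀ d r κ p s u → d * (4ℚ * (r * (κ * p))) ≡ d * 1ℚ
      + 4ℚ * (κ * p) * (r * d - s) + 4ℚ * (κ * p) * (s - u * u)
      + 4ℚ * p * (κ * (u * u) - p) + - 1ℚ * (d - 2ℚ * p * (2ℚ * p))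
    eq = solve-∀ ℚ-ring

  *-^ : ∀ c r n → (c * r) ^ n ≡ c ^ n * r ^ n
  *-^ c r zero    = refl
  *-^ c r (suc n) = trans (cong (c * r *_) (*-^ c r n)) (eq c r (c ^ n) (r ^ n))
    where
    eq : ∀ c r p q → c * r * (p * q) ≡ c * p * (r * q)
    eq = solve-∀ ℚ-ring

  -- `_ConvergesTo_` contains two tolerances: ε for the limit in n and ε′ from the order on ℝ. The
  -- entry index is chosen after n, so continuity of each single partial sum suffices.
  sums-intro : ∀ a ℓ (s : ℕ → ℕ → ℚ) (t : ℕ → ℚ) → (∀ n i → seq (partialSum a n) i ≡ s n i) → (∀ i → seq ℓ i ≡ t i) →
    (∀ ε → 0ℚ < ε → ∃ λ N → ∀ n → N ℕ.≤ n → ∀ ε′ → 0ℚ < ε′ → ∃ λ I → ∀ i → I ℕ.≤ i → ∣ s n i - t i ∣ ≤ ε + ε′) →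
    a SumsTo ℓ
  sums-intro a ℓ s t s≡ t≡ h ε 0<ε = proj₁ (h ε 0<ε) , λ n N≤n ε′ 0<ε′ →
    proj₁ (proj₂ (h ε 0<ε) n N≤n ε′ 0<ε′) , λ i I≤i →
      subst₂ (λ p q → ∣ p - q ∣ ≤ ε + ε′) (sym (s≡ n i)) (sym (t≡ i)) (proj₂ (proj₂ (h ε 0<ε) n N≤n ε′ 0<ε′) i I≤i)

  ≃-intro : ∀ u v (s t : ℕ → ℚ) → (∀ i → seq u i ≡ s i) → (∀ i → seq v i ≡ t i) → Null (λ i → s i - t i) → u ≃ v
  ≃-intro u v s t s≡ t≡ h ε 0<ε = proj₁ (h (ε * ½) (half>0 0<ε)) , λ n N≤n →
    ℚP.≤-<-trans (subst₂ (λ p q →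
      ∣ p - q ∣ ≤ ε * ½) (sym (s≡ n)) (sym (t≡ n)) (proj₂ (h (ε * ½) (half>0 0<ε)) n N≤n)) (half< 0<ε)

  seq-prefactor : ∀ j ℓ i → seq (prefactor (k j) *ᵣ ℓ) i ≡ leibnizSum i * ratio j * seq ℓ i
  seq-prefactor j ℓ i = refl

  module Point (x : ℝ) (0≤x : fromℕ 0 ≤ᵣ x) (x≤1 : x ≤ᵣ fromℕ 1) where

    root : ℝ
    root = √ (x *ᵣ (fromℕ 1 -ᵣ x))

    R x̄ ȳ : ℕ → ℚ
    R = seq root
    x̄ i = clamp (seq x i)
    ȳ i = 2ℚ * x̄ i - 1ℚ

    radicand : ℕ → ℚ
    radicand i = seq x i * (1ℚ - seq x i) ⊔ 0ℚ

    -- `√` replaces a negative radicand by 0, which is exactly the effect of clamping x. So the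
    -- identity holds at every entry and not only in the limit.
    4radicand≡1-ȳ² : ∀ i → 4ℚ * radicand i ≡ 1ℚ - ȳ i * ȳ i
    4radicand≡1-ȳ² i = trans (cong (4ℚ *_) (clamp-product (seq x i))) (eq (x̄ i))
      where
      eq : ∀ x → 4ℚ * (x * (1ℚ - x)) ≡ 1ℚ - (2ℚ * x - 1ℚ) * (2ℚ * x - 1ℚ)
      eq = solve-∀ ℚ-ring

    0≤radicand : ∀ i → 0ℚ ≤ radicand i
    0≤radicand i = ℚP.p≤q⊔p (seq x i * (1ℚ - seq x i)) 0ℚ

    ȳ²≤1 : ∀ i → ȳ i * ȳ i ≤ 1ℚ
    ȳ²≤1 i = ≤-by (4ℚ * radicand i) (nonNeg* {4ℚ} (0≤/ 4 0) (0≤radicand i)) (by₁ (- 1ℚ) (4radicand≡1-ȳ² i) (eq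
      (ȳ i * ȳ i) (4ℚ * radicand i)))
      where
      eq : ∀ z q → 1ℚ ≡ z + q + - 1ℚ * (q - (1ℚ - z))
      eq = solve-∀ ℚ-ring

    y-ȳ-null : Null (λ i → shifted x i - ȳ i)
    y-ȳ-null = null-cong (λ i → eq (seq x i) (x̄ i)) (null-* 2ℚ x-x̄)
      where
      eq : ∀ x x̄ → 2ℚ * (x - x̄) ≡ 2ℚ * x - 1ℚ - (2ℚ * x̄ - 1ℚ)
      eq = solve-∀ ℚ-ring
      x-x̄ : Null (λ i → seq x i - x̄ i)
      x-x̄ ε 0<ε = combine (0≤x ε 0<ε) (x≤1 ε 0<ε)
        where
        combine : (∃ λ N → ∀ n → N ℕ.≤ n → 0ℚ ≤ seq x n + ε) → (∃ λ N → ∀ n → N ℕ.≤ n → seq x n ≤ 1ℚ + ε) →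
                  ∃ λ N → ∀ n → N ℕ.≤ n → ∣ seq x n - x̄ n ∣ ≤ ε
        combine (M , f) (K , f′) = M ℕ.⊔ K , λ n h →
          clamp-close (seq x n) (ℚP.<⇒≤ 0<ε) (f n (ℕP.m⊔n≤o⇒m≤o M K h)) (f′ n (ℕP.m⊔n≤o⇒n≤o M K h))

    0≤R : ∀ i → 0ℚ ≤ R i
    0≤R i = proj₁ (lower-spec (radicand i) i (0≤radicand i))

    R²≤ : ∀ i → R i * R i ≤ radicand i
    R²≤ i = proj₁ (proj₂ (lower-spec (radicand i) i (0≤radicand i)))

    2R≤1 : ∀ i → 2ℚ * R i ≤ 1ℚ
    2R≤1 i = sq-cancel-≤ {2ℚ * R i} {1ℚ} 0≤1
      (≤-by (4ℚ * (radicand i - R i * R i) + ȳ i * ȳ i) (0≤+ (nonNeg* {4ℚ} (0≤/ 4 0) (≤⇒0≤- (R²≤ i))) (0≤sq (ȳ i)))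
        (by₁ (- 1ℚ) (4radicand≡1-ȳ² i) (eq (R i) (radicand i) (ȳ i * ȳ i))))
      where
      eq : ∀ r q z → 1ℚ * 1ℚ ≡ 2ℚ * r * (2ℚ * r) + (4ℚ * (q - r * r) + z) + - 1ℚ * (4ℚ * q - (1ℚ - z))
      eq = solve-∀ ℚ-ring

    R≤1 : ∀ i → R i ≤ 1ℚ
    R≤1 i = ℚP.≤-trans (≤-by (R i) (0≤R i) (eq (R i))) (2R≤1 i)
      where
      eq : ∀ r → 2ℚ * r ≡ r + r
      eq = solve-∀ ℚ-ring

    radicand≤1 : ∀ i → radicand i ≤ 1ℚ
    radicand≤1 i = cancel-≤ 4ℚ (ℚP.positive⁻¹ 4ℚ) (≤-by (3ℚ + ȳ i * ȳ i) (0≤+ (0≤/ 3 0) (0≤sq (ȳ i)))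
      (by₁ (- 1ℚ) (4radicand≡1-ȳ² i) (eq (radicand i) (ȳ i * ȳ i))))
      where
      eq : ∀ q z → 4ℚ * 1ℚ ≡ 4ℚ * q + (3ℚ + z) + - 1ℚ * (4ℚ * q - (1ℚ - z))
      eq = solve-∀ ℚ-ring

    -- With q the radicand and ω the bisection width at entry i, 4 (q - r²) ≤ 8rω + 4ω² ≤ 16ω, as r
    -- ≤ 1 and ω ≤ 2. Since q ≤ 1, the width is at most 2/(i + 1), whence the constant 32.
    root-null : Null (λ i → 2ℚ * R i * (2ℚ * R i) - (1ℚ - ȳ i * ȳ i))
    root-null = null-rate (+ 32 / 1) rate
      where
      rate : ∀ i → ∣ 2ℚ * R i * (2ℚ * R i) - (1ℚ - ȳ i * ȳ i) ∣ * ι (suc i) ≤ + 32 / 1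
      rate i = ℚP.≤-trans (*-monoʳ (ι (suc i)) (0≤ι (suc i)) close) (≤-by (8ℚ * 2ℚ * (2ℚ - ω * ι (suc i)))
          (nonNeg* {8ℚ * 2ℚ} (0≤/ 16 0) (≤⇒0≤- ω-rate)) (eq₁ ω (ι (suc i))))
        where
        ω q r : ℚ
        q = radicand i
        r = R i
        ω = width q i
        0≤ω : 0ℚ ≤ ω
        0≤ω = ℚP.<⇒≤ (width>0 q i (0≤radicand i))
        ω≤ : ω ≤ + 2 / suc i
        ω≤ = width-bound q 2 i (ℚP.+-monoˡ-≤ 1ℚ (radicand≤1 i))
        ω-rate : ω * ι (suc i) ≤ 2ℚ
        ω-rate = ℚP.≤-trans (*-monoʳ (ι (suc i)) (0≤ι (suc i)) ω≤) (ℚP.≤-reflexive (/-*ι 2 i))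
        ω≤2 : ω ≤ 2ℚ
        ω≤2 = ℚP.≤-trans (≤-by (ω * ι i) (nonNeg* 0≤ω (0≤ι i)) (eq₂ ω (ι i))) ω-rate
          where
          eq₂ : ∀ w n → w * (1ℚ + n) ≡ w + w * n
          eq₂ = solve-∀ ℚ-ring
        q≤ : q ≤ (r + ω) * (r + ω)
        q≤ = ℚP.<⇒≤ (proj₂ (proj₂ (lower-spec q i (0≤radicand i))))
        eq₁ : ∀ w n → + 32 / 1 ≡ 8ℚ * 2ℚ * w * n + 8ℚ * 2ℚ * (2ℚ - w * n)
        eq₁ = solve-∀ ℚ-ring
        z : ℚ
        z = ȳ i * ȳ i
        close : ∣ 2ℚ * r * (2ℚ * r) - (1ℚ - z) ∣ ≤ 8ℚ * 2ℚ * ω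
        close = ∣∣≤-intro
          (≤-by (4ℚ * (q - r * r) + 8ℚ * 2ℚ * ω)
            (0≤+ (nonNeg* {4ℚ} (0≤/ 4 0) (≤⇒0≤- (R²≤ i))) (nonNeg* {8ℚ * 2ℚ} (0≤/ 16 0) 0≤ω))
            (by₁ (- 1ℚ) (4radicand≡1-ȳ² i) (e₁ r q ω z)))
          (≤-by (4ℚ * ((r + ω) * (r + ω) - q) + (8ℚ * ω * (1ℚ - r) + 4ℚ * ω * (2ℚ - ω)))
            (0≤+ (nonNeg* {4ℚ} (0≤/ 4 0) (≤⇒0≤- q≤))
              (0≤+ (nonNeg* (nonNeg* {8ℚ} (0≤/ 8 0) 0≤ω) (≤⇒0≤- (R≤1 i))) (nonNeg* (nonNeg* {4ℚ} (0≤/ 4 0) 0≤ω)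
                (≤⇒0≤- ω≤2))))
            (by₁ 1ℚ (4radicand≡1-ȳ² i) (e₂ r q ω z)))
          where
          e₁ : ∀ r q w z → 8ℚ * 2ℚ * w ≡
            2ℚ * r * (2ℚ * r) - (1ℚ - z) + (4ℚ * (q - r * r) + 8ℚ * 2ℚ * w) + - 1ℚ * (4ℚ * q - (1ℚ - z))
          e₁ = solve-∀ ℚ-ring
          e₂ : ∀ r q w z → 8ℚ * 2ℚ * w ≡ - (2ℚ * r * (2ℚ * r) - (1ℚ - z))
            + (4ℚ * ((r + w) * (r + w) - q) + (8ℚ * w * (1ℚ - r) + 4ℚ * w * (2ℚ - w))) + 1ℚ * (4ℚ * q - (1ℚ - z))
          e₂ = solve-∀ ℚ-ring

    module _ (j : ℕ) where

      private
        c : ℚ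
        c = κ j * 2ℚ ^ k j

      -- The power divided by `prefactor`, with `Vᵣ` for 4/π. The factor 2ᵏ in `c` enters because
      -- `2ℚ * R i`, not `R i`, approximates √(1 - y²).
      limit : ℝ
      limit = root ^ᵣ k j *ᵣ (fromℚ c *ᵣ Vᵣ)

      limit-seq : ∀ i → seq limit i ≡ κ j * V i * (2ℚ * R i) ^ k j
      limit-seq i = trans (cong (_* (c * V i)) (seq-^ root (k j) i))
        (trans (eq (κ j) (V i) (2ℚ ^ k j) (R i ^ k j)) (cong (κ j * V i *_) (sym (*-^ 2ℚ (R i) (k j)))))
        where
        eq : ∀ κ v p r → r * (κ * p * v) ≡ κ * v * (p * r)
        eq = solve-∀ ℚ-ring

      target : ℕ → ℚ
      target i = κ j * V i * (2ℚ * R i) ^ k j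

      private
        -- Three moves: from the entry of x to its clamped value, then `Approximates` with the fixed
        -- V n, then from V n to the entry V i of the limit. The last one needs n ≤ i.
        close : ∀ {ε ε′ δ} n i → n ℕ.≤ i →
          (∀ y r → y * y ≤ 1ℚ → 0ℚ ≤ r → r ≤ 1ℚ → ∣ r * r - (1ℚ - y * y) ∣ ≤ δ →
            ∣ evenSum (γ j) (suc n) y - κ j * V n * r ^ k j ∣ ≤ ε * ½) →
          κ j * (1ℚ ÷ ι (suc n)) ≤ ε * ½ →
          ∣ evenSum (γ j) (suc n) (shifted x i) - evenSum (γ j) (suc n) (ȳ i) ∣ ≤ ε′ →
          ∣ 2ℚ * R i * (2ℚ * R i) - (1ℚ - ȳ i * ȳ i) ∣ ≤ δ → ∣ evenSum (γ j) (suc n) (shifted x i) - target i ∣ ≤ ε + ε′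
        close {ε} {ε′} n i n≤i f f′ h₁ h₂ = subst (∣ s₀ - target i ∣ ≤_) (trans (cong (λ e →
          ε′ + e) (half+half ε)) (ℚP.+-comm ε′ ε))
            (∣-∣≤-trans {s₀} {s₁} {target i} h₁ (∣-∣≤-trans {s₁} {κ j * V n * p} {target i}
              (f (ȳ i) r (ȳ²≤1 i) 0≤r (2R≤1 i) h₂) V-step))
          where
          s₀ s₁ r p : ℚ
          s₀ = evenSum (γ j) (suc n) (shifted x i)
          s₁ = evenSum (γ j) (suc n) (ȳ i)
          r = 2ℚ * R i
          p = r ^ k j
          0≤r : 0ℚ ≤ r
          0≤r = 0≤2* (0≤R i)
          ∣p∣≤1 : ∣ p ∣ ≤ 1ℚ
          ∣p∣≤1 = ∣nonNeg∣≤ (0≤^ (k j) 0≤r) (^≤1 (k j) 0≤r (2R≤1 i))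
          eq : ∀ κ v u p → κ * (u - v) * p ≡ κ * u * p - κ * v * p
          eq = solve-∀ ℚ-ring
          V-step : ∣ κ j * V n * p - κ j * V i * p ∣ ≤ ε * ½
          V-step = ℚP.≤-trans (subst₂ _≤_ (cong ∣_∣ (eq (κ j) (V i) (V n) p)) (ℚP.*-identityʳ (κ j * (1ℚ ÷ ι (suc n))))
              (∣*∣≤ {κ j * (V n - V i)} {p} (∣*∣≤ {κ j} {V n - V i} (∣nonNeg∣≤ (0≤κ j) ℚP.≤-refl)
                (subst (_≤ 1ℚ ÷ ι (suc n)) (∣∣-sym (V i) (V n)) (V-close n≤i))) ∣p∣≤1))
            f′

      evenSums-converge : ∀ ε → 0ℚ < ε → ∃ λ N → ∀ n → N ℕ.≤ n → ∀ ε′ → 0ℚ < ε′ → ∃ λ I → ∀ i → I ℕ.≤ i →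
        ∣ evenSum (γ j) n (shifted x i) - target i ∣ ≤ ε + ε′
      evenSums-converge ε 0<ε = combine (approximates j (ε * ½) (half>0 0<ε)) (null-* (κ j) null-recip (ε * ½)
        (half>0 0<ε))
        where
        combine : (∃ λ N → ∃ λ δ → 0ℚ < δ × (∀ n → N ℕ.≤ n → ∀ y r → y * y ≤ 1ℚ → 0ℚ ≤ r → r ≤ 1ℚ →
            ∣ r * r - (1ℚ - y * y) ∣ ≤ δ → ∣ evenSum (γ j) (suc n) y - κ j * V n * r ^ k j ∣ ≤ ε * ½)) →
          (∃ λ N → ∀ n → N ℕ.≤ n → ∣ κ j * (1ℚ ÷ ι (suc n)) ∣ ≤ ε * ½) →
          ∃ λ N → ∀ n → N ℕ.≤ n → ∀ ε′ → 0ℚ < ε′ → ∃ λ I → ∀ i → I ℕ.≤ i →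
            ∣ evenSum (γ j) n (shifted x i) - target i ∣ ≤ ε + ε′
        -- `Approximates` concerns sums of `suc n` terms, hence the successor in the threshold.
        combine (M , δ , 0<δ , f) (K , f′) = suc (M ℕ.⊔ K) , bound
          where
          bound : ∀ n → suc (M ℕ.⊔ K) ℕ.≤ n → ∀ ε′ → 0ℚ < ε′ → ∃ λ I → ∀ i → I ℕ.≤ i →
            ∣ evenSum (γ j) n (shifted x i) - target i ∣ ≤ ε + ε′
          bound (suc n) (ℕ.s≤s h) ε′ 0<ε′ = finish (evenSum-continuous (γ j) {shifted x} {ȳ} ȳ²≤1 y-ȳ-null
            (suc n) ε′ 0<ε′) (root-null δ 0<δ)
            where
            finish : (∃ λ I → ∀ i → I ℕ.≤ i →
              ∣ evenSum (γ j) (suc n) (shifted x i) - evenSum (γ j) (suc n) (ȳ i) ∣ ≤ ε′) →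
              (∃ λ I → ∀ i → I ℕ.≤ i → ∣ 2ℚ * R i * (2ℚ * R i) - (1ℚ - ȳ i * ȳ i) ∣ ≤ δ) →
              ∃ λ I → ∀ i → I ℕ.≤ i → ∣ evenSum (γ j) (suc n) (shifted x i) - target i ∣ ≤ ε + ε′
            finish (I , u) (I′ , u′) = n ℕ.⊔ (I ℕ.⊔ I′) , λ i hi →
              close {ε} {ε′} {δ} n i (ℕP.m⊔n≤o⇒m≤o n (I ℕ.⊔ I′) hi)
                (f n (ℕP.m⊔n≤o⇒m≤o M K h))
                (ℚP.≤-trans (p≤∣p∣ (κ j * (1ℚ ÷ ι (suc n)))) (f′ n (ℕP.m⊔n≤o⇒n≤o M K h)))
                (u i (ℕP.m⊔n≤o⇒m≤o I I′ (ℕP.m⊔n≤o⇒n≤o n (I ℕ.⊔ I′) hi)))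
                (u′ i (ℕP.m⊔n≤o⇒n≤o I I′ (ℕP.m⊔n≤o⇒n≤o n (I ℕ.⊔ I′) hi)))

      sums : (λ n → fromℚ (coefficient (suc (double j)) n) *ᵣ legendre (2 ℕ.* n) (fromℕ 2 *ᵣ x -ᵣ fromℕ 1)) SumsTo limit
      sums = sums-intro (λ n → fromℚ (coefficient (suc (double j)) n) *ᵣ legendre (2 ℕ.* n)
        (fromℕ 2 *ᵣ x -ᵣ fromℕ 1)) limit (λ n i → evenSum (γ j) n (shifted x i)) target
        (seq-partialSum j x) limit-seq evenSums-converge

      private
        p : ℕ → ℚ
        p = seq (root ^ᵣ k j)

      -- As `leibnizSum i` is 4 `quarter i`, `ratio-inverse` turns the difference into -p i
      -- (`quarter i` V i - 1) with p bounded by 1.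
      difference-null : Null (λ i → p i - leibnizSum i * ratio j * (p i * (c * V i)))
      difference-null = null-cong rewriting (null-bounded* {λ i → - p i} {λ i →
        quarter i * V i - 1ℚ} 1ℚ ∣p∣≤1 quarter*V)
        where
        ∣p∣≤1 : ∀ i → ∣ - p i ∣ ≤ 1ℚ
        ∣p∣≤1 i = subst (_≤ 1ℚ) (sym (ℚP.∣-p∣≡∣p∣ (p i))) (subst (λ z → ∣ z ∣ ≤ 1ℚ) (sym (seq-^ root (k j) i))
          (∣nonNeg∣≤ (0≤^ (k j) (0≤R i)) (^≤1 (k j) (0≤R i) (R≤1 i))))
        eq : ∀ p q v L r c → (- p) * (q * v - 1ℚ) ≡
          p - L * r * (p * (c * v)) + r * (p * (c * v)) * (L - 4ℚ * q) + p * q * v * (4ℚ * (r * c) - 1ℚ)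
        eq = solve-∀ ℚ-ring
        rewriting : ∀ i → (- p i) * (quarter i * V i - 1ℚ) ≡ p i - leibnizSum i * ratio j * (p i * (c * V i))
        rewriting i = by₂ (ratio j * (p i * (c * V i))) (p i * quarter i * V i) (leibnizSum≡ i) (ratio-inverse j)
          (eq (p i) (quarter i) (V i) (leibnizSum i) (ratio j) c)

      power-eq : (x *ᵣ (fromℕ 1 -ᵣ x)) ^[ suc (double j) /2] ≃ prefactor (suc (double j)) *ᵣ limit
      power-eq = ≃-intro (root ^ᵣ k j) (prefactor (k j) *ᵣ limit) p (λ i → leibnizSum i * ratio j * (p i * (c * V i)))
        (λ _ → refl) (seq-prefactor j limit) difference-null

  parity : ∀ k → (∃ λ j → k ≡ double j) ⊎ (∃ λ j → k ≡ suc (double j))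
  parity zero = inj₁ (zero , refl)
  parity (suc k) with parity k
  ... | inj₁ (j , eq) = inj₂ (j , cong suc eq)
  ... | inj₂ (j , eq) = inj₁ (suc j , cong suc eq)

  odd : ∀ k → ¬ (2 ∣ k) → ∃ λ j → k ≡ suc (double j)
  odd k 2∤k with parity k
  ... | inj₁ (j , eq) = contradiction (divides j (trans eq (trans (sym (2*≡double j)) (ℕP.*-comm 2 j)))) 2∤k
  ... | inj₂ h = h

open import Defs
open LegendrePolynomials using (double)
open Reals using (odd; module Point)

expansion : ∀ k → (∃ λ j → k ≡ suc (double j)) → (x : ℝ) → fromℕ 0 ≤ x → x ≤ fromℕ 1 →
    ∃ λ S → (λ n → fromℚ (coefficient k n) * legendre (2 ℕ.* n) (fromℕ 2 * x - fromℕ 1)) SumsTo S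
    × (x * (fromℕ 1 - x)) ^[ k /2] ≃ prefactor k * S
expansion .(suc (double j)) (j , refl) x 0≤x x≤1 =
  Point.limit x 0≤x x≤1 j , Point.sums x 0≤x x≤1 j , Point.power-eq x 0≤x x≤1 j

theorem1 : (k : ℕ) → ¬ (2 ∣ k) → (x : ℝ) → fromℕ 0 ≤ x → x ≤ fromℕ 1 →
    ∃ λ S → (λ n → fromℚ (coefficient k n) * legendre (2 ℕ.* n) (fromℕ 2 * x - fromℕ 1)) SumsTo S
    × (x * (fromℕ 1 - x)) ^[ k /2] ≃ prefactor k * S
theorem1 k 2∤k = expansion k (odd k 2∤k)
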